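{- Let $\alpha^*\approx 0.357403$ be the unique solution in $[0,1]$ of $\frac{4}{e}\,\alpha\, e^{1-\alpha}=1$. For every $\alpha$ with $0\le\alpha<\alpha^*$ there are constants $C,c>0$ and $n_0$, depending only on $\alpha$, such that for every $n\ge n_0$ for which $m=\alpha n$ is an integer the following holds. When $m+1$ distinct keys are inserted one after another into an initially empty table with $n$ slots by quadratic probing with a uniformly random hash function, there is an event $E$ (determined by the hash values) with $\Pr[E]\ge 1-\exp(-c\sqrt n)$ such that on $E$ all $m+1$ insertions succeed, and conditioned on $E$ the expected cost of the $(m+1)$th insertion is at most $C$.
   Context: Quadratic probing: the table is an array $A[0],\ldots,A[n-1]$, every slot of which is initially empty. The hash function $h$ maps keys to $\{0,1,\ldots,n-1\}$; it is uniformly random, i.e. the hash values of distinct keys are independent and uniform, and the sequence of keys inserted is fixed independently of $h$. To insert a key $x$, find the minimum $i\ge 0$ such that slot $A[(h(x)+i^2)\bmod n]$ is empty and store $x$ there; the cost of the insertion is $i+1$ (the number of slots probed). The insertion fails if no such $i$ exists (this is possible because $(i^2 \bmod n)_{i\ge0}$ need not take all values in $\{0,\ldots,n-1\}$). Keys are never moved after insertion. The load factor is $\alpha=m/n$. -}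

module Defs where

open import Data.Bool.Base using (Bool; T)
open import Data.Empty using (⊥-elim)
open import Data.Fin.Base as Fin using (Fin; toℕ; inject₁)
open import Data.Fin.Properties using (toℕ-injective; toℕ-fromℕ<)
open import Data.Integer.Base as ℤ using (+_; -[1+_])
import Data.Integer.Properties as ℤP
open import Data.List.Base using (List; []; _∷_; length; map; filterᵇ; allFin; cartesianProductWith)
open import Data.List.Membership.Propositional using (_∈_)
open import Data.List.Membership.Propositional.Properties using (∈-cartesianProductWith⁺; ∈-allFin)
open import Data.List.Relation.Unary.Any using (here)
open import Data.List.Relation.Unary.All using ([])
open import Data.List.Relation.Unary.Unique.Propositional using (Unique; []; _∷_)
open import Data.List.Relation.Unary.Unique.Propositional.Properties using (allFin⁺; cartesianProductWith⁺)
open import Data.Maybe.Base as Maybe using (Maybe; just; nothing; maybe; _>>=_)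
open import Data.Nat.Base as ℕ using (ℕ; zero; suc; NonZero; _!)
open import Data.Nat.DivMod using (_mod_; _%_; m%n<n; %-distribˡ-+; %-distribˡ-*)
open import Data.Nat.ListAction using (sum)
import Data.Nat.Properties as ℕP
open import Data.Product.Base using (∃; _×_; _,_; proj₁; proj₂)
open import Data.Rational.Base as ℚ using (ℚ; 0ℚ; 1ℚ; ½; ∣_∣; _+_; _*_; _-_; -_; _/_; _<_; _≤_)
import Data.Rational.Properties as ℚP
open import Data.Rational.Solver using (module +-*-Solver)
import Data.Rational.Unnormalised.Base as ℚᵘ
import Data.Rational.Unnormalised.Properties as ℚᵘP
open import Data.Sum.Base using (inj₁; inj₂)
open import Data.Vec.Base using (Vec; []; _∷_; lookup; replicate; _[_]≔_)
open import Data.Vec.Properties using (∷-injective)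
open import Relation.Binary.PropositionalEquality using (_≡_; refl; sym; trans; cong; cong₂; subst; subst₂)
open import Relation.Nullary using (¬_; yes; no)
open import Algebra.Definitions.RawSemiring ℚ.+-*-rawSemiring using (_^_)

fromℕ : ℕ → ℚ
fromℕ n = + n / 1

module RationalLemmas where

  open +-*-Solver using (solve; _:=_; _:+_; _:*_; _:-_; :-_; con)

  *-pos : ∀ {p q} → 0ℚ < p → 0ℚ < q → 0ℚ < p * q
  *-pos {p} {q} hp hq = ℚP.positive⁻¹ (p * q) {{ℚP.pos*pos⇒pos p {{ℚ.positive hp}} q {{ℚ.positive hq}}}}

  *-nonNeg : ∀ {p q} → 0ℚ ≤ p → 0ℚ ≤ q → 0ℚ ≤ p * q
  *-nonNeg {p} {q} hp hq = ℚP.nonNegative⁻¹ (p * q) {{ℚP.nonNeg*nonNeg⇒nonNeg p {{ℚ.nonNegative hp}} q {{ℚ.nonNegative hq}}}}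

  +-nonNeg : ∀ {p q} → 0ℚ ≤ p → 0ℚ ≤ q → 0ℚ ≤ p + q
  +-nonNeg hp hq = ℚP.+-mono-≤ hp hq

  *-monoˡ : ∀ {p q} r → 0ℚ ≤ r → p ≤ q → r * p ≤ r * q
  *-monoˡ r hr = ℚP.*-monoˡ-≤-nonNeg r {{ℚ.nonNegative hr}}

  *-mono : ∀ {p q r s} → 0ℚ ≤ p → 0ℚ ≤ s → p ≤ q → r ≤ s → p * r ≤ q * s
  *-mono {p} {q} {r} {s} hp hs pq rs =
    ℚP.≤-trans (*-monoˡ p hp rs) (ℚP.*-monoʳ-≤-nonNeg s {{ℚ.nonNegative hs}} pq)

  ∣-∣-mono-* : ∀ {a b c d} → ∣ a ∣ ≤ c → ∣ b ∣ ≤ d → 0ℚ ≤ d → ∣ a * b ∣ ≤ c * d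
  ∣-∣-mono-* {a} {b} {c} {d} ac bd hd =
    ℚP.≤-trans (ℚP.≤-reflexive (ℚP.∣p*q∣≡∣p∣*∣q∣ a b)) (*-mono (ℚP.0≤∣p∣ a) hd ac bd)

  ∣-∣-mono-+ : ∀ {a b c d} → ∣ a ∣ ≤ c → ∣ b ∣ ≤ d → ∣ a + b ∣ ≤ c + d
  ∣-∣-mono-+ {a} {b} ac bd = ℚP.≤-trans (ℚP.∣p+q∣≤∣p∣+∣q∣ a b) (ℚP.+-mono-≤ ac bd)

  ∣-∣-flip : ∀ a b → ∣ a - b ∣ ≡ ∣ b - a ∣
  ∣-∣-flip a b = trans (sym (ℚP.∣-p∣≡∣p∣ (a - b))) (cong ∣_∣ (solve 2 (λ x y → :- (x :- y) := y :- x) refl a b))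

  ≤⇒∣-∣≤ : ∀ {a b e} → a ≤ b + e → b ≤ a + e → ∣ a - b ∣ ≤ e
  ≤⇒∣-∣≤ {a} {b} {e} h₁ h₂ with ℚP.∣p∣≡p∨∣p∣≡-p (a - b)
  ... | inj₁ eq = subst (_≤ e) (sym eq)
        (subst (a - b ≤_) (solve 2 (λ x y → (x :+ y) :- x := y) refl b e) (ℚP.+-monoˡ-≤ (- b) h₁))
  ... | inj₂ eq = subst (_≤ e) (sym eq)
        (subst₂ _≤_ (solve 2 (λ x y → y :- x := :- (x :- y)) refl a b)
                    (solve 2 (λ x y → (x :+ y) :- x := y) refl a e) (ℚP.+-monoˡ-≤ (- a) h₂))

  0<1 : 0ℚ < 1ℚ
  0<1 = ℚP.positive⁻¹ 1ℚ

  0<½ : 0ℚ < ½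
  0<½ = ℚP.positive⁻¹ ½

  halves : ∀ p → ½ * p + ½ * p ≡ p
  halves = solve 1 (λ x → con ½ :* x :+ con ½ :* x := x) refl

  half-pos : ∀ {p} → 0ℚ < p → 0ℚ < ½ * p
  half-pos = *-pos 0<½

  inv : ∀ p → 0ℚ < p → ℚ
  inv p hp = (ℚ.1/ p) {{ℚ.>-nonZero hp}}

  inv-pos : ∀ p (hp : 0ℚ < p) → 0ℚ < inv p hp
  inv-pos p hp = ℚP.positive⁻¹ _ {{ℚP.1/pos⇒pos p {{ℚ.positive hp}}}}

  *-inv : ∀ p (hp : 0ℚ < p) → p * inv p hp ≡ 1ℚ
  *-inv p hp = ℚP.*-inverseʳ p {{ℚ.>-nonZero hp}}

  toℚᵘ-/ : ∀ i n .{{_ : NonZero n}} → ℚ.toℚᵘ (i / n) ℚᵘ.≃ (i ℚᵘ./ n)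
  toℚᵘ-/ i (suc n) = ℚP.toℚᵘ-fromℚᵘ (i ℚᵘ./ suc n)

  /-mono-≤ : ∀ a m b n .{{_ : NonZero m}} .{{_ : NonZero n}} → a ℕ.* n ℕ.≤ b ℕ.* m → + a / m ≤ + b / n
  /-mono-≤ a m@(suc _) b n@(suc _) h = ℚP.toℚᵘ-cancel-≤
    (ℚᵘP.≤-respˡ-≃ (ℚᵘP.≃-sym (toℚᵘ-/ (+ a) m)) (ℚᵘP.≤-respʳ-≃ (ℚᵘP.≃-sym (toℚᵘ-/ (+ b) n))
      (ℚᵘ.*≤* (subst₂ ℤ._≤_ (ℤP.pos-* a n) (ℤP.pos-* b m) (ℤ.+≤+ h)))))

  /-nonNeg : ∀ a m .{{_ : NonZero m}} → 0ℚ ≤ + a / m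
  /-nonNeg a m = /-mono-≤ 0 1 a m ℕ.z≤n

  /-+ : ∀ a b n .{{_ : NonZero n}} → + (a ℕ.+ b) / n ≡ + a / n + + b / n
  /-+ a b n@(suc n-1) = ℚP.toℚᵘ-injective
    (ℚᵘP.≃-trans (toℚᵘ-/ (+ (a ℕ.+ b)) n)
    (ℚᵘP.≃-trans (ℚᵘ.*≡* (eq (+ a) (+ b) (+ n)))
    (ℚᵘP.≃-trans (ℚᵘP.≃-sym (ℚᵘP.+-cong (toℚᵘ-/ (+ a) n) (toℚᵘ-/ (+ b) n)))
                 (ℚᵘP.≃-sym (ℚP.toℚᵘ-homo-+ (+ a / n) (+ b / n))))))
    where
    eq : ∀ x y z → (x ℤ.+ y) ℤ.* (z ℤ.* z) ≡ (x ℤ.* z ℤ.+ y ℤ.* z) ℤ.* z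
    eq x y z = trans (sym (ℤP.*-assoc (x ℤ.+ y) z z)) (cong (ℤ._* z) (ℤP.*-distribʳ-+ z x y))

  /-cancel : ∀ m n .{{_ : NonZero m}} .{{_ : NonZero n}} .{{_ : NonZero (m ℕ.* n)}} →
             fromℕ m * (+ 1 / (m ℕ.* n)) ≡ + 1 / n
  /-cancel m@(suc _) n@(suc _) = ℚP.toℚᵘ-injective
    (ℚᵘP.≃-trans (ℚP.toℚᵘ-homo-* (fromℕ m) (+ 1 / (m ℕ.* n)))
    (ℚᵘP.≃-trans (ℚᵘP.*-cong (toℚᵘ-/ (+ m) 1) (toℚᵘ-/ (+ 1) (m ℕ.* n)))
    (ℚᵘP.≃-trans (ℚᵘ.*≡* eq) (ℚᵘP.≃-sym (toℚᵘ-/ (+ 1) n)))))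
    where
    eq : (+ m ℤ.* + 1) ℤ.* + n ≡ + 1 ℤ.* (+ 1 ℤ.* + (m ℕ.* n))
    eq = trans (cong (ℤ._* + n) (ℤP.*-identityʳ (+ m)))
        (trans (sym (ℤP.pos-* m n))
        (sym (trans (ℤP.*-identityˡ _) (ℤP.*-identityˡ _))))

  fromℕ-mono : ∀ {m n} → m ℕ.≤ n → fromℕ m ≤ fromℕ n
  fromℕ-mono {m} {n} h = /-mono-≤ m 1 n 1 (ℕP.*-monoˡ-≤ 1 h)

  fromℕ-suc : ∀ n → fromℕ (suc n) ≡ fromℕ n + 1ℚ
  fromℕ-suc n = trans (cong fromℕ (ℕP.+-comm 1 n)) (/-+ n 1 1)

  fromℕ-nonNeg : ∀ n → 0ℚ ≤ fromℕ n
  fromℕ-nonNeg n = /-nonNeg n 1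

  fromℕ-suc-pos : ∀ n → 0ℚ < fromℕ (suc n)
  fromℕ-suc-pos n = ℚP.<-≤-trans 0<1 (fromℕ-mono (ℕ.s≤s (ℕ.z≤n {n})))

  archimedean : ∀ q → ∃ λ m → q ≤ fromℕ m
  archimedean q@(ℚ.mkℚ (+ a) d _) = a , ℚP.toℚᵘ-cancel-≤ (ℚᵘP.≤-respʳ-≃ (ℚᵘP.≃-sym (toℚᵘ-/ (+ a) 1))
    (ℚᵘ.*≤* (subst₂ ℤ._≤_ (ℤP.pos-* a 1) (ℤP.pos-* a (suc d)) (ℤ.+≤+ (ℕP.*-monoʳ-≤ a (ℕ.s≤s ℕ.z≤n))))))
  archimedean q@(ℚ.mkℚ -[1+ _ ] _ _) = 0 , ℚP.<⇒≤ (ℚP.negative⁻¹ q)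

  /-small : ∀ {ε} → 0ℚ < ε → ∃ λ n → + 1 / suc n < ε
  /-small {ε} hε with archimedean (inv ε hε)
  ... | n , h = n , ℚP.*-cancelˡ-<-nonNeg (fromℕ (suc n)) {{ℚ.nonNegative (fromℕ-nonNeg (suc n))}} lt
    where
    e₁ : fromℕ (suc n) * (+ 1 / suc n) ≡ 1ℚ
    e₁ = subst (λ k → .{{_ : NonZero k}} → fromℕ (suc n) * (+ 1 / k) ≡ 1ℚ) (ℕP.*-identityʳ (suc n)) (/-cancel (suc n) 1)
    lt : fromℕ (suc n) * (+ 1 / suc n) < fromℕ (suc n) * ε
    lt = subst₂ _<_ (sym e₁) refl
      (ℚP.≤-<-trans (ℚP.≤-trans (ℚP.≤-reflexive (sym (trans (ℚP.*-comm (inv ε hε) ε) (*-inv ε hε))))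
                               (ℚP.*-monoʳ-≤-nonNeg ε {{ℚ.nonNegative (ℚP.<⇒≤ hε)}} h))
                    (ℚP.*-monoˡ-<-pos ε {{ℚ.positive hε}}
                      (subst (fromℕ n <_) (sym (fromℕ-suc n))
                        (subst (_< fromℕ n + 1ℚ) (ℚP.+-identityʳ (fromℕ n)) (ℚP.+-monoʳ-< (fromℕ n) 0<1)))))

Cauchy : (ℕ → ℚ) → Set
Cauchy x = ∀ ε → 0ℚ < ε → ∃ λ N → ∀ i j → N ℕ.≤ i → N ℕ.≤ j → ∣ x i - x j ∣ < ε

-- Real numbers as Cauchy sequences of rationals, with _≃ᴿ_ below as their equality.
record ℝ : Set where
  constructor mkℝ
  field
    seq    : ℕ → ℚ
    cauchy : Cauchy seq

open ℝ public

module CauchyLemmas where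

  open RationalLemmas
  open +-*-Solver using (solve; _:=_; _:+_; _:*_; _:-_; :-_; con)

  -- A sequence whose increments are dominated by those of two Cauchy sequences is Cauchy.
  dominated : ∀ u x y K → 0ℚ < K → (N : ℕ) →
              (∀ i j → N ℕ.≤ i → N ℕ.≤ j → ∣ u i - u j ∣ ≤ K * (∣ x i - x j ∣ + ∣ y i - y j ∣)) →
              Cauchy x → Cauchy y → Cauchy u
  dominated u x y K hK N₀ h cx cy ε hε = M , bound
    where
    δ = ½ * (ε * inv K hK)
    hδ : 0ℚ < δ
    hδ = half-pos (*-pos hε (inv-pos K hK))
    Nx = proj₁ (cx δ hδ)
    Ny = proj₁ (cy δ hδ)
    M = N₀ ℕ.+ (Nx ℕ.+ Ny)
    M≥N₀ : N₀ ℕ.≤ M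
    M≥N₀ = ℕP.m≤m+n N₀ _
    M≥Nx : Nx ℕ.≤ M
    M≥Nx = ℕP.≤-trans (ℕP.m≤m+n Nx Ny) (ℕP.m≤n+m _ N₀)
    M≥Ny : Ny ℕ.≤ M
    M≥Ny = ℕP.≤-trans (ℕP.m≤n+m Ny Nx) (ℕP.m≤n+m _ N₀)
    K*δ : K * (δ + δ) ≡ ε
    K*δ = trans (cong (K *_) (halves (ε * inv K hK)))
         (trans (solve 3 (λ k e r → k :* (e :* r) := e :* (k :* r)) refl K ε (inv K hK))
         (trans (cong (ε *_) (*-inv K hK)) (ℚP.*-identityʳ ε)))
    bound : ∀ i j → M ℕ.≤ i → M ℕ.≤ j → ∣ u i - u j ∣ < ε
    bound i j hi hj = ℚP.≤-<-trans
      (h i j (ℕP.≤-trans M≥N₀ hi) (ℕP.≤-trans M≥N₀ hj))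
      (subst (K * (∣ x i - x j ∣ + ∣ y i - y j ∣) <_) K*δ
        (ℚP.*-monoʳ-<-pos K {{ℚ.positive hK}}
          (ℚP.+-mono-< (proj₂ (cx δ hδ) i j (ℕP.≤-trans M≥Nx hi) (ℕP.≤-trans M≥Nx hj))
                       (proj₂ (cy δ hδ) i j (ℕP.≤-trans M≥Ny hi) (ℕP.≤-trans M≥Ny hj)))))

  bounded : ∀ x → Cauchy x → ∃ λ B → 0ℚ < B × ∃ λ N → ∀ i → N ℕ.≤ i → ∣ x i ∣ ≤ B
  bounded x cx = ∣ x N ∣ + 1ℚ , ℚP.+-mono-≤-< (ℚP.0≤∣p∣ (x N)) 0<1 , N , λ i hi →
    subst (λ q → ∣ q ∣ ≤ ∣ x N ∣ + 1ℚ) (solve 2 (λ a b → a :+ (b :- a) := b) refl (x N) (x i))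
      (∣-∣-mono-+ {x N} {x i - x N} ℚP.≤-refl (ℚP.<⇒≤ (proj₂ (cx 1ℚ 0<1) i N hi ℕP.≤-refl)))
    where
    N = proj₁ (cx 1ℚ 0<1)

  const-cauchy : ∀ q → Cauchy (λ _ → q)
  const-cauchy q ε hε = 0 , λ _ _ _ _ → subst (λ r → ∣ r ∣ < ε) (sym (ℚP.+-inverseʳ q)) hε

  +-cauchy : ∀ x y → Cauchy x → Cauchy y → Cauchy (λ k → x k + y k)
  +-cauchy x y = dominated (λ k → x k + y k) x y 1ℚ 0<1 0 λ i j _ _ →
    subst₂ _≤_
      (cong ∣_∣ (solve 4 (λ a b c d → (a :- b) :+ (c :- d) := (a :+ c) :- (b :+ d)) refl (x i) (x j) (y i) (y j)))
      (sym (ℚP.*-identityˡ _))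
      (ℚP.∣p+q∣≤∣p∣+∣q∣ (x i - x j) (y i - y j))

  neg-cauchy : ∀ x → Cauchy x → Cauchy (λ k → - x k)
  neg-cauchy x cx ε hε with cx ε hε
  ... | N , h = N , λ i j hi hj → subst (_< ε)
    (trans (∣-∣-flip (x i) (x j)) (cong ∣_∣ (solve 2 (λ a b → b :- a := (:- a) :- (:- b)) refl (x i) (x j))))
    (h i j hi hj)

  cross-≤ : ∀ A B p q → 0ℚ ≤ A → 0ℚ ≤ B → 0ℚ ≤ p → 0ℚ ≤ q → A * q + p * B ≤ (A + B) * (p + q)
  cross-≤ A B p q hA hB hp hq = subst₂ _≤_ (ℚP.+-identityʳ (A * q + p * B)) (expand A B p q)
    (ℚP.+-monoʳ-≤ (A * q + p * B) (+-nonNeg {A * p} {B * q} (*-nonNeg hA hp) (*-nonNeg hB hq)))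
    where
    expand : ∀ A B p q → (A * q + p * B) + (A * p + B * q) ≡ (A + B) * (p + q)
    expand = solve 4 (λ A B p q → (A :* q :+ p :* B) :+ (A :* p :+ B :* q) := (A :+ B) :* (p :+ q)) refl

  ∣*-*∣≤ : ∀ a b c d A B → ∣ a ∣ ≤ A → ∣ d ∣ ≤ B → 0ℚ ≤ A → 0ℚ ≤ B →
           ∣ a * c - b * d ∣ ≤ (A + B) * (∣ a - b ∣ + ∣ c - d ∣)
  ∣*-*∣≤ a b c d A B ha hd hA hB = ℚP.≤-trans
    (subst (λ r → ∣ r ∣ ≤ A * ∣ c - d ∣ + ∣ a - b ∣ * B) (split a b c d)
      (∣-∣-mono-+ {a * (c - d)} {(a - b) * d} {A * ∣ c - d ∣} {∣ a - b ∣ * B}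
        (∣-∣-mono-* {a} {c - d} {A} {∣ c - d ∣} ha ℚP.≤-refl (ℚP.0≤∣p∣ (c - d)))
        (∣-∣-mono-* {a - b} {d} {∣ a - b ∣} {B} ℚP.≤-refl hd hB)))
    (cross-≤ A B ∣ a - b ∣ ∣ c - d ∣ hA hB (ℚP.0≤∣p∣ (a - b)) (ℚP.0≤∣p∣ (c - d)))
    where
    split : ∀ a b c d → a * (c - d) + (a - b) * d ≡ a * c - b * d
    split = solve 4 (λ a b c d → a :* (c :- d) :+ (a :- b) :* d := a :* c :- b :* d) refl

  +-pos : ∀ {p q} → 0ℚ < p → 0ℚ < q → 0ℚ < p + q
  +-pos {p} {q} hp hq = ℚP.<-trans hq (subst (_< p + q) (ℚP.+-identityˡ q) (ℚP.+-monoˡ-< q hp))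

  *-cauchy : ∀ x y → Cauchy x → Cauchy y → Cauchy (λ k → x k * y k)
  *-cauchy x y cx cy = dominated (λ k → x k * y k) x y (A + B) (+-pos hA hB) (M ℕ.+ N) bound cx cy
    where
    A = proj₁ (bounded x cx)
    B = proj₁ (bounded y cy)
    hA : 0ℚ < A
    hA = proj₁ (proj₂ (bounded x cx))
    hB : 0ℚ < B
    hB = proj₁ (proj₂ (bounded y cy))
    M = proj₁ (proj₂ (proj₂ (bounded x cx)))
    N = proj₁ (proj₂ (proj₂ (bounded y cy)))
    hx : ∀ i → M ℕ.≤ i → ∣ x i ∣ ≤ A
    hx = proj₂ (proj₂ (proj₂ (bounded x cx)))
    hy : ∀ i → N ℕ.≤ i → ∣ y i ∣ ≤ B
    hy = proj₂ (proj₂ (proj₂ (bounded y cy)))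
    bound : ∀ i j → M ℕ.+ N ℕ.≤ i → M ℕ.+ N ℕ.≤ j →
            ∣ x i * y i - x j * y j ∣ ≤ (A + B) * (∣ x i - x j ∣ + ∣ y i - y j ∣)
    bound i j hi hj = ∣*-*∣≤ (x i) (x j) (y i) (y j) A B
      (hx i (ℕP.≤-trans (ℕP.m≤m+n M N) hi)) (hy j (ℕP.≤-trans (ℕP.m≤n+m N M) hj)) (ℚP.<⇒≤ hA) (ℚP.<⇒≤ hB)

infix 4 _≃ᴿ_ _≤ᴿ_ _<ᴿ_

_≃ᴿ_ _≤ᴿ_ _<ᴿ_ : ℝ → ℝ → Set
x ≃ᴿ y = ∀ ε → 0ℚ < ε → ∃ λ N → ∀ k → N ℕ.≤ k → ∣ seq x k - seq y k ∣ < ε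
x ≤ᴿ y = ∀ ε → 0ℚ < ε → ∃ λ N → ∀ k → N ℕ.≤ k → seq x k < seq y k + ε
x <ᴿ y = ∃ λ ε → 0ℚ < ε × ∃ λ N → ∀ k → N ℕ.≤ k → seq x k + ε < seq y k

fromℚ : ℚ → ℝ
fromℚ q = mkℝ (λ _ → q) (CauchyLemmas.const-cauchy q)

0ᴿ 1ᴿ : ℝ
0ᴿ = fromℚ 0ℚ
1ᴿ = fromℚ 1ℚ

infixl 6 _+ᴿ_ _-ᴿ_
infixl 7 _*ᴿ_
infix  8 -ᴿ_

_+ᴿ_ _*ᴿ_ : ℝ → ℝ → ℝ
x +ᴿ y = mkℝ (λ k → seq x k + seq y k) (CauchyLemmas.+-cauchy (seq x) (seq y) (cauchy x) (cauchy y))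
x *ᴿ y = mkℝ (λ k → seq x k * seq y k) (CauchyLemmas.*-cauchy (seq x) (seq y) (cauchy x) (cauchy y))

-ᴿ_ : ℝ → ℝ
-ᴿ x = mkℝ (λ k → - seq x k) (CauchyLemmas.neg-cauchy (seq x) (cauchy x))

_-ᴿ_ : ℝ → ℝ → ℝ
x -ᴿ y = x +ᴿ (-ᴿ y)

recip : ℚ → ℚ
recip q with q ℚP.≟ 0ℚ
... | yes _  = 0ℚ
... | no q≢0 = (ℚ.1/ q) {{ℚ.≢-nonZero q≢0}}

module RecipLemmas where

  open RationalLemmas
  open CauchyLemmas
  open +-*-Solver using (solve; _:=_; _:+_; _:*_; _:-_; :-_; con)

  *-recip : ∀ {q} → 0ℚ < q → q * recip q ≡ 1ℚ
  *-recip {q} hq with q ℚP.≟ 0ℚ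
  ... | yes q≡0 = ⊥-elim (ℚP.<-irrefl (sym q≡0) hq)
  ... | no q≢0  = ℚP.*-inverseʳ q {{ℚ.≢-nonZero q≢0}}

  recip-nonNeg : ∀ {q} → 0ℚ < q → 0ℚ ≤ recip q
  recip-nonNeg {q} hq = ℚP.*-cancelˡ-≤-pos q {{ℚ.positive hq}}
    (subst₂ _≤_ (sym (ℚP.*-zeroʳ q)) (sym (*-recip hq)) (ℚP.<⇒≤ 0<1))

  recip-anti : ∀ {p q} → 0ℚ < p → p ≤ q → recip q ≤ recip p
  recip-anti {p} {q} hp pq = subst₂ _≤_
    (trans (solve 3 (λ a b c → a :* (b :* c) := c :* (a :* b)) refl p (recip p) (recip q))
      (trans (cong (recip q *_) (*-recip hp)) (ℚP.*-identityʳ _)))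
    (trans (solve 3 (λ a b c → a :* (b :* c) := b :* (a :* c)) refl q (recip p) (recip q))
      (trans (cong (recip p *_) (*-recip hq)) (ℚP.*-identityʳ _)))
    (ℚP.*-monoʳ-≤-nonNeg (recip p * recip q) {{ℚ.nonNegative (*-nonNeg (recip-nonNeg hp) (recip-nonNeg hq))}} pq)
    where
    hq : 0ℚ < q
    hq = ℚP.<-≤-trans hp pq

  recip-cauchy : (x : ℝ) → 0ᴿ <ᴿ x → Cauchy (λ k → recip (seq x k))
  recip-cauchy x (ε , hε , N , h) = dominated (λ k → recip (seq x k)) (seq x) (λ _ → 0ℚ) K hK N bound (cauchy x) (const-cauchy 0ℚ)
    where
    r = recip ε
    hr : 0ℚ < r
    hr = ℚP.*-cancelˡ-<-nonNeg ε {{ℚ.nonNegative (ℚP.<⇒≤ hε)}} (subst₂ _<_ (sym (ℚP.*-zeroʳ ε)) (sym (*-recip hε)) 0<1)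
    K = r * r
    hK : 0ℚ < K
    hK = *-pos hr hr
    ε≤ : ∀ k → N ℕ.≤ k → ε ≤ seq x k
    ε≤ k hk = ℚP.<⇒≤ (subst (_< seq x k) (ℚP.+-identityˡ ε) (h k hk))
    ∣recip∣ : ∀ k → N ℕ.≤ k → ∣ recip (seq x k) ∣ ≤ r
    ∣recip∣ k hk = subst (_≤ r) (sym (ℚP.0≤p⇒∣p∣≡p (recip-nonNeg (ℚP.<-≤-trans hε (ε≤ k hk))))) (recip-anti hε (ε≤ k hk))
    diff : ∀ a b → 0ℚ < a → 0ℚ < b → (recip a * recip b) * (b - a) ≡ recip a - recip b
    diff a b ha hb = trans
      (solve 4 (λ a b c d → (c :* d) :* (b :- a) := c :* (b :* d) :- d :* (a :* c)) refl a b (recip a) (recip b))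
      (cong₂ _-_ (times-one (recip a) (*-recip hb)) (times-one (recip b) (*-recip ha)))
      where
      times-one : ∀ p {q} → q ≡ 1ℚ → p * q ≡ p
      times-one p refl = ℚP.*-identityʳ p
    bound : ∀ i j → N ℕ.≤ i → N ℕ.≤ j →
            ∣ recip (seq x i) - recip (seq x j) ∣ ≤ K * (∣ seq x i - seq x j ∣ + ∣ 0ℚ - 0ℚ ∣)
    bound i j hi hj = subst₂ _≤_
      (cong ∣_∣ (diff (seq x i) (seq x j) (ℚP.<-≤-trans hε (ε≤ i hi)) (ℚP.<-≤-trans hε (ε≤ j hj))))
      (cong (K *_) (trans (∣-∣-flip (seq x j) (seq x i)) (sym (ℚP.+-identityʳ _))))
      (∣-∣-mono-* {recip (seq x i) * recip (seq x j)} {seq x j - seq x i}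
        (∣-∣-mono-* {recip (seq x i)} {recip (seq x j)} (∣recip∣ i hi) (∣recip∣ j hj) (ℚP.<⇒≤ hr))
        ℚP.≤-refl (ℚP.0≤∣p∣ (seq x j - seq x i)))

-- Since y is apart from 0, only finitely many seq y k can be 0, so the junk value of recip at 0 is immaterial.
_÷ᴿ_[_] : (x y : ℝ) → 0ᴿ <ᴿ y → ℝ
x ÷ᴿ y [ y>0 ] = x *ᴿ mkℝ (λ k → recip (seq y k)) (RecipLemmas.recip-cauchy y y>0)

expTerm : ℚ → ℕ → ℚ
expTerm x j = x ^ j * (+ 1 / j !) {{ℕP._!≢0 j}}

expSum : ℚ → ℕ → ℚ
expSum x zero    = 0ℚ
expSum x (suc k) = expSum x k + expTerm x k

module ExpLemmas where

  open RationalLemmas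
  open CauchyLemmas
  open +-*-Solver using (solve; _:=_; _:+_; _:*_; _:-_; :-_; con)

  inv! : ℕ → ℚ
  inv! j = (+ 1 / j !) {{ℕP._!≢0 j}}

  inv!-nonNeg : ∀ j → 0ℚ ≤ inv! j
  inv!-nonNeg j = /-nonNeg 1 (j !) {{ℕP._!≢0 j}}

  inv!-suc : ∀ j → fromℕ (suc j) * inv! (suc j) ≡ inv! j
  inv!-suc j = /-cancel (suc j) (j !) {{_}} {{ℕP._!≢0 j}} {{ℕP._!≢0 (suc j)}}

  ^-nonNeg : ∀ {B} → 0ℚ ≤ B → ∀ j → 0ℚ ≤ B ^ j
  ^-nonNeg hB zero    = ℚP.<⇒≤ 0<1
  ^-nonNeg hB (suc j) = *-nonNeg hB (^-nonNeg hB j)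

  expTerm-nonNeg : ∀ {B} → 0ℚ ≤ B → ∀ j → 0ℚ ≤ expTerm B j
  expTerm-nonNeg hB j = *-nonNeg (^-nonNeg hB j) (inv!-nonNeg j)

  ∣^∣-mono : ∀ {x B} → ∣ x ∣ ≤ B → ∀ j → ∣ x ^ j ∣ ≤ B ^ j
  ∣^∣-mono h zero = ℚP.≤-refl
  ∣^∣-mono {x} h (suc j) = ∣-∣-mono-* {x} {x ^ j} h (∣^∣-mono h j) (^-nonNeg (ℚP.≤-trans (ℚP.0≤∣p∣ x) h) j)

  ∣expTerm∣-mono : ∀ {x B} → ∣ x ∣ ≤ B → ∀ j → ∣ expTerm x j ∣ ≤ expTerm B j
  ∣expTerm∣-mono {x} h j = ∣-∣-mono-* {x ^ j} {inv! j} (∣^∣-mono h j)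
    (ℚP.≤-reflexive (ℚP.0≤p⇒∣p∣≡p (inv!-nonNeg j))) (inv!-nonNeg j)

  expTerm-halves : ∀ {B} → 0ℚ ≤ B → ∀ M → B + B ≤ fromℕ M → ∀ j → M ℕ.≤ j →
                   expTerm B (suc j) + expTerm B (suc j) ≤ expTerm B j
  expTerm-halves {B} hB M hM j hj = subst₂ _≤_
    (solve 3 (λ b p i → (p :* i) :* (b :+ b) := (b :* p) :* i :+ (b :* p) :* i) refl B (B ^ j) (inv! (suc j)))
    (trans (solve 3 (λ p i s → (p :* i) :* s := p :* (s :* i)) refl (B ^ j) (inv! (suc j)) (fromℕ (suc j)))
           (cong (B ^ j *_) (inv!-suc j)))
    (*-monoˡ (B ^ j * inv! (suc j)) (*-nonNeg (^-nonNeg hB j) (inv!-nonNeg (suc j)))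
      (ℚP.≤-trans hM (fromℕ-mono (ℕP.≤-trans hj (ℕP.n≤1+n j)))))

  expSum-tail : ∀ {x B} → ∣ x ∣ ≤ B → ∀ M → B + B ≤ fromℕ M → ∀ N → M ℕ.≤ N → ∀ d →
                ∣ expSum x (d ℕ.+ N) - expSum x N ∣ + (expTerm B (d ℕ.+ N) + expTerm B (d ℕ.+ N))
                  ≤ expTerm B N + expTerm B N
  expSum-tail {x} {B} h M hM N hN zero = ℚP.≤-reflexive
    (trans (cong (λ q → ∣ q ∣ + (t + t)) (ℚP.+-inverseʳ (expSum x N))) (ℚP.+-identityˡ _))
    where t = expTerm B N
  expSum-tail {x} {B} h M hM N hN (suc d) = ℚP.≤-trans
    (ℚP.+-mono-≤
      (subst (_≤ a + t) (cong ∣_∣ (solve 3 (λ p q r → (p :- r) :+ q := (p :+ q) :- r) refl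
                                   (expSum x (d ℕ.+ N)) (expTerm x (d ℕ.+ N)) (expSum x N)))
        (∣-∣-mono-+ {expSum x (d ℕ.+ N) - expSum x N} {expTerm x (d ℕ.+ N)} ℚP.≤-refl (∣expTerm∣-mono h (d ℕ.+ N))))
      (expTerm-halves (ℚP.≤-trans (ℚP.0≤∣p∣ x) h) M hM (d ℕ.+ N) (ℕP.≤-trans hN (ℕP.m≤n+m N d))))
    (ℚP.≤-trans (ℚP.≤-reflexive (ℚP.+-assoc a t t)) (expSum-tail h M hM N hN d))
    where
    t = expTerm B (d ℕ.+ N)
    a = ∣ expSum x (d ℕ.+ N) - expSum x N ∣

  expTerm-decay : ∀ {B} → 0ℚ ≤ B → ∀ M → B + B ≤ fromℕ M → ∀ k →
                  fromℕ (suc k) * expTerm B (k ℕ.+ M) ≤ expTerm B M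
  expTerm-decay hB M hM zero = ℚP.≤-reflexive (ℚP.*-identityˡ _)
  expTerm-decay {B} hB M hM (suc k) = ℚP.≤-trans
    (ℚP.≤-trans
      (ℚP.*-monoʳ-≤-nonNeg t {{ℚ.nonNegative (expTerm-nonNeg hB (suc (k ℕ.+ M)))}}
        (ℚP.≤-trans (fromℕ-mono le) (ℚP.≤-reflexive (/-+ (suc k) (suc k) 1))))
      (subst (_≤ fromℕ (suc k) * expTerm B (k ℕ.+ M))
        (solve 2 (λ s u → s :* (u :+ u) := (s :+ s) :* u) refl (fromℕ (suc k)) t)
        (*-monoˡ (fromℕ (suc k)) (fromℕ-nonNeg (suc k)) (expTerm-halves hB M hM (k ℕ.+ M) (ℕP.m≤n+m M k)))))
    (expTerm-decay hB M hM k)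
    where
    t = expTerm B (suc (k ℕ.+ M))
    le : suc (suc k) ℕ.≤ suc k ℕ.+ suc k
    le = ℕ.s≤s (ℕP.m≤n+m (suc k) k)

  expTerm-small : ∀ {B} → 0ℚ ≤ B → ∀ M → B + B ≤ fromℕ M → ∀ ε → 0ℚ < ε → ∃ λ k → expTerm B (k ℕ.+ M) < ε
  expTerm-small {B} hB M hM ε hε with archimedean (inv ε hε * expTerm B M)
  ... | k , hk = k , ℚP.*-cancelˡ-<-nonNeg (fromℕ (suc k)) {{ℚ.nonNegative (fromℕ-nonNeg (suc k))}}
    (ℚP.≤-<-trans (expTerm-decay hB M hM k)
      (ℚP.≤-<-trans
        (subst (_≤ ε * fromℕ k)
          (trans (sym (ℚP.*-assoc ε (inv ε hε) (expTerm B M)))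
                 (trans (cong (_* expTerm B M) (*-inv ε hε)) (ℚP.*-identityˡ _)))
          (*-monoˡ ε (ℚP.<⇒≤ hε) hk))
        (subst (ε * fromℕ k <_) (ℚP.*-comm ε (fromℕ (suc k)))
          (ℚP.*-monoʳ-<-pos ε {{ℚ.positive hε}}
            (subst (fromℕ k <_) (sym (fromℕ-suc k))
              (subst (_< fromℕ k + 1ℚ) (ℚP.+-identityʳ (fromℕ k)) (ℚP.+-monoʳ-< (fromℕ k) 0<1)))))))

  expSum-fixed-cauchy : ∀ x → Cauchy x → ∀ N → Cauchy (λ k → expSum (x k) N)
  expSum-fixed-cauchy x cx zero    = const-cauchy 0ℚ
  expSum-fixed-cauchy x cx (suc N) = +-cauchy (λ k → expSum (x k) N) (λ k → expTerm (x k) N)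
    (expSum-fixed-cauchy x cx N) (*-cauchy (λ k → x k ^ N) (λ _ → inv! N) (^-cauchy N) (const-cauchy (inv! N)))
    where
    ^-cauchy : ∀ j → Cauchy (λ k → x k ^ j)
    ^-cauchy zero    = const-cauchy 1ℚ
    ^-cauchy (suc j) = *-cauchy x (λ k → x k ^ j) cx (^-cauchy j)

  expSum-close : ∀ {x B} → ∣ x ∣ ≤ B → ∀ M → B + B ≤ fromℕ M → ∀ N → M ℕ.≤ N → ∀ i → N ℕ.≤ i →
                 ∣ expSum x i - expSum x N ∣ ≤ expTerm B N + expTerm B N
  expSum-close {x} {B} h M hM N hN i hi = subst (λ n → ∣ expSum x n - expSum x N ∣ ≤ t + t) (ℕP.m∸n+n≡m hi)
    (ℚP.≤-trans
      (subst (_≤ a + (s + s)) (ℚP.+-identityʳ a) (ℚP.+-monoʳ-≤ a (+-nonNeg hs hs)))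
      (expSum-tail h M hM N hN (i ℕ.∸ N)))
    where
    t = expTerm B N
    s = expTerm B (i ℕ.∸ N ℕ.+ N)
    a = ∣ expSum x (i ℕ.∸ N ℕ.+ N) - expSum x N ∣
    hs : 0ℚ ≤ s
    hs = expTerm-nonNeg (ℚP.≤-trans (ℚP.0≤∣p∣ x) h) (i ℕ.∸ N ℕ.+ N)

  exp-cauchy : ∀ x → Cauchy x → Cauchy (λ k → expSum (x k) k)
  exp-cauchy x cx ε hε = N , bound
    where
    B = proj₁ (bounded x cx)
    hB : 0ℚ ≤ B
    hB = ℚP.<⇒≤ (proj₁ (proj₂ (bounded x cx)))
    N₁ = proj₁ (proj₂ (proj₂ (bounded x cx)))
    hx : ∀ i → N₁ ℕ.≤ i → ∣ x i ∣ ≤ B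
    hx = proj₂ (proj₂ (proj₂ (bounded x cx)))
    M = proj₁ (archimedean (B + B))
    hM : B + B ≤ fromℕ M
    hM = proj₂ (archimedean (B + B))
    tiny : ∃ λ k → expTerm B (k ℕ.+ M) < ½ * (½ * (½ * ε))
    tiny = expTerm-small hB M hM (½ * (½ * (½ * ε))) (half-pos (half-pos (half-pos hε)))
    k = proj₁ tiny
    K = k ℕ.+ M
    small : expTerm B K < ½ * (½ * (½ * ε))
    small = proj₂ tiny
    N₂ = proj₁ (expSum-fixed-cauchy x cx K (½ * ε) (half-pos hε))
    fixed : ∀ i j → N₂ ℕ.≤ i → N₂ ℕ.≤ j → ∣ expSum (x i) K - expSum (x j) K ∣ < ½ * ε
    fixed = proj₂ (expSum-fixed-cauchy x cx K (½ * ε) (half-pos hε))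
    N = K ℕ.+ (N₁ ℕ.+ N₂)
    t = expTerm B K
    K≤N : K ℕ.≤ N
    K≤N = ℕP.m≤m+n K _
    N₁≤N : N₁ ℕ.≤ N
    N₁≤N = ℕP.≤-trans (ℕP.m≤m+n N₁ N₂) (ℕP.m≤n+m _ K)
    N₂≤N : N₂ ℕ.≤ N
    N₂≤N = ℕP.≤-trans (ℕP.m≤n+m N₂ N₁) (ℕP.m≤n+m _ K)
    close : ∀ i → N ℕ.≤ i → ∣ expSum (x i) i - expSum (x i) K ∣ < ½ * (½ * ε)
    close i hi = ℚP.≤-<-trans
      (expSum-close (hx i (ℕP.≤-trans N₁≤N hi)) M hM K (ℕP.m≤n+m M k) i (ℕP.≤-trans K≤N hi))
      (subst (t + t <_) (halves (½ * (½ * ε))) (ℚP.+-mono-< small small))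
    bound : ∀ i j → N ℕ.≤ i → N ℕ.≤ j → ∣ expSum (x i) i - expSum (x j) j ∣ < ε
    bound i j hi hj = subst₂ _<_
      (cong ∣_∣ (solve 4 (λ a b c d → ((a :- c) :+ (d :- b)) :+ (c :- d) := a :- b) refl
                  (expSum (x i) i) (expSum (x j) j) (expSum (x i) K) (expSum (x j) K)))
      (trans (cong (_+ ½ * ε) (halves (½ * ε))) (halves ε))
      (ℚP.≤-<-trans
        (∣-∣-mono-+ {(expSum (x i) i - expSum (x i) K) + (expSum (x j) K - expSum (x j) j)} {expSum (x i) K - expSum (x j) K}
          (ℚP.∣p+q∣≤∣p∣+∣q∣ (expSum (x i) i - expSum (x i) K) (expSum (x j) K - expSum (x j) j)) ℚP.≤-refl)
        (ℚP.+-mono-<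
          (ℚP.+-mono-< (close i hi)
            (subst (_< ½ * (½ * ε)) (∣-∣-flip (expSum (x j) j) (expSum (x j) K)) (close j hj)))
          (fixed i j (ℕP.≤-trans N₂≤N hi) (ℕP.≤-trans N₂≤N hj))))

-- exp x = Σ xʲ / j!, along the diagonal: the k-th approximation is the k-term partial sum at the k-th approximation of x.
exp : ℝ → ℝ
exp x = mkℝ (λ k → expSum (seq x k) k) (ExpLemmas.exp-cauchy (seq x) (cauchy x))

isqrt : ℕ → ℕ
isqrt zero = 0
isqrt (suc n) with suc (isqrt n) ℕ.* suc (isqrt n) ℕP.≤? suc n
... | yes _ = suc (isqrt n)
... | no  _ = isqrt n

isqrt-spec : ∀ n → isqrt n ℕ.* isqrt n ℕ.≤ n × n ℕ.< suc (isqrt n) ℕ.* suc (isqrt n)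
isqrt-spec zero = ℕ.z≤n , ℕ.s≤s ℕ.z≤n
isqrt-spec (suc n) with suc (isqrt n) ℕ.* suc (isqrt n) ℕP.≤? suc n
... | yes h = h , ℕP.≤-<-trans (proj₂ (isqrt-spec n))
                    (ℕP.*-mono-< (ℕP.n<1+n (suc (isqrt n))) (ℕP.n<1+n (suc (isqrt n))))
... | no h  = ℕP.≤-trans (proj₁ (isqrt-spec n)) (ℕP.n≤1+n n) , ℕP.≰⇒> h

√-approx : ℕ → ℕ → ℚ
√-approx n k = + isqrt (n ℕ.* (suc k ℕ.* suc k)) / suc k

module SqrtLemmas where

  open RationalLemmas

  square-cancel : ∀ a b → a ℕ.* a ℕ.≤ b ℕ.* b → a ℕ.≤ b
  square-cancel a b h with a ℕP.≤? b
  ... | yes a≤b = a≤b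
  ... | no  a≰b = ⊥-elim (ℕP.<⇒≱ (ℕP.*-mono-< (ℕP.≰⇒> a≰b) (ℕP.≰⇒> a≰b)) h)

  swap-squares : ∀ a b → (a ℕ.* b) ℕ.* (a ℕ.* b) ≡ (a ℕ.* a) ℕ.* (b ℕ.* b)
  swap-squares a b = ℕP.[m*n]*[o*p]≡[m*o]*[n*p] a b a b

  step : ∀ n i j → √-approx n i ≤ √-approx n j + + 1 / suc j
  step n i j = ℚP.≤-trans (/-mono-≤ a p (b ℕ.+ 1) q le) (ℚP.≤-reflexive (/-+ b 1 q))
    where
    p = suc i
    q = suc j
    a = isqrt (n ℕ.* (p ℕ.* p))
    b = isqrt (n ℕ.* (q ℕ.* q))
    lo : a ℕ.* a ℕ.≤ n ℕ.* (p ℕ.* p)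
    lo = proj₁ (isqrt-spec (n ℕ.* (p ℕ.* p)))
    hi : n ℕ.* (q ℕ.* q) ℕ.≤ (b ℕ.+ 1) ℕ.* (b ℕ.+ 1)
    hi = subst (λ c → n ℕ.* (q ℕ.* q) ℕ.≤ c ℕ.* c) (ℕP.+-comm 1 b) (ℕP.<⇒≤ (proj₂ (isqrt-spec (n ℕ.* (q ℕ.* q)))))
    move : (n ℕ.* (p ℕ.* p)) ℕ.* (q ℕ.* q) ≡ (n ℕ.* (q ℕ.* q)) ℕ.* (p ℕ.* p)
    move = trans (ℕP.*-assoc n _ _) (trans (cong (n ℕ.*_) (ℕP.*-comm (p ℕ.* p) (q ℕ.* q))) (sym (ℕP.*-assoc n _ _)))
    le : a ℕ.* q ℕ.≤ (b ℕ.+ 1) ℕ.* p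
    le = square-cancel _ _ (subst₂ ℕ._≤_ (sym (swap-squares a q)) (sym (swap-squares (b ℕ.+ 1) p))
      (ℕP.≤-trans (ℕP.*-monoˡ-≤ (q ℕ.* q) lo) (ℕP.≤-trans (ℕP.≤-reflexive move) (ℕP.*-monoˡ-≤ (p ℕ.* p) hi))))

  √-cauchy : ∀ n → Cauchy (√-approx n)
  √-cauchy n ε hε = N , λ i j hi hj → ℚP.≤-<-trans
    (≤⇒∣-∣≤ (ℚP.≤-trans (step n i j) (ℚP.+-monoʳ-≤ (√-approx n j) (anti j hj)))
            (ℚP.≤-trans (step n j i) (ℚP.+-monoʳ-≤ (√-approx n i) (anti i hi))))
    (proj₂ (/-small hε))
    where
    N = proj₁ (/-small hε)
    anti : ∀ i → N ℕ.≤ i → + 1 / suc i ≤ + 1 / suc N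
    anti i hi = /-mono-≤ 1 (suc i) 1 (suc N) (ℕP.*-monoʳ-≤ 1 (ℕ.s≤s hi))

-- √n is the limit of ⌊√(n (k+1)²)⌋ / (k+1).
√_ : ℕ → ℝ
√ n = mkℝ (√-approx n) (SqrtLemmas.√-cauchy n)

e : ℝ
e = exp 1ᴿ

e>0 : 0ᴿ <ᴿ e
e>0 = ½ , 0<½ , 1 , λ { (suc k) _ → ℚP.<-≤-trans ½<1 (1≤ k) }
  where
  open RationalLemmas
  ½<1 : 0ℚ + ½ < 1ℚ
  ½<1 = ℚ.*<* (ℤ.+<+ (ℕ.s≤s (ℕ.s≤s ℕ.z≤n)))
  1≤ : ∀ k → 1ℚ ≤ expSum 1ℚ (suc k)
  1≤ zero    = ℚP.≤-refl
  1≤ (suc k) = ℚP.≤-trans (1≤ k) (subst (_≤ expSum 1ℚ (suc (suc k))) (ℚP.+-identityʳ (expSum 1ℚ (suc k)))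
    (ℚP.+-monoʳ-≤ (expSum 1ℚ (suc k)) (ExpLemmas.expTerm-nonNeg (ℚP.<⇒≤ 0<1) (suc k))))

natᴿ : ℕ → ℝ
natᴿ n = fromℚ (fromℕ n)

-- a is a solution in [0,1] of (4/e) a e^(1-a) = 1.
IsThreshold : ℝ → Set
IsThreshold a = 0ᴿ ≤ᴿ a × a ≤ᴿ 1ᴿ × (natᴿ 4 ÷ᴿ e [ e>0 ]) *ᴿ a *ᴿ exp (1ᴿ -ᴿ a) ≃ᴿ 1ᴿ

module Probing {K : Set} {n : ℕ} .{{_ : NonZero n}} (h : K → Fin n) where

  Table : Set
  Table = Vec (Maybe K) n

  empty : Table
  empty = replicate n nothing

  slot : K → ℕ → Fin n
  slot x i = (toℕ (h x) ℕ.+ i ℕ.* i) mod n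

  Empty Occupied : Table → Fin n → Set
  Empty t s    = lookup t s ≡ nothing
  Occupied t s = ¬ Empty t s

  search : Table → K → (fuel i : ℕ) → Maybe ℕ
  search t x zero       i = nothing
  search t x (suc fuel) i with lookup t (slot x i)
  ... | nothing = just i
  ... | just _  = search t x fuel (suc i)

  -- Only i < n is searched, because slot x has period n; firstEmpty-just and firstEmpty-nothing
  -- below show that this is the minimum over all i, and that nothing means that no i exists.
  firstEmpty : Table → K → Maybe ℕ
  firstEmpty t x = search t x n 0

  -- The updated table together with the number of slots probed.
  insert : K → Table → Maybe (Table × ℕ)
  insert x t = Maybe.map (λ i → t [ slot x i ]≔ just x , suc i) (firstEmpty t x)

  insertAll : List K → Table → Maybe Table
  insertAll []       t = just t
  insertAll (x ∷ xs) t = insert x t >>= λ (t′ , _) → insertAll xs t′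

  search-just : ∀ t x fuel i {j} → search t x fuel i ≡ just j →
                Empty t (slot x j) × (∀ k → i ℕ.≤ k → k ℕ.< j → Occupied t (slot x k))
  search-just t x (suc fuel) i eq with lookup t (slot x i) in here
  search-just t x (suc fuel) i refl | nothing = here , λ k i≤k k<i → ⊥-elim (ℕP.<⇒≱ k<i i≤k)
  search-just t x (suc fuel) i {j} eq | just y with search-just t x fuel (suc i) eq
  ... | last , before = last , before′
    where
    before′ : ∀ k → i ℕ.≤ k → k ℕ.< j → Occupied t (slot x k)
    before′ k i≤k k<j with ℕP.m≤n⇒m<n∨m≡n i≤k
    ... | inj₁ i<k  = before k i<k k<j
    ... | inj₂ refl = λ free → just≢nothing (trans (sym here) free)
      where
      just≢nothing : ¬ (just y ≡ nothing)
      just≢nothing ()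

  search-nothing : ∀ t x fuel i → search t x fuel i ≡ nothing →
                   ∀ k → i ℕ.≤ k → k ℕ.< fuel ℕ.+ i → Occupied t (slot x k)
  search-nothing t x zero i eq k i≤k k<i = ⊥-elim (ℕP.<⇒≱ k<i i≤k)
  search-nothing t x (suc fuel) i eq k i≤k k<j with lookup t (slot x i) in here
  search-nothing t x (suc fuel) i () k i≤k k<j | nothing
  search-nothing t x (suc fuel) i eq k i≤k k<j | just y with ℕP.m≤n⇒m<n∨m≡n i≤k
  ... | inj₁ i<k  = search-nothing t x fuel (suc i) eq k i<k (subst (k ℕ.<_) (sym (ℕP.+-suc fuel i)) k<j)
  ... | inj₂ refl = λ free → just≢nothing (trans (sym here) free)
    where
    just≢nothing : ¬ (just y ≡ nothing)
    just≢nothing ()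

  slot-periodic : ∀ x i → slot x (i % n) ≡ slot x i
  slot-periodic x i = toℕ-injective (trans (toℕ-fromℕ< _) (trans same (sym (toℕ-fromℕ< _))))
    where
    a = toℕ (h x)
    square : ((i % n) ℕ.* (i % n)) % n ≡ (i ℕ.* i) % n
    square = sym (%-distribˡ-* i i n)
    same : (a ℕ.+ (i % n) ℕ.* (i % n)) % n ≡ (a ℕ.+ i ℕ.* i) % n
    same = trans (%-distribˡ-+ a _ n) (trans (cong (λ r → (a % n ℕ.+ r) % n) square) (sym (%-distribˡ-+ a _ n)))

  firstEmpty-just : ∀ t x i → firstEmpty t x ≡ just i →
                    Empty t (slot x i) × (∀ j → j ℕ.< i → Occupied t (slot x j))
  firstEmpty-just t x i eq with search-just t x n 0 eq
  ... | last , before = last , λ j → before j ℕ.z≤n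

  firstEmpty-nothing : ∀ t x → firstEmpty t x ≡ nothing → ∀ i → Occupied t (slot x i)
  firstEmpty-nothing t x eq i = subst (Occupied t) (slot-periodic x i)
    (search-nothing t x n 0 eq (i % n) ℕ.z≤n (subst (i % n ℕ.<_) (sym (ℕP.+-identityʳ n)) (m%n<n i n)))

-- The joint hash values of k distinct keys: uniformly distributed over Vec (Fin n) k.
outcomes : ∀ n k → List (Vec (Fin n) k)
outcomes n zero    = [] ∷ []
outcomes n (suc k) = cartesianProductWith _∷_ (allFin n) (outcomes n k)

outcomes-complete : ∀ n k (ω : Vec (Fin n) k) → ω ∈ outcomes n k
outcomes-complete n zero    []      = here refl
outcomes-complete n (suc k) (a ∷ ω) = ∈-cartesianProductWith⁺ _∷_ (∈-allFin a) (outcomes-complete n k ω)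

outcomes-unique : ∀ n k → Unique (outcomes n k)
outcomes-unique n zero    = [] ∷ []
outcomes-unique n (suc k) = cartesianProductWith⁺ _∷_ ∷-injective (allFin⁺ n) (outcomes-unique n k)

Event : ℕ → ℕ → Set
Event n k = Vec (Fin n) k → Bool

_∈ᴱ_ : ∀ {n k} → Vec (Fin n) k → Event n k → Set
ω ∈ᴱ E = T (E ω)

size : ∀ {n k} → Event n k → ℕ
size {n} {k} E = length (filterᵇ E (outcomes n k))

Pr : ∀ {n k} .{{_ : NonZero n}} → Event n k → ℚ
Pr {n} {k} E = (+ size E / n ℕ.^ k) {{ℕP.m^n≢0 n k}}

𝔼[_∣_] : ∀ {n k} → (Vec (Fin n) k → ℕ) → (E : Event n k) → .{{_ : NonZero (size E)}} → ℚ
𝔼[_∣_] {n} {k} X E = + sum (map X (filterᵇ E (outcomes n k))) / size E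

module _ {n m : ℕ} .{{_ : NonZero n}} where

  -- The m + 1 keys are named 0 , … , m in order of insertion, and the hash function is lookup ω.
  -- The result is just (final table , cost of the last insertion) iff every insertion succeeds.
  run : (ω : Vec (Fin n) (suc m)) → Maybe (Vec (Maybe (Fin (suc m))) n × ℕ)
  run ω = insertAll (map inject₁ (allFin m)) empty >>= insert (Fin.fromℕ m)
    where open Probing (lookup ω)

  AllSucceed : Vec (Fin n) (suc m) → Set
  AllSucceed ω = ∃ λ r → run ω ≡ just r

  -- The value 0 is a placeholder for runs with a failed insertion.
  lastCost : Vec (Fin n) (suc m) → ℕ
  lastCost ω = maybe proj₂ 0 (run ω)

{-# OPTIONS --safe #-}

-- Link the keys whose probe sequences meet. A new key merges the components that its probes hit, so removing the
-- last key of a component leaves an ordered sequence of smaller components, each with a marked slot, the one that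
-- is hit. A component of k keys fills exactly k slots; by translation invariance a marked slot costs a factor k, and the
-- last-key decomposition then reads D = 1 / (1 - x D) in terms of generating functions. Hence at most k! Cat(k-1)
-- hash sequences of length k form a single component through a given slot. All other keys must hash outside it, so
-- with t keys in the table a new key merges components of total size i with probability at most
-- Cat(i) t!/(t-i)! (n-i)^(t-i) / n^t, which decays like (4 α e^(-α))^i, and 4 α e^(-α) < 1 below the threshold.
-- The offsets i² < n are distinct mod n, so an insertion costs at most one more than that total size, unless the size
-- exceeds about √n; this exceptional case has probability exp(-c √n).
module Submission where

open import Data.Bool.Base using (Bool; true; false; not; _∧_; _∨_; if_then_else_)
open import Data.Bool.ListAction using (all)
open import Data.Bool.Properties using (∨-assoc; ∨-comm; ∨-identityʳ; ∨-zeroʳ; T-≡)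
open import Data.Empty using (⊥-elim)
open import Data.Fin.Base as Fin using (Fin; toℕ; inject₁)
open import Data.Fin.Permutation using (Permutation′; permutation; _⟨$⟩ʳ_; _⟨$⟩ˡ_; inverseˡ)
open import Data.Fin.Properties using (_≟_; toℕ-injective; toℕ-fromℕ<; toℕ<n; toℕ≤n)
import Data.Integer.Base as ℤ
open import Data.List.Base as List using (List; []; _∷_; _++_; _∷ʳ_; length; null; filterᵇ; allFin; tabulate; reverse; cartesianProductWith)
import Data.List.Properties as ListP
open import Data.List.Relation.Unary.All as All using (All; []; _∷_)
open import Data.List.Relation.Unary.Unique.Propositional using (Unique; []; _∷_)
open import Data.Maybe.Base as Maybe using (Maybe; just; nothing; is-just; _>>=_)
open import Data.Nat.Base as ℕ using (ℕ; zero; suc; NonZero; _!; _∸_; z≤n; s≤s)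
open import Data.Nat.DivMod using (_mod_; _%_; m%n%n≡m%n; [m+kn]%n≡m%n; [m+n]%n≡m%n; m<n⇒m%n≡m; %-distribˡ-+)
open import Data.Nat.ListAction using (sum)
open import Data.Nat.ListAction.Properties using (sum-++)
import Data.Nat.Properties as ℕP
open import Data.Nat.Tactic.RingSolver using (solve-∀)
open import Data.Product.Base using (Σ; ∃; ∃₂; _×_; _,_; proj₁; proj₂)
open import Data.Rational.Base as ℚ using (ℚ; 0ℚ; 1ℚ; ½; ∣_∣; _+_; _*_; _-_; -_; _/_; _<_; _≤_)
import Data.Rational.Properties as ℚP
open import Data.Rational.Solver using (module +-*-Solver)
open import Data.Sum.Base using (inj₁; inj₂)
open import Data.Vec.Base as Vec using (Vec; []; _∷_; lookup; toList; _[_]≔_)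
import Data.Vec.Properties as VecP
open import Function.Base using (_∘_)
open import Function.Bundles using (Equivalence)
open import Relation.Binary.PropositionalEquality using (_≡_; _≢_; refl; sym; trans; cong; cong₂; subst; subst₂; module ≡-Reasoning)
open import Relation.Nullary using (¬_; yes; no; does)
open import Relation.Nullary.Decidable using (True; toWitness)
open import Algebra.Definitions.RawSemiring ℚ.+-*-rawSemiring using (_^_)
import Algebra.Properties.Semiring.Sum ℕP.+-*-semiring as Sum
open import Defs

-- Deleting keys from an insertion sequence in general moves the others. `Independent` isolates a
-- case in which it does not: each subword, run alone, fills the slots that it fills in the joint
-- run. Components are not defined as classes of keys. It suffices that every successful table has a
-- splitting of positive weight; summing the weights of all splittings is then a union bound. The
-- bound on the weights is uniform in the slots already seen, so components found one after another
-- count as separate factors, although the slot that is hit next depends on the earlier ones. The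
-- event E says that every key finds a free slot among its first κ + 1 probes, with κ² < n as large
-- as possible; on E the cut-off scheme and true quadratic probing agree. The threshold equation
-- reads 4 x = e^x. Moving one more key into the merged components costs a factor 4 x (1 - 1/N)^T
-- with x = T/N, at most 4 x e^(-x). Here x runs through smaller loads too, so 4 x < e^x is required
-- uniformly below α. Exponentials enter the count only through e^u ≤ 1/(1 - u), which every partial
-- sum satisfies without error term, so the count stays in ℚ with one fixed truncation order.

-- Sums over words and over splittings of words

-- Opaque, so that unification can recover f from ∑ f.
opaque

  ∑ : ∀ {n} → (Fin n → ℕ) → ℕ
  ∑ {zero}  f = 0
  ∑ {suc n} f = f Fin.zero ℕ.+ ∑ (λ i → f (Fin.suc i))

opaque
  unfolding ∑

  ∑≡sum : ∀ {n} (f : Fin n → ℕ) → ∑ f ≡ Sum.sum f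
  ∑≡sum {zero}  f = refl
  ∑≡sum {suc n} f = cong (f Fin.zero ℕ.+_) (∑≡sum λ i → f (Fin.suc i))

  ∑-cong : ∀ {n} {f g : Fin n → ℕ} → (∀ i → f i ≡ g i) → ∑ f ≡ ∑ g
  ∑-cong {zero}  h = refl
  ∑-cong {suc n} h = cong₂ ℕ._+_ (h Fin.zero) (∑-cong λ i → h (Fin.suc i))

  ∑-+ : ∀ {n} (f g : Fin n → ℕ) → ∑ (λ i → f i ℕ.+ g i) ≡ ∑ f ℕ.+ ∑ g
  ∑-+ {zero}  f g = refl
  ∑-+ {suc n} f g = trans (cong (f Fin.zero ℕ.+ g Fin.zero ℕ.+_) (∑-+ (λ i → f (Fin.suc i)) (λ i → g (Fin.suc i))))
    (swap (f Fin.zero) (g Fin.zero) _ _)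
    where
    swap : ∀ a b c d → (a ℕ.+ b) ℕ.+ (c ℕ.+ d) ≡ (a ℕ.+ c) ℕ.+ (b ℕ.+ d)
    swap = solve-∀

  ∑-* : ∀ {n} c (f : Fin n → ℕ) → ∑ (λ i → c ℕ.* f i) ≡ c ℕ.* ∑ f
  ∑-* {zero}  c f = sym (ℕP.*-zeroʳ c)
  ∑-* {suc n} c f = trans (cong (c ℕ.* f Fin.zero ℕ.+_) (∑-* c λ i → f (Fin.suc i))) (sym (ℕP.*-distribˡ-+ c (f Fin.zero) _))

  ∑-comm : ∀ {m n} (f : Fin m → Fin n → ℕ) → ∑ (λ i → ∑ (f i)) ≡ ∑ λ j → ∑ λ i → f i j
  ∑-comm {zero}  {n} f = sym (∑-* {n} 0 (λ _ → 0))
  ∑-comm {suc m} {n} f = trans (cong (∑ (f Fin.zero) ℕ.+_) (∑-comm λ i → f (Fin.suc i))) (sym (∑-+ (f Fin.zero) _))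

  ∑-mono : ∀ {n} {f g : Fin n → ℕ} → (∀ i → f i ℕ.≤ g i) → ∑ f ℕ.≤ ∑ g
  ∑-mono {zero}  h = z≤n
  ∑-mono {suc n} h = ℕP.+-mono-≤ (h Fin.zero) (∑-mono (λ i → h (Fin.suc i)))

  ∑-const : ∀ n c → ∑ {n} (λ _ → c) ≡ n ℕ.* c
  ∑-const zero    c = refl
  ∑-const (suc n) c = cong (c ℕ.+_) (∑-const n c)

∑-shift : ∀ {n} (π : Permutation′ n) (f : Fin n → ℕ) → ∑ (λ a → f (π ⟨$⟩ʳ a)) ≡ ∑ f
∑-shift π f = trans (∑≡sum _) (trans (sym (Sum.sum-permute f π)) (sym (∑≡sum f)))

𝟙 : Bool → ℕ
𝟙 b = if b then 1 else 0

∑Word : ∀ {n} → ℕ → (List (Fin n) → ℕ) → ℕ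
∑Word zero    f = f []
∑Word (suc k) f = ∑ λ a → ∑Word k λ l → f (a ∷ l)

module _ {n : ℕ} where

  private
    Word = List (Fin n)

  ∑Word-mono : ∀ k {f g : Word → ℕ} → (∀ l → length l ≡ k → f l ℕ.≤ g l) → ∑Word k f ℕ.≤ ∑Word k g
  ∑Word-mono zero    h = h [] refl
  ∑Word-mono (suc k) h = ∑-mono λ a → ∑Word-mono k λ l e → h (a ∷ l) (cong suc e)

  ∑Word-cong : ∀ k {f g : Word → ℕ} → (∀ l → length l ≡ k → f l ≡ g l) → ∑Word k f ≡ ∑Word k g
  ∑Word-cong zero    h = h [] refl
  ∑Word-cong (suc k) h = ∑-cong λ a → ∑Word-cong k λ l e → h (a ∷ l) (cong suc e)

  ∑Word-+ : ∀ k (f g : Word → ℕ) → ∑Word k (λ l → f l ℕ.+ g l) ≡ ∑Word k f ℕ.+ ∑Word k g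
  ∑Word-+ zero    f g = refl
  ∑Word-+ (suc k) f g = trans (∑-cong λ a → ∑Word-+ k _ _) (∑-+ _ _)

  ∑Word-* : ∀ k c (f : Word → ℕ) → ∑Word k (λ l → c ℕ.* f l) ≡ c ℕ.* ∑Word k f
  ∑Word-* zero    c f = refl
  ∑Word-* (suc k) c f = trans (∑-cong λ a → ∑Word-* k c _) (∑-* c (λ a → ∑Word k (λ l → f (a ∷ l))))

  ∑Word-∑ : ∀ k {m} (f : Word → Fin m → ℕ) → ∑Word k (λ l → ∑ (f l)) ≡ ∑ λ i → ∑Word k λ l → f l i
  ∑Word-∑ zero    f = refl
  ∑Word-∑ (suc k) f = trans (∑-cong λ a → ∑Word-∑ k (λ l → f (a ∷ l))) (∑-comm _)

  ∑Word-zero : ∀ k {f : Word → ℕ} → (∀ l → length l ≡ k → f l ≡ 0) → ∑Word k f ≡ 0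
  ∑Word-zero zero    h = h [] refl
  ∑Word-zero (suc k) h = trans (∑-cong λ a → ∑Word-zero k λ l e → h (a ∷ l) (cong suc e))
    (trans (∑-const n 0) (ℕP.*-zeroʳ n))

  ∑Word-shift : ∀ k (π : Permutation′ n) (f : Word → ℕ) → ∑Word k (λ l → f (List.map (π ⟨$⟩ʳ_) l)) ≡ ∑Word k f
  ∑Word-shift zero    π f = refl
  ∑Word-shift (suc k) π f = trans (∑-cong λ a → ∑Word-shift k π λ l → f ((π ⟨$⟩ʳ a) ∷ l))
    (∑-shift π λ a → ∑Word k λ l → f (a ∷ l))

  ∑Word-∷ʳ : ∀ k (f : Word → ℕ) → ∑Word (suc k) f ≡ ∑ λ a → ∑Word k λ l → f (l List.∷ʳ a)
  ∑Word-∷ʳ zero    f = refl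
  ∑Word-∷ʳ (suc k) f = trans (∑-cong λ a → ∑Word-∷ʳ k λ l → f (a ∷ l)) (∑-comm _)

  ∑Word-all : ∀ k (p : Fin n → Bool) → ∑Word k (λ l → 𝟙 (all p l)) ≡ ∑ (λ a → 𝟙 (p a)) ℕ.^ k
  ∑Word-all zero    p = refl
  ∑Word-all (suc k) p = trans (∑-cong λ a → trans (∑Word-cong k λ l _ → 𝟙-∧ (p a) (all p l))
                                                  (trans (∑Word-* k (𝟙 (p a)) λ l → 𝟙 (all p l)) (cong (𝟙 (p a) ℕ.*_) (∑Word-all k p))))
    (trans (∑-cong λ a → ℕP.*-comm (𝟙 (p a)) _) (trans (∑-* (∑ (λ a → 𝟙 (p a)) ℕ.^ k) λ a → 𝟙 (p a)) (ℕP.*-comm _ (∑ λ a → 𝟙 (p a)))))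
    where
    𝟙-∧ : ∀ b c → 𝟙 (b ∧ c) ≡ 𝟙 b ℕ.* 𝟙 c
    𝟙-∧ true  c = sym (ℕP.+-identityʳ _)
    𝟙-∧ false c = refl

  -- The splittings are into two complementary subsequences, 2^k of them for a word of length k,
  -- since the keys of different components are inserted in interleaved order.
  ∑Splits : Word → (Word → Word → ℕ) → ℕ
  ∑Splits []      g = g [] []
  ∑Splits (a ∷ ω) g = ∑Splits ω (λ l r → g (a ∷ l) r) ℕ.+ ∑Splits ω (λ l r → g l (a ∷ r))

∑Antidiagonal : ℕ → (ℕ → ℕ → ℕ) → ℕ
∑Antidiagonal zero    u = u 0 0
∑Antidiagonal (suc k) u = u 0 (suc k) ℕ.+ ∑Antidiagonal k (λ i j → u (suc i) j)

∑Antidiagonal-mono : ∀ k {u v : ℕ → ℕ → ℕ} → (∀ i j → i ℕ.+ j ≡ k → u i j ℕ.≤ v i j) → ∑Antidiagonal k u ℕ.≤ ∑Antidiagonal k v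
∑Antidiagonal-mono zero    h = h 0 0 refl
∑Antidiagonal-mono (suc k) h = ℕP.+-mono-≤ (h 0 (suc k) refl) (∑Antidiagonal-mono k λ i j e → h (suc i) j (cong suc e))

∑Antidiagonal-cong : ∀ k {u v : ℕ → ℕ → ℕ} → (∀ i j → i ℕ.+ j ≡ k → u i j ≡ v i j) → ∑Antidiagonal k u ≡ ∑Antidiagonal k v
∑Antidiagonal-cong zero    h = h 0 0 refl
∑Antidiagonal-cong (suc k) h = cong₂ ℕ._+_ (h 0 (suc k) refl) (∑Antidiagonal-cong k λ i j e → h (suc i) j (cong suc e))

∑Antidiagonal-last : ∀ k (u : ℕ → ℕ → ℕ) → ∑Antidiagonal (suc k) u ≡ ∑Antidiagonal k (λ i j → u i (suc j)) ℕ.+ u (suc k) 0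
∑Antidiagonal-last zero    u = refl
∑Antidiagonal-last (suc k) u = trans (cong (u 0 (suc (suc k)) ℕ.+_) (∑Antidiagonal-last k (λ i j → u (suc i) j))) (sym (ℕP.+-assoc (u 0 (suc (suc k))) _ _))

∑Antidiagonal-+ : ∀ k (u v : ℕ → ℕ → ℕ) → ∑Antidiagonal k (λ i j → u i j ℕ.+ v i j) ≡ ∑Antidiagonal k u ℕ.+ ∑Antidiagonal k v
∑Antidiagonal-+ zero    u v = refl
∑Antidiagonal-+ (suc k) u v = trans (cong (u 0 (suc k) ℕ.+ v 0 (suc k) ℕ.+_) (∑Antidiagonal-+ k (λ i → u (suc i)) (λ i → v (suc i)))) (swap (u 0 (suc k)) (v 0 (suc k)) _ _)
  where
  swap : ∀ a b c d → (a ℕ.+ b) ℕ.+ (c ℕ.+ d) ≡ (a ℕ.+ c) ℕ.+ (b ℕ.+ d)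
  swap = solve-∀

∑Antidiagonal-* : ∀ k c (u : ℕ → ℕ → ℕ) → ∑Antidiagonal k (λ i j → c ℕ.* u i j) ≡ c ℕ.* ∑Antidiagonal k u
∑Antidiagonal-* zero    c u = refl
∑Antidiagonal-* (suc k) c u = trans (cong (c ℕ.* u 0 (suc k) ℕ.+_) (∑Antidiagonal-* k c _)) (sym (ℕP.*-distribˡ-+ c (u 0 (suc k)) _))

-- choose i j is the binomial coefficient (i + j) over i.
choose : ℕ → ℕ → ℕ
choose zero    j       = 1
choose (suc i) zero    = 1
choose (suc i) (suc j) = choose i (suc j) ℕ.+ choose (suc i) j

choose-zeroʳ : ∀ i → choose i 0 ≡ 1
choose-zeroʳ zero    = refl
choose-zeroʳ (suc i) = refl

choose-! : ∀ i j → choose i j ℕ.* (i ! ℕ.* j !) ≡ (i ℕ.+ j) !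
choose-! zero    j       = trans (ℕP.+-identityʳ _) (ℕP.+-identityʳ _)
choose-! (suc i) zero    = trans (ℕP.+-identityʳ _) (trans (ℕP.*-identityʳ _) (cong _! (sym (ℕP.+-identityʳ (suc i)))))
choose-! (suc i) (suc j) = trans (expand (choose i (suc j)) (choose (suc i) j) i j (i !) (j !))
  (trans (cong₂ (λ x y → suc i ℕ.* x ℕ.+ suc j ℕ.* y) (choose-! i (suc j)) (choose-! (suc i) j))
  (trans (cong (λ x → suc i ℕ.* (i ℕ.+ suc j) ! ℕ.+ suc j ℕ.* x !) (sym (ℕP.+-suc i j)))
  (trans (sym (ℕP.*-distribʳ-+ ((i ℕ.+ suc j) !) (suc i) (suc j))) refl)))
  where
  expand : ∀ x y i j p q → (x ℕ.+ y) ℕ.* ((suc i ℕ.* p) ℕ.* (suc j ℕ.* q)) ≡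
           suc i ℕ.* (x ℕ.* (p ℕ.* (suc j ℕ.* q))) ℕ.+ suc j ℕ.* (y ℕ.* ((suc i ℕ.* p) ℕ.* q))
  expand = solve-∀

-- Both sides times `j !` are `(suc i + j) !`. The product `choose i j * i !` is the falling
-- factorial (i + j)! / j!, and this is its recurrence when one key passes from the second group to
-- the first.
choose-!-shift : ∀ i j → choose (suc i) j ℕ.* suc i ! ≡ suc j ℕ.* (choose i (suc j) ℕ.* i !)
choose-!-shift i j = ℕP.*-cancelʳ-≡ _ _ (j !) {{ℕP._!≢0 j}}
  (trans (ℕP.*-assoc (choose (suc i) j) _ _) (trans (choose-! (suc i) j)
  (trans (cong _! (sym (ℕP.+-suc i j))) (trans (sym (choose-! i (suc j))) (move (choose i (suc j)) (i !) (suc j) (j !))))))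
  where
  move : ∀ c p s q → c ℕ.* (p ℕ.* (s ℕ.* q)) ≡ s ℕ.* (c ℕ.* p) ℕ.* q
  move = solve-∀

-- Pascal's rule summed over an antidiagonal; the two sums on the left arise when the first letter
-- of a word is assigned to the left or to the right subword.
∑Antidiagonal-pascal : ∀ k (u : ℕ → ℕ → ℕ) →
              ∑Antidiagonal k (λ i j → choose i j ℕ.* u (suc i) j) ℕ.+ ∑Antidiagonal k (λ i j → choose i j ℕ.* u i (suc j)) ≡
              ∑Antidiagonal (suc k) (λ i j → choose i j ℕ.* u i j)
∑Antidiagonal-pascal zero    u = ℕP.+-comm (1 ℕ.* u 1 0) (1 ℕ.* u 0 1)
∑Antidiagonal-pascal (suc k) u = begin
  ∑Antidiagonal (suc k) (λ i j → choose i j ℕ.* u (suc i) j) ℕ.+ (1 ℕ.* u 0 (suc (suc k)) ℕ.+ B)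
    ≡⟨ cong (ℕ._+ (1 ℕ.* u 0 (suc (suc k)) ℕ.+ B)) (trans (∑Antidiagonal-last k (λ i j → choose i j ℕ.* u (suc i) j)) (cong (λ x → A ℕ.+ x ℕ.* u (suc (suc k)) 0) (choose-zeroʳ (suc k)))) ⟩
  (A ℕ.+ 1 ℕ.* u (suc (suc k)) 0) ℕ.+ (1 ℕ.* u 0 (suc (suc k)) ℕ.+ B)
    ≡⟨ swap A (1 ℕ.* u (suc (suc k)) 0) (1 ℕ.* u 0 (suc (suc k))) B ⟩
  1 ℕ.* u 0 (suc (suc k)) ℕ.+ ((A ℕ.+ B) ℕ.+ 1 ℕ.* u (suc (suc k)) 0)
    ≡⟨ cong (λ x → 1 ℕ.* u 0 (suc (suc k)) ℕ.+ (x ℕ.+ 1 ℕ.* u (suc (suc k)) 0))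
         (trans (sym (∑Antidiagonal-+ k _ _)) (∑Antidiagonal-cong k λ i j _ → sym (ℕP.*-distribʳ-+ (u (suc i) (suc j)) (choose i (suc j)) (choose (suc i) j)))) ⟩
  1 ℕ.* u 0 (suc (suc k)) ℕ.+ (∑Antidiagonal k (λ i j → choose (suc i) (suc j) ℕ.* u (suc i) (suc j)) ℕ.+ 1 ℕ.* u (suc (suc k)) 0)
    ≡⟨ cong (1 ℕ.* u 0 (suc (suc k)) ℕ.+_) (sym (∑Antidiagonal-last k (λ i j → choose (suc i) j ℕ.* u (suc i) j))) ⟩
  ∑Antidiagonal (suc (suc k)) (λ i j → choose i j ℕ.* u i j) ∎
  where
  open ≡-Reasoning
  A = ∑Antidiagonal k (λ i j → choose i (suc j) ℕ.* u (suc i) (suc j))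
  B = ∑Antidiagonal k (λ i j → choose (suc i) j ℕ.* u (suc i) (suc j))
  swap : ∀ a b c d → (a ℕ.+ b) ℕ.+ (c ℕ.+ d) ≡ c ℕ.+ ((a ℕ.+ d) ℕ.+ b)
  swap = solve-∀

-- All letters are summed over independently, so the positions chosen for the left subword do not
-- matter and only their number `choose i j` remains.
∑Word-∑Splits : ∀ {n} k (g : List (Fin n) → List (Fin n) → ℕ) →
           ∑Word k (λ ω → ∑Splits ω g) ≡ ∑Antidiagonal k (λ i j → choose i j ℕ.* ∑Word i λ l → ∑Word j λ r → g l r)
∑Word-∑Splits zero    g = sym (ℕP.+-identityʳ _)
∑Word-∑Splits (suc k) g = begin
  ∑ (λ a → ∑Word k λ ω → ∑Splits ω (λ l r → g (a ∷ l) r) ℕ.+ ∑Splits ω (λ l r → g l (a ∷ r)))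
    ≡⟨ ∑-cong (λ a → ∑Word-+ k (λ ω → ∑Splits ω (λ l r → g (a ∷ l) r)) (λ ω → ∑Splits ω (λ l r → g l (a ∷ r)))) ⟩
  ∑ (λ a → ∑Word k (λ ω → ∑Splits ω (λ l r → g (a ∷ l) r)) ℕ.+ ∑Word k (λ ω → ∑Splits ω (λ l r → g l (a ∷ r))))
    ≡⟨ ∑-+ _ _ ⟩
  ∑ (λ a → ∑Word k (λ ω → ∑Splits ω (λ l r → g (a ∷ l) r))) ℕ.+ ∑ (λ a → ∑Word k (λ ω → ∑Splits ω (λ l r → g l (a ∷ r))))
    ≡⟨ cong₂ ℕ._+_ (trans (∑-cong λ a → ∑Word-∑Splits k _) (∑-∑Antidiagonal k _))
                   (trans (∑-cong λ a → ∑Word-∑Splits k _) (∑-∑Antidiagonal k _)) ⟩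
  ∑Antidiagonal k (λ i j → ∑ λ a → choose i j ℕ.* ∑Word i λ l → ∑Word j λ r → g (a ∷ l) r) ℕ.+
  ∑Antidiagonal k (λ i j → ∑ λ a → choose i j ℕ.* ∑Word i λ l → ∑Word j λ r → g l (a ∷ r))
    ≡⟨ cong₂ ℕ._+_ (∑Antidiagonal-cong k λ i j _ → ∑-* (choose i j) (λ a → ∑Word i λ l → ∑Word j λ r → g (a ∷ l) r))
                   (∑Antidiagonal-cong k λ i j _ → trans (∑-* (choose i j) (λ a → ∑Word i λ l → ∑Word j λ r → g l (a ∷ r)))
                                                (cong (choose i j ℕ.*_) (sym (∑Word-∑ i _)))) ⟩
  ∑Antidiagonal k (λ i j → choose i j ℕ.* F (suc i) j) ℕ.+ ∑Antidiagonal k (λ i j → choose i j ℕ.* F i (suc j))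
    ≡⟨ ∑Antidiagonal-pascal k F ⟩
  ∑Antidiagonal (suc k) (λ i j → choose i j ℕ.* F i j) ∎
  where
  open ≡-Reasoning
  F : ℕ → ℕ → ℕ
  F i j = ∑Word i λ l → ∑Word j λ r → g l r
  ∑-∑Antidiagonal : ∀ k {m} (u : Fin m → ℕ → ℕ → ℕ) → ∑ (λ a → ∑Antidiagonal k (u a)) ≡ ∑Antidiagonal k (λ i j → ∑ λ a → u a i j)
  ∑-∑Antidiagonal zero    u = refl
  ∑-∑Antidiagonal (suc k) u = trans (∑-+ _ _) (cong (∑ (λ a → u a 0 (suc k)) ℕ.+_) (∑-∑Antidiagonal k _))

-- Fixed-offset probing

module _ {n : ℕ} where

  Slots : Set
  Slots = Fin n → Bool

  ∅ : Slots
  ∅ _ = false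

  infixr 5 _∪_

  _∪_ : Slots → Slots → Slots
  (S ∪ S′) s = S s ∨ S′ s

  add : Maybe (Fin n) → Slots → Slots
  add nothing  S = S
  add (just p) S s = does (s ≟ p) ∨ S s

  card : Slots → ℕ
  card S = ∑ λ s → 𝟙 (S s)

  firstFree : List (Fin n) → Slots → Maybe (Fin n)
  firstFree []       S = nothing
  firstFree (q ∷ qs) S = if S q then firstFree qs S else just q

  busy : List (Fin n) → Slots → ℕ
  busy []       S = 0
  busy (q ∷ qs) S = if S q then suc (busy qs S) else 0

  firstFree-free : ∀ qs S {p} → firstFree qs S ≡ just p → S p ≡ false
  firstFree-free (q ∷ qs) S eq with S q in e
  ... | true = firstFree-free qs S eq
  firstFree-free (q ∷ qs) S refl | false = e

  firstFree-cong : ∀ qs {S S′} → (∀ s → S s ≡ S′ s) → firstFree qs S ≡ firstFree qs S′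
  firstFree-cong []       h = refl
  firstFree-cong (q ∷ qs) {S} h rewrite sym (h q) with S q
  ... | true  = firstFree-cong qs h
  ... | false = refl

  -- Probes before the stopping slot lie in S already, so S′ can interfere only at the stopping slot
  -- itself. All locality of components rests on this.
  search-∪ : ∀ qs S S′ → (∀ p → firstFree qs S ≡ just p → S′ p ≡ false) →
             firstFree qs (S ∪ S′) ≡ firstFree qs S × busy qs (S ∪ S′) ≡ busy qs S
  search-∪ []       S S′ h = refl , refl
  search-∪ (q ∷ qs) S S′ h with S q
  ... | true  = proj₁ (search-∪ qs S S′ h) , cong suc (proj₂ (search-∪ qs S S′ h))
  ... | false rewrite h q refl = refl , refl

  busy-nothing : ∀ qs S → firstFree qs S ≡ nothing → busy qs S ≡ length qs
  busy-nothing []       S eq = refl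
  busy-nothing (q ∷ qs) S eq with S q
  ... | true = cong suc (busy-nothing qs S eq)
  busy-nothing (q ∷ qs) S () | false

opaque
  unfolding ∑

  card-∅ : ∀ {n} → card {n} ∅ ≡ 0
  card-∅ {n} = trans (∑-const n 0) (ℕP.*-zeroʳ n)

  card-add : ∀ {n} (p : Fin n) S → S p ≡ false → card (add (just p) S) ≡ suc (card S)
  card-add Fin.zero    S h rewrite h = refl
  card-add (Fin.suc p) S h = trans (cong (𝟙 (S Fin.zero) ℕ.+_)
    (card-add p (S ∘ Fin.suc) h))
    (ℕP.+-suc (𝟙 (S Fin.zero)) _)

card-add-≤ : ∀ {n} (p : Maybe (Fin n)) S → card (add p S) ℕ.≤ suc (card S)
card-add-≤ nothing  S = ℕP.n≤1+n _
card-add-≤ (just p) S with S p in e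
... | false = ℕP.≤-reflexive (card-add p S e)
... | true  = ℕP.≤-trans (∑-mono same) (ℕP.n≤1+n _)
  where
  same : ∀ s → 𝟙 (does (s ≟ p) ∨ S s) ℕ.≤ 𝟙 (S s)
  same s with s ≟ p
  ... | yes refl rewrite e = ℕP.≤-refl
  ... | no _     = ℕP.≤-refl

card-not : ∀ {n} (S : Slots {n}) → card (not ∘ S) ≡ n ∸ card S
card-not {n} S = trans (sym (ℕP.m+n∸m≡n (card S) _)) (cong (_∸ card S)
  (trans (sym (∑-+ (𝟙 ∘ S) (𝟙 ∘ not ∘ S))) (trans (∑-cong λ s → one (S s)) (trans (∑-const n 1) (ℕP.*-identityʳ n)))))
  where
  one : ∀ b → 𝟙 b ℕ.+ 𝟙 (not b) ≡ 1
  one true  = refl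
  one false = refl

-- The occupied probes before the first free one are distinct elements of S; the induction removes
-- the head probe from S. This is where distinctness of the probes enters.
busy-≤-card : ∀ {n} (qs : List (Fin n)) S → Unique qs → busy qs S ℕ.≤ card S
busy-≤-card []       S u = z≤n
busy-≤-card (q ∷ qs) S (q∉ ∷ u) with S q in e
... | false = z≤n
... | true  = ℕP.≤-trans (s≤s (ℕP.≤-trans (ℕP.≤-reflexive (busy-minus qs q∉)) (busy-≤-card qs S-q u)))
    (ℕP.≤-reflexive (trans (sym (card-add q S-q S-q-q)) (∑-cong λ s → cong 𝟙 (restore s))))
  where
  S-q : Slots
  S-q s = not (does (s ≟ q)) ∧ S s
  S-q-q : S-q q ≡ false
  S-q-q with q ≟ q
  ... | yes _  = refl
  ... | no q≢q = ⊥-elim (q≢q refl)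
  restore : ∀ s → add (just q) S-q s ≡ S s
  restore s with s ≟ q
  ... | yes refl = sym e
  ... | no _     = refl
  busy-minus : ∀ qs → All (q ≢_) qs → busy qs S ≡ busy qs S-q
  busy-minus []       []       = refl
  busy-minus (r ∷ qs) (q≢r ∷ h) with r ≟ q
  ... | yes r≡q = ⊥-elim (q≢r (sym r≡q))
  ... | no _    with S r
  ...   | true  = cong suc (busy-minus qs h)
  ...   | false = refl

-- A fixed-offset probing scheme; a word lists hash values from the most recent insertion to the
-- earliest one, and an insertion whose probes are all occupied has no effect.
module Scheme {n : ℕ} (later : Fin n → List (Fin n)) where

  Word : Set
  Word = List (Fin n)

  probes : Fin n → List (Fin n)
  probes a = a ∷ later a

  first : Fin n → Slots → Maybe (Fin n)
  first a S = firstFree (probes a) S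

  occ : Word → Slots
  occ []      = ∅
  occ (a ∷ ω) = add (first a (occ ω)) (occ ω)

  ok : Word → Bool
  ok []      = true
  ok (a ∷ ω) = is-just (first a (occ ω)) ∧ ok ω

  card-occ-≤ : ∀ ω → card (occ ω) ℕ.≤ length ω
  card-occ-≤ []      = ℕP.≤-reflexive card-∅
  card-occ-≤ (a ∷ ω) = ℕP.≤-trans (card-add-≤ (first a (occ ω)) (occ ω)) (s≤s (card-occ-≤ ω))

  card-occ : ∀ ω → ok ω ≡ true → card (occ ω) ≡ length ω
  card-occ []      h = card-∅
  card-occ (a ∷ ω) h with first a (occ ω) in e
  ... | just p = trans (card-add p (occ ω) (firstFree-free (probes a) (occ ω) e)) (cong suc (card-occ ω h))

  occ-mono : ∀ a ω s → occ ω s ≡ true → occ (a ∷ ω) s ≡ true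
  occ-mono a ω s h with first a (occ ω)
  ... | nothing = h
  ... | just p rewrite h = ∨-zeroʳ _

  -- Slot a is either occupied before the insertion or is its first free probe. This turns
  -- statements about filled slots into conditions on hash values.
  occ-head : ∀ a ω → occ (a ∷ ω) a ≡ true
  occ-head a ω with occ ω a in e
  ... | true with firstFree (later a) (occ ω)
  ...   | nothing = e
  ...   | just p rewrite e = ∨-zeroʳ _
  occ-head a ω | false with a ≟ a
  ... | yes _  = refl
  ... | no a≢a = ⊥-elim (a≢a refl)

  -- All probes of a before its first free slot hit slots of its own subword, so the conditions say that neither
  -- subword ever probes a slot of the other.
  data Independent : Word → Word → Word → Set where
    []    : Independent [] [] []
    left  : ∀ {a l r ω} → Independent l r ω → (∀ p → first a (occ l) ≡ just p → occ r p ≡ false) →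
            Independent (a ∷ l) r (a ∷ ω)
    right : ∀ {a l r ω} → Independent l r ω → (∀ p → first a (occ r) ≡ just p → occ l p ≡ false) →
            Independent l (a ∷ r) (a ∷ ω)

  swap : ∀ {l r ω} → Independent l r ω → Independent r l ω
  swap []          = []
  swap (left i h)  = right (swap i) h
  swap (right i h) = left (swap i) h

  -- The hypothesis on `occ ω` is the conclusion of `occ-split`, which is itself proved by induction
  -- through this lemma and `occ-∪`.
  first-∪ : ∀ {a l r ω} → (∀ s → occ ω s ≡ occ l s ∨ occ r s) → (∀ p → first a (occ l) ≡ just p → occ r p ≡ false) →
            first a (occ ω) ≡ first a (occ l)
  first-∪ {a} {l} {r} i h = trans (firstFree-cong (probes a) i) (proj₁ (search-∪ (probes a) (occ l) (occ r) h))

  occ-∪ : ∀ {a l r ω} → (∀ s → occ ω s ≡ occ l s ∨ occ r s) → (∀ p → first a (occ l) ≡ just p → occ r p ≡ false) →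
          ∀ s → occ (a ∷ ω) s ≡ occ (a ∷ l) s ∨ occ r s
  occ-∪ {a} {l} {r} {ω} i h s rewrite first-∪ {a} {l} {r} {ω} i h with first a (occ l)
  ... | nothing = i s
  ... | just p  = trans (cong (does (s ≟ p) ∨_) (i s)) (sym (∨-assoc (does (s ≟ p)) _ _))

  occ-split : ∀ {l r ω} → Independent l r ω → ∀ s → occ ω s ≡ occ l s ∨ occ r s
  occ-split []        s = refl
  occ-split (left {a} {l} {r} {ω} i h) s = occ-∪ {a} {l} {r} {ω} (occ-split i) h s
  occ-split (right {a} {l} {r} {ω} i h) s =
    trans (occ-∪ {a} {r} {l} {ω} (λ s → trans (occ-split i s) (∨-comm (occ l s) _)) h s) (∨-comm (occ (a ∷ r) s) (occ l s))

  first-left : ∀ {a l r ω} → Independent l r ω → (∀ p → first a (occ l) ≡ just p → occ r p ≡ false) →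
               first a (occ ω) ≡ first a (occ l)
  first-left {a} {l} {r} {ω} i h = first-∪ {a} {l} {r} {ω} (occ-split i) h

  disjoint : ∀ {l r ω} → Independent l r ω → ∀ s → occ l s ≡ true → occ r s ≡ false
  disjoint (left {a} {l} i h) s e with first a (occ l)
  ... | nothing = disjoint i s e
  ... | just p with s ≟ p
  ...   | yes refl = h p refl
  ...   | no _     = disjoint i s e
  disjoint (right {a} {l} {r} i h) s e with first a (occ r)
  ... | nothing = disjoint i s e
  ... | just p with s ≟ p
  ...   | no _     = disjoint i s e
  ...   | yes refl with trans (sym e) (h p refl)
  ...     | ()

  ok-left : ∀ {l r ω} → Independent l r ω → ok ω ≡ true → ok l ≡ true
  ok-left []         e = refl
  ok-left (left {a} {l} {r} {ω} i h) e rewrite first-left {a = a} i h with first a (occ l)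
  ... | just _ = ok-left i e
  ok-left (right {a} {l} {r} {ω} i h) e with first a (occ ω)
  ... | just _ = ok-left i e

  length-split : ∀ {l r ω} → Independent l r ω → length l ℕ.+ length r ≡ length ω
  length-split []          = refl
  length-split (left i _)  = cong suc (length-split i)
  length-split (right {l = l} i _) = trans (ℕP.+-suc (length l) _) (cong suc (length-split i))

  -- An independent splitting is one of the summands. Exhibiting one of positive weight thus makes
  -- the whole sum positive, which is the form of the union bound.
  ∑Splits-≥ : ∀ {l r ω} → Independent l r ω → ∀ g → g l r ℕ.≤ ∑Splits ω g
  ∑Splits-≥ []          g = ℕP.≤-refl
  ∑Splits-≥ (left i _)  g = ℕP.≤-trans (∑Splits-≥ i _) (ℕP.m≤m+n _ _)
  ∑Splits-≥ (right i _) g = ℕP.≤-trans (∑Splits-≥ i _) (ℕP.m≤n+m _ _)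

  all-trivial : ∀ l → Independent l [] l
  all-trivial []      = []
  all-trivial (a ∷ l) = left (all-trivial l) λ _ _ → refl

  ∨-falseˡ : ∀ {b c} → b ∨ c ≡ false → b ≡ false
  ∨-falseˡ {false} e = refl

  ∨-falseʳ : ∀ {b c} → b ∨ c ≡ false → c ≡ false
  ∨-falseʳ {false} e = e

  -- Associativity: l₁ split off from ω and l₂ from the remainder can be split off together. A key
  -- of one part stops outside the slots of the other two, because `occ-split` resolves the slots of
  -- a union into those of its parts.
  merge : ∀ {l₁ r₁ l₂ r₂ ω} → Independent l₁ r₁ ω → Independent l₂ r₂ r₁ →
          ∃ λ l → Independent l r₂ ω × Independent l₁ l₂ l
  merge [] [] = [] , [] , []
  merge {l₂ = l₂} {r₂} (left {a} {l₁} {r₁} i h) j with merge i j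
  ... | l , i′ , j′ = a ∷ l , left i′ out , left j′ keep
    where
    split : ∀ p → first a (occ l₁) ≡ just p → occ l₂ p ∨ occ r₂ p ≡ false
    split p e = trans (sym (occ-split j p)) (h p e)
    keep : ∀ p → first a (occ l₁) ≡ just p → occ l₂ p ≡ false
    keep p e = ∨-falseˡ (split p e)
    out : ∀ p → first a (occ l) ≡ just p → occ r₂ p ≡ false
    out p e = ∨-falseʳ {occ l₂ p} (split p (trans (sym (first-left j′ keep)) e))
  merge (right {a} {l₁} {r₁} i h) (left {a} {l₂} {r₂} j k) with merge i j
  ... | l , i′ , j′ = a ∷ l , left i′ out , right j′ avoid
    where
    avoid : ∀ p → first a (occ l₂) ≡ just p → occ l₁ p ≡ false
    avoid p e = h p (trans (first-left j k) e)
    out : ∀ p → first a (occ l) ≡ just p → occ r₂ p ≡ false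
    out p e = k p (trans (sym (first-left (swap j′) avoid)) e)
  merge (right {a} {l₁} {r₁} i h) (right {a} {l₂} {r₂} j k) with merge i j
  ... | l , i′ , j′ = l , right i′ out , j′
    where
    out : ∀ p → first a (occ r₂) ≡ just p → occ l p ≡ false
    out p e = trans (occ-split j′ p) (cong₂ _∨_ (h p (trans (first-left (swap j) k) e)) (k p e))

-- The component structure

*-≥1 : ∀ {a b} → 1 ℕ.≤ a → 1 ℕ.≤ b → 1 ℕ.≤ a ℕ.* b
*-≥1 = ℕP.*-mono-≤

module Witness {n : ℕ} (later : Fin n → List (Fin n)) where

  open Scheme later

  -- children d a S r bounds the number of ways in which the components hit by the probes of a, other than
  -- the slots S seen already, can use up the insertions of r; rooted d s l does so for a component l
  -- that contains the slot s. The fuel d only has to reach the length of the word.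
  mutual

    children : ℕ → Fin n → Slots → Word → ℕ
    children zero    a S r = 𝟙 (null r)
    children (suc d) a S r = 𝟙 (null r) ℕ.+ next d a S r (first a S)

    next : ℕ → Fin n → Slots → Word → Maybe (Fin n) → ℕ
    next d a S r nothing  = 0
    next d a S r (just s) = ∑Splits r λ l r′ → rooted d s l ℕ.* children d a (S ∪ occ l) r′

    rooted : ℕ → Fin n → Word → ℕ
    rooted d s []      = 0
    rooted d s (b ∷ l) = children d b ∅ l ℕ.* 𝟙 (ok (b ∷ l) ∧ occ (b ∷ l) s)

  children-[] : ∀ d a S → 1 ℕ.≤ children d a S []
  children-[] zero    a S = ℕP.≤-refl
  children-[] (suc d) a S = s≤s z≤n

  mutual

    -- Follows the probes of a. If the first probe outside S is occupied, the component filling it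
    -- is split off and its slots join the seen ones; otherwise the search stops there. The last
    -- conclusion is exactly the hypothesis of `search-∪`: the remainder r cannot influence the
    -- insertion of a. The fuels differ because `component` may pass over keys, which shortens the
    -- word while the index of `rooted d` has to stay the same: e drives the recursion, d indexes
    -- the weights.
    explore : ∀ e d ω a S → length ω ℕ.≤ e → length ω ℕ.≤ d → ok ω ≡ true →
              ∃₂ λ l r → Independent l r ω × 1 ℕ.≤ children d a S l ×
                         (∀ p → first a (S ∪ occ l) ≡ just p → occ r p ≡ false)
    explore e d ω a S he hd hω with first a S in eq
    ... | nothing = [] , ω , swap (all-trivial ω) , children-[] d a S , none
      where
      none : ∀ p → first a (S ∪ ∅) ≡ just p → occ ω p ≡ false
      none p h with trans (sym eq) (trans (sym (firstFree-cong (probes a) λ s → ∨-identityʳ (S s))) h)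
      ... | ()
    ... | just q with occ ω q in hq
    ...   | false = [] , ω , swap (all-trivial ω) , children-[] d a S , free
      where
      free : ∀ p → first a (S ∪ ∅) ≡ just p → occ ω p ≡ false
      free p h with trans (sym eq) (trans (sym (firstFree-cong (probes a) λ s → ∨-identityʳ (S s))) h)
      ... | refl = hq
    explore e d [] a S he hd hω | just q | true with hq
    ... | ()
    explore (suc e) (suc d) ω@(_ ∷ _) a S he hd hω | just q | true
      with component (suc e) d ω q he hd hω hq
    ... | l₁ , r₁ , i₁ , w₁ , q∈ with explore e d r₁ a (S ∪ occ l₁) (shorter l₁ q∈ i₁ he) (shorter l₁ q∈ i₁ hd) (ok-left (swap i₁) hω)
    ...   | l₂ , r₂ , i₂ , w₂ , h with merge i₁ i₂
    ...     | l , i , j = l , r₂ , i , positive , λ p e → h p (trans (firstFree-cong (probes a) λ s →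
                trans (∨-assoc (S s) (occ l₁ s) (occ l₂ s)) (cong (S s ∨_) (sym (occ-split j s)))) e)
      where
      positive : 1 ℕ.≤ children (suc d) a S l
      positive rewrite eq = ℕP.≤-trans (*-≥1 w₁ w₂) (ℕP.≤-trans
        (∑Splits-≥ j λ l r → rooted d q l ℕ.* children d a (S ∪ occ l) r) (ℕP.m≤n+m _ (𝟙 (null l))))

    -- Progress: a component that fills q has at least one key.
    shorter : ∀ {q e r₁ ω} l₁ → occ l₁ q ≡ true → Independent l₁ r₁ ω → length ω ℕ.≤ suc e → length r₁ ℕ.≤ e
    shorter {r₁ = r₁} (b ∷ l₁) _ i h = ℕP.≤-trans (ℕP.m≤n+m (length r₁) (length l₁))
      (ℕP.≤-pred (subst (ℕ._≤ suc _) (sym (length-split i)) h))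

    -- The newest key a and the components it merges form a component independent of the rest.
    -- Either it fills q, or q is filled by the rest; in the latter case the component of q is
    -- sought there, and `merge` returns the keys passed over to the remainder.
    component : ∀ e d ω q → length ω ℕ.≤ e → length ω ℕ.≤ suc d → ok ω ≡ true → occ ω q ≡ true →
                ∃₂ λ l r → Independent l r ω × 1 ℕ.≤ rooted d q l × occ l q ≡ true
    component (suc e) d (a ∷ ω) q (s≤s he) (s≤s hd) hω hq
      with explore e d ω a ∅ he hd (ok-tail hω)
      where
      ok-tail : is-just (first a (occ ω)) ∧ ok ω ≡ true → ok ω ≡ true
      ok-tail h with is-just (first a (occ ω))
      ... | true = h
    ... | l , r , i , w , h with occ (a ∷ l) q in hl
    ...   | true = a ∷ l , r , left i h , *-≥1 w one , hl
      where
      one : 1 ℕ.≤ 𝟙 (ok (a ∷ l) ∧ occ (a ∷ l) q)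
      one rewrite ok-left (left i h) hω | hl = ℕP.≤-refl
    ...   | false with component e d r q (ℕP.≤-trans r≤ω he) (ℕP.≤-trans r≤ω (ℕP.m≤n⇒m≤1+n hd)) (ok-left (swap (left i h)) hω)
                         (trans (sym (trans (occ-split (left i h) q) (cong (_∨ occ r q) hl))) hq)
      where
      r≤ω : length r ℕ.≤ length ω
      r≤ω = subst (length r ℕ.≤_) (length-split i) (ℕP.m≤n+m (length r) (length l))
    ...     | l₂ , r₂ , i₂ , w₂ , q∈ = l₂ , proj₁ m , swap (proj₁ (proj₂ m)) , w₂ , q∈
      where
      m = merge (left i h) (swap i₂)

  hashes-occ : ∀ ω → All (λ b → occ ω b ≡ true) ω
  hashes-occ []      = []
  hashes-occ (a ∷ ω) = occ-head a ω ∷ All.map (λ {b} → occ-mono a ω b) (hashes-occ ω)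

  -- A consequence of independence that is a product condition on the letters of r, so that the
  -- words r satisfying it are counted by a plain power.
  avoids : Word → Word → Bool
  avoids l r = all (not ∘ occ l) r

  independent-avoids : ∀ {l r ω} → Independent l r ω → avoids l r ≡ true
  independent-avoids {l} {r} i = go r (hashes-occ r)
    where
    go : ∀ bs → All (λ b → occ r b ≡ true) bs → avoids l bs ≡ true
    go []       []       = refl
    go (b ∷ bs) (h ∷ hs) rewrite disjoint (swap i) b h = go bs hs

  -- By `search-∪` the probes of a meet as many occupied slots in the whole table as among the slots
  -- of l, and l fills at most `length l` slots.
  newest-component : (∀ a → Unique (probes a)) → ∀ ω a → ok ω ≡ true →
                     ∃₂ λ l r → Independent l r ω × 1 ℕ.≤ children (length ω) a ∅ l ℕ.* (𝟙 (ok l) ℕ.* 𝟙 (avoids l r)) ×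
                                busy (probes a) (occ ω) ℕ.≤ length l
  newest-component unique ω a hω with explore (length ω) (length ω) ω a ∅ ℕP.≤-refl ℕP.≤-refl hω
  ... | l , r , i , w , h = l , r , i , *-≥1 w (*-≥1 (one (ok-left i hω)) (one (independent-avoids i))) ,
    ℕP.≤-trans (ℕP.≤-reflexive (trans (busy-cong (probes a)) (proj₂ (search-∪ (probes a) (occ l) (occ r) h))))
               (ℕP.≤-trans (busy-≤-card (probes a) (occ l) (unique a)) (card-occ-≤ l))
    where
    one : ∀ {b} → b ≡ true → 1 ℕ.≤ 𝟙 b
    one refl = ℕP.≤-refl
    busy-cong : ∀ qs → busy qs (occ ω) ≡ busy qs (occ l ∪ occ r)
    busy-cong []       = refl
    busy-cong (q ∷ qs) rewrite occ-split i q with occ l q ∨ occ r q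
    ... | true  = cong suc (busy-cong qs)
    ... | false = refl

-- Counting components

-- ballot r k is the coefficient of x^k in the r-th power of the Catalan series D = 1 + x D².
ballot : ℕ → ℕ → ℕ
ballot zero    zero    = 1
ballot zero    (suc k) = 0
ballot (suc r) zero    = ballot r zero
ballot (suc r) (suc k) = ballot r (suc k) ℕ.+ ballot (suc (suc r)) k

catalan : ℕ → ℕ
catalan = ballot 1

ballot-zeroʳ : ∀ r → ballot r 0 ≡ 1
ballot-zeroʳ zero    = refl
ballot-zeroʳ (suc r) = ballot-zeroʳ r

-- D^r D^s = D^(r+s). The defining clauses of `ballot` are D^(r+1) = D^r + x D^(r+2), and the
-- product inherits this recurrence in r.
ballot-conv : ∀ r s k → ∑Antidiagonal k (λ i j → ballot r i ℕ.* ballot s j) ≡ ballot (r ℕ.+ s) k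
ballot-conv zero s zero = ℕP.+-identityʳ _
ballot-conv zero s (suc k) = trans (cong₂ ℕ._+_ (ℕP.+-identityʳ _) (∑Antidiagonal-* k 0 λ i j → ballot s j)) (ℕP.+-identityʳ _)
ballot-conv (suc r) s zero = trans (cong₂ ℕ._*_ (ballot-zeroʳ r) (ballot-zeroʳ s)) (sym (ballot-zeroʳ (r ℕ.+ s)))
ballot-conv (suc r) s (suc k) = begin
  ballot r 0 ℕ.* ballot s (suc k) ℕ.+ ∑Antidiagonal k (λ i j → (ballot r (suc i) ℕ.+ ballot (suc (suc r)) i) ℕ.* ballot s j)
    ≡⟨ cong (ballot r 0 ℕ.* ballot s (suc k) ℕ.+_)
         (trans (∑Antidiagonal-cong k λ i j _ → ℕP.*-distribʳ-+ (ballot s j) (ballot r (suc i)) _) (∑Antidiagonal-+ k _ _)) ⟩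
  ballot r 0 ℕ.* ballot s (suc k) ℕ.+ (∑Antidiagonal k (λ i j → ballot r (suc i) ℕ.* ballot s j) ℕ.+
                                       ∑Antidiagonal k (λ i j → ballot (suc (suc r)) i ℕ.* ballot s j))
    ≡⟨ sym (ℕP.+-assoc (ballot r 0 ℕ.* ballot s (suc k)) _ _) ⟩
  ∑Antidiagonal (suc k) (λ i j → ballot r i ℕ.* ballot s j) ℕ.+ ∑Antidiagonal k (λ i j → ballot (suc (suc r)) i ℕ.* ballot s j)
    ≡⟨ cong₂ ℕ._+_ (ballot-conv r s (suc k)) (ballot-conv (suc (suc r)) s k) ⟩
  ballot (suc r ℕ.+ s) (suc k) ∎
  where open ≡-Reasoning

-- D has radius of convergence 1/4 and D(1/4) = 2, so the k-th coefficient of D^r is at most 2^r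
-- 4^k. The recurrence reproduces this bound with equality.
ballot-≤ : ∀ r k → ballot r k ℕ.≤ 4 ℕ.^ k ℕ.* 2 ℕ.^ r
ballot-≤ zero    zero    = ℕP.≤-refl
ballot-≤ zero    (suc k) = z≤n
ballot-≤ (suc r) zero    = ℕP.≤-trans (ballot-≤ r zero) (ℕP.*-monoʳ-≤ 1 (ℕP.m≤n*m (2 ℕ.^ r) 2))
ballot-≤ (suc r) (suc k) = ℕP.≤-trans (ℕP.+-mono-≤ (ballot-≤ r (suc k)) (ballot-≤ (suc (suc r)) k))
  (ℕP.≤-reflexive (regroup (4 ℕ.^ k) (2 ℕ.^ r)))
  where
  regroup : ∀ x y → 4 ℕ.* x ℕ.* y ℕ.+ x ℕ.* (2 ℕ.* (2 ℕ.* y)) ≡ 4 ℕ.* x ℕ.* (2 ℕ.* y)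
  regroup = solve-∀

module Count {n : ℕ} (later : Fin n → List (Fin n))
             (translate : ∀ s s′ → ∃ λ (π : Permutation′ n) → π ⟨$⟩ʳ s ≡ s′ × (∀ a → later (π ⟨$⟩ʳ a) ≡ List.map (π ⟨$⟩ʳ_) (later a)))
             where

  open Scheme later
  open Witness later

  module Equivariance (π : Permutation′ n) (equivariant : ∀ a → later (π ⟨$⟩ʳ a) ≡ List.map (π ⟨$⟩ʳ_) (later a)) where

    τ : Fin n → Fin n
    τ = π ⟨$⟩ʳ_

    -- Slot sets are functions, so a set and its image are given as a pair related pointwise, here
    -- and in the lemmas that follow.
    firstFree-τ : ∀ qs {S S′} → (∀ s → S′ (τ s) ≡ S s) → firstFree (List.map τ qs) S′ ≡ Maybe.map τ (firstFree qs S)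
    firstFree-τ []       h = refl
    firstFree-τ (q ∷ qs) {S} h rewrite h q with S q
    ... | true  = firstFree-τ qs h
    ... | false = refl

    first-τ : ∀ a {S S′} → (∀ s → S′ (τ s) ≡ S s) → first (τ a) S′ ≡ Maybe.map τ (first a S)
    first-τ a h rewrite equivariant a = firstFree-τ (probes a) h

    ≟-τ : ∀ s p → does (τ s ≟ τ p) ≡ does (s ≟ p)
    ≟-τ s p with s ≟ p | τ s ≟ τ p
    ... | yes _    | yes _   = refl
    ... | yes refl | no h    = ⊥-elim (h refl)
    ... | no h     | yes e   = ⊥-elim (h (trans (sym (inverseˡ π)) (trans (cong (π ⟨$⟩ˡ_) e) (inverseˡ π))))
    ... | no _     | no _    = refl

    add-τ : ∀ p {S S′} → (∀ s → S′ (τ s) ≡ S s) → ∀ s → add (Maybe.map τ p) S′ (τ s) ≡ add p S s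
    add-τ nothing  h s = h s
    add-τ (just p) h s = cong₂ _∨_ (≟-τ s p) (h s)

    occ-τ : ∀ ω s → occ (List.map τ ω) (τ s) ≡ occ ω s
    occ-τ []      s = refl
    occ-τ (a ∷ ω) s = trans (cong (λ p → add p (occ (List.map τ ω)) (τ s)) (first-τ a {S′ = occ (List.map τ ω)} (occ-τ ω))) (add-τ (first a (occ ω)) (occ-τ ω) s)

    ok-τ : ∀ ω → ok (List.map τ ω) ≡ ok ω
    ok-τ []      = refl
    ok-τ (a ∷ ω) = cong₂ _∧_ (trans (cong is-just (first-τ a {S′ = occ (List.map τ ω)} (occ-τ ω))) (is-just-map (first a (occ ω)))) (ok-τ ω)
      where
      is-just-map : ∀ p → is-just (Maybe.map τ p) ≡ is-just p
      is-just-map nothing  = refl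
      is-just-map (just p) = refl

    null-τ : ∀ (ω : Word) → null (List.map τ ω) ≡ null ω
    null-τ []      = refl
    null-τ (a ∷ ω) = refl

    ∑Splits-τ : ∀ ω {g g′ : Word → Word → ℕ} → (∀ l r → g′ (List.map τ l) (List.map τ r) ≡ g l r) → ∑Splits (List.map τ ω) g′ ≡ ∑Splits ω g
    ∑Splits-τ []      h = h [] []
    ∑Splits-τ (a ∷ ω) h = cong₂ ℕ._+_ (∑Splits-τ ω λ l r → h (a ∷ l) r) (∑Splits-τ ω λ l r → h l (a ∷ r))

    mutual

      children-τ : ∀ d a {S S′} → (∀ s → S′ (τ s) ≡ S s) → ∀ r → children d (τ a) S′ (List.map τ r) ≡ children d a S r
      children-τ zero    a h r = cong 𝟙 (null-τ r)
      children-τ (suc d) a {S} {S′} h r = cong₂ ℕ._+_ (cong 𝟙 (null-τ r))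
        (trans (cong (next d (τ a) S′ (List.map τ r)) (first-τ a {S′ = S′} h)) (next-τ d a h r (first a S)))

      next-τ : ∀ d a {S S′} → (∀ s → S′ (τ s) ≡ S s) → ∀ r p → next d (τ a) S′ (List.map τ r) (Maybe.map τ p) ≡ next d a S r p
      next-τ d a h r nothing  = refl
      next-τ d a h r (just s) = ∑Splits-τ r λ l r′ →
        cong₂ ℕ._*_ (rooted-τ d s l) (children-τ d a (λ t → cong₂ _∨_ (h t) (occ-τ l t)) r′)

      rooted-τ : ∀ d s l → rooted d (τ s) (List.map τ l) ≡ rooted d s l
      rooted-τ d s []      = refl
      rooted-τ d s (b ∷ l) = cong₂ ℕ._*_ (children-τ d b (λ _ → refl) l) (cong 𝟙 (cong₂ _∧_ (ok-τ (b ∷ l)) (occ-τ (b ∷ l) s)))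

  ∑Word-rooted-translate : ∀ d k s s′ → ∑Word k (rooted d s′) ≡ ∑Word k (rooted d s)
  ∑Word-rooted-translate d k s s′ with translate s s′
  ... | π , refl , h = trans (sym (∑Word-shift k π _)) (∑Word-cong k λ l _ → Equivariance.rooted-τ π h d s l)

  ∑-rooted : ∀ d b l → ∑ (λ s → rooted d s (b ∷ l)) ℕ.≤ suc (length l) ℕ.* children d b ∅ l
  ∑-rooted d b l = begin
    ∑ (λ s → children d b ∅ l ℕ.* 𝟙 (ok (b ∷ l) ∧ occ (b ∷ l) s)) ≡⟨ ∑-* (children d b ∅ l) _ ⟩
    children d b ∅ l ℕ.* ∑ (λ s → 𝟙 (ok (b ∷ l) ∧ occ (b ∷ l) s)) ≤⟨ ℕP.*-monoʳ-≤ (children d b ∅ l) (∑-mono λ s → drop (ok (b ∷ l)) (occ (b ∷ l) s)) ⟩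
    children d b ∅ l ℕ.* card (occ (b ∷ l))                        ≤⟨ ℕP.*-monoʳ-≤ (children d b ∅ l) (card-occ-≤ (b ∷ l)) ⟩
    children d b ∅ l ℕ.* suc (length l)                            ≡⟨ ℕP.*-comm (children d b ∅ l) _ ⟩
    suc (length l) ℕ.* children d b ∅ l                            ∎
    where
    open ℕP.≤-Reasoning
    drop : ∀ x y → 𝟙 (x ∧ y) ℕ.≤ 𝟙 y
    drop true  y = ℕP.≤-refl
    drop false y = z≤n

  -- The coefficients of x D: the newest key of a component is one of its k keys and leaves k - 1
  -- for its children. There is no empty component.
  catalan′ : ℕ → ℕ
  catalan′ zero    = 0
  catalan′ (suc k) = catalan k

  mutual

    -- By translation invariance the count does not depend on s, and a component has k slots s.
    ∑Word-rooted : ∀ d s k → ∑Word k (rooted d s) ℕ.≤ k ! ℕ.* catalan′ k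
    ∑Word-rooted d s zero    = z≤n
    ∑Word-rooted d s (suc k) = ℕP.*-cancelˡ-≤ n {{nonZero s}} (begin
      n ℕ.* ∑Word (suc k) (rooted d s)                              ≡⟨ sym (∑-const n _) ⟩
      ∑ {n} (λ _ → ∑Word (suc k) (rooted d s))                      ≡⟨ ∑-cong (λ s′ → sym (∑Word-rooted-translate d (suc k) s s′)) ⟩
      ∑ (λ s′ → ∑Word (suc k) (rooted d s′))                        ≡⟨ sym (∑Word-∑ (suc k) λ l s′ → rooted d s′ l) ⟩
      ∑Word (suc k) (λ l → ∑ λ s′ → rooted d s′ l)                  ≤⟨ ∑-mono (λ b → ∑Word-mono k λ l e → subst (λ k → _ ℕ.≤ suc k ℕ.* children d b ∅ l) e (∑-rooted d b l)) ⟩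
      ∑ (λ b → ∑Word k λ l → suc k ℕ.* children d b ∅ l)            ≡⟨ ∑-cong (λ b → ∑Word-* k (suc k) (children d b ∅)) ⟩
      ∑ (λ b → suc k ℕ.* ∑Word k (children d b ∅))                  ≤⟨ ∑-mono (λ b → ℕP.*-monoʳ-≤ (suc k) (∑Word-children d b ∅ k)) ⟩
      ∑ {n} (λ _ → suc k ℕ.* (k ! ℕ.* catalan k))               ≡⟨ ∑-const n _ ⟩
      n ℕ.* (suc k ℕ.* (k ! ℕ.* catalan k))                     ≡⟨ cong (n ℕ.*_) (sym (ℕP.*-assoc (suc k) (k !) _)) ⟩
      n ℕ.* (suc k ! ℕ.* catalan′ (suc k))                      ∎)
      where
      open ℕP.≤-Reasoning
      nonZero : ∀ {n} → Fin n → NonZero n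
      nonZero Fin.zero    = _
      nonZero (Fin.suc _) = _

    -- The equation D = 1 + (x D) D: either no keys are used, or the first component hit has weight
    -- x D and the remaining ones have weight D. The factorials make these exponential generating
    -- functions, matching the binomial coefficient of an interleaving. Uniformity in S allows the
    -- later components to be summed first, for each fixed l.
    ∑Word-children : ∀ d a S k → ∑Word k (children d a S) ℕ.≤ k ! ℕ.* catalan k
    ∑Word-children zero    a S k       = ∑Word-null k
    ∑Word-children (suc d) a S k = ℕP.≤-trans (ℕP.≤-reflexive (∑Word-+ k (λ r → 𝟙 (null r)) λ r → next d a S r (first a S)))
      (∑Word-null-next k (first a S))
      where
      ∑Word-null-next : ∀ k p → ∑Word k (λ r → 𝟙 (null r)) ℕ.+ ∑Word k (λ r → next d a S r p) ℕ.≤ k ! ℕ.* catalan k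
      ∑Word-null-next k nothing = ℕP.≤-trans
        (ℕP.≤-reflexive (trans (cong (∑Word k (λ r → 𝟙 (null r)) ℕ.+_) (∑Word-zero k λ _ _ → refl)) (ℕP.+-identityʳ _))) (∑Word-null k)
      ∑Word-null-next zero    (just s) = ℕP.≤-refl
      ∑Word-null-next (suc k) (just s) = begin
        ∑Word (suc k) (λ r → 𝟙 (null r)) ℕ.+ ∑Word (suc k) (λ r → ∑Splits r g) ≡⟨ cong (ℕ._+ ∑Word (suc k) (λ r → ∑Splits r g)) (∑Word-zero (suc k) {λ r → 𝟙 (null r)} λ { (_ ∷ _) _ → refl }) ⟩
        ∑Word (suc k) (λ r → ∑Splits r g)                                  ≡⟨ ∑Word-∑Splits (suc k) g ⟩
        ∑Antidiagonal (suc k) (λ i j → choose i j ℕ.* ∑Word i λ l → ∑Word j (g l))     ≤⟨ ∑Antidiagonal-mono (suc k) (λ i j e → bound i j e) ⟩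
        ∑Antidiagonal (suc k) (λ i j → suc k ! ℕ.* (catalan′ i ℕ.* catalan j)) ≡⟨ ∑Antidiagonal-* (suc k) (suc k !) (λ i j → catalan′ i ℕ.* catalan j) ⟩
        -- The term i = 0 vanishes by computation since `catalan′ 0` is 0, and the rest shifts down
        -- to a convolution of index k.
        suc k ! ℕ.* ∑Antidiagonal k (λ i j → catalan i ℕ.* catalan j)          ≡⟨ cong (suc k ! ℕ.*_) (ballot-conv 1 1 k) ⟩
        suc k ! ℕ.* catalan (suc k)                                   ∎
        where
        open ℕP.≤-Reasoning
        g : Word → Word → ℕ
        g l r = rooted d s l ℕ.* children d a (S ∪ occ l) r
        bound : ∀ i j → i ℕ.+ j ≡ suc k → choose i j ℕ.* (∑Word i λ l → ∑Word j (g l)) ℕ.≤ suc k ! ℕ.* (catalan′ i ℕ.* catalan j)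
        bound i j e = begin
          choose i j ℕ.* (∑Word i λ l → ∑Word j (g l))
            ≡⟨ cong (choose i j ℕ.*_) (∑Word-cong i λ l _ → ∑Word-* j (rooted d s l) _) ⟩
          choose i j ℕ.* (∑Word i λ l → rooted d s l ℕ.* ∑Word j (children d a (S ∪ occ l)))
            ≤⟨ ℕP.*-monoʳ-≤ (choose i j) (∑Word-mono i λ l _ → ℕP.≤-trans (ℕP.*-monoʳ-≤ (rooted d s l) (∑Word-children d a (S ∪ occ l) j))
                                                               (ℕP.≤-reflexive (ℕP.*-comm (rooted d s l) _))) ⟩
          choose i j ℕ.* (∑Word i λ l → (j ! ℕ.* catalan j) ℕ.* rooted d s l)
            ≡⟨ cong (choose i j ℕ.*_) (∑Word-* i (j ! ℕ.* catalan j) (rooted d s)) ⟩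
          choose i j ℕ.* ((j ! ℕ.* catalan j) ℕ.* ∑Word i (rooted d s))
            ≤⟨ ℕP.*-monoʳ-≤ (choose i j) (ℕP.*-monoʳ-≤ (j ! ℕ.* catalan j) (∑Word-rooted d s i)) ⟩
          choose i j ℕ.* ((j ! ℕ.* catalan j) ℕ.* (i ! ℕ.* catalan′ i))
            ≡⟨ regroup (choose i j) (i !) (j !) (catalan′ i) (catalan j) ⟩
          choose i j ℕ.* (i ! ℕ.* j !) ℕ.* (catalan′ i ℕ.* catalan j)
            ≡⟨ cong (ℕ._* (catalan′ i ℕ.* catalan j)) (trans (choose-! i j) (cong _! e)) ⟩
          suc k ! ℕ.* (catalan′ i ℕ.* catalan j) ∎
          where
          regroup : ∀ c x y u v → c ℕ.* ((y ℕ.* v) ℕ.* (x ℕ.* u)) ≡ c ℕ.* (x ℕ.* y) ℕ.* (u ℕ.* v)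
          regroup = solve-∀

    ∑Word-null : ∀ k → ∑Word k (λ (r : Word) → 𝟙 (null r)) ℕ.≤ k ! ℕ.* catalan k
    ∑Word-null zero    = ℕP.≤-refl
    ∑Word-null (suc k) = ℕP.≤-trans (ℕP.≤-reflexive (∑Word-zero (suc k) {λ r → 𝟙 (null r)} λ { (_ ∷ _) _ → refl })) z≤n

  -- A union bound over the splittings supplied by `newest-component`. It serves twice: with ψ =
  -- `suc` for the cost, and with ψ an indicator of large values for the failures; monotonicity lets
  -- ψ pass from the occupied probes to the size of l.
  ∑Word-busy : (∀ a → Unique (probes a)) → ∀ t (ψ : ℕ → ℕ) → (∀ {i j} → i ℕ.≤ j → ψ i ℕ.≤ ψ j) →
           ∑ (λ a → ∑Word t λ ω → 𝟙 (ok ω) ℕ.* ψ (busy (probes a) (occ ω))) ℕ.≤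
           n ℕ.* ∑Antidiagonal t (λ i j → choose i j ℕ.* i ! ℕ.* (ψ i ℕ.* catalan i ℕ.* (n ∸ i) ℕ.^ j))
  ∑Word-busy unique t ψ ψ-mono = begin
    ∑ (λ a → ∑Word t λ ω → 𝟙 (ok ω) ℕ.* ψ (busy (probes a) (occ ω)))
      ≤⟨ ∑-mono (λ a → ∑Word-mono t λ ω e → subst (λ t → _ ℕ.≤ ∑Splits ω (g t a)) e (pointwise a ω)) ⟩
    ∑ (λ a → ∑Word t λ ω → ∑Splits ω (g t a))
      ≤⟨ ∑-mono (λ a → ℕP.≤-trans (ℕP.≤-reflexive (∑Word-∑Splits t (g t a))) (∑Antidiagonal-mono t λ i j _ → bound a i j)) ⟩
    ∑ {n} (λ _ → ∑Antidiagonal t (λ i j → choose i j ℕ.* i ! ℕ.* (ψ i ℕ.* catalan i ℕ.* (n ∸ i) ℕ.^ j)))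
      ≡⟨ ∑-const n _ ⟩
    n ℕ.* ∑Antidiagonal t (λ i j → choose i j ℕ.* i ! ℕ.* (ψ i ℕ.* catalan i ℕ.* (n ∸ i) ℕ.^ j)) ∎
    where
    open ℕP.≤-Reasoning
    g : ℕ → Fin n → Word → Word → ℕ
    g t a l r = ψ (length l) ℕ.* (children t a ∅ l ℕ.* (𝟙 (ok l) ℕ.* 𝟙 (avoids l r)))
    pointwise : ∀ a ω → 𝟙 (ok ω) ℕ.* ψ (busy (probes a) (occ ω)) ℕ.≤ ∑Splits ω (g (length ω) a)
    pointwise a ω with ok ω in e
    ... | false = z≤n
    ... | true with newest-component unique ω a e
    ...   | l , r , i , w , b = ℕP.≤-trans
      (ℕP.≤-trans (ℕP.≤-reflexive (ℕP.+-identityʳ _)) (ℕP.≤-trans (ψ-mono b)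
        (ℕP.≤-trans (ℕP.≤-reflexive (sym (ℕP.*-identityʳ _))) (ℕP.*-monoʳ-≤ (ψ (length l)) w))))
      (∑Splits-≥ i (g (length ω) a))
    bound : ∀ a i j → choose i j ℕ.* (∑Word i λ l → ∑Word j (g t a l)) ℕ.≤ choose i j ℕ.* i ! ℕ.* (ψ i ℕ.* catalan i ℕ.* (n ∸ i) ℕ.^ j)
    bound a i j = begin
      choose i j ℕ.* (∑Word i λ l → ∑Word j (g t a l))
        ≤⟨ ℕP.*-monoʳ-≤ (choose i j) (∑Word-mono i λ l e → inner l e) ⟩
      choose i j ℕ.* (∑Word i λ l → (ψ i ℕ.* (n ∸ i) ℕ.^ j) ℕ.* children t a ∅ l)
        ≡⟨ cong (choose i j ℕ.*_) (∑Word-* i (ψ i ℕ.* (n ∸ i) ℕ.^ j) (children t a ∅)) ⟩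
      choose i j ℕ.* ((ψ i ℕ.* (n ∸ i) ℕ.^ j) ℕ.* ∑Word i (children t a ∅))
        ≤⟨ ℕP.*-monoʳ-≤ (choose i j) (ℕP.*-monoʳ-≤ (ψ i ℕ.* (n ∸ i) ℕ.^ j) (∑Word-children t a ∅ i)) ⟩
      choose i j ℕ.* ((ψ i ℕ.* (n ∸ i) ℕ.^ j) ℕ.* (i ! ℕ.* catalan i))
        ≡⟨ regroup (choose i j) (ψ i) ((n ∸ i) ℕ.^ j) (i !) (catalan i) ⟩
      choose i j ℕ.* i ! ℕ.* (ψ i ℕ.* catalan i ℕ.* (n ∸ i) ℕ.^ j) ∎
      where
      regroup : ∀ c p q f u → c ℕ.* ((p ℕ.* q) ℕ.* (f ℕ.* u)) ≡ c ℕ.* f ℕ.* (p ℕ.* u ℕ.* q)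
      regroup = solve-∀
      inner : ∀ l → length l ≡ i → ∑Word j (g t a l) ℕ.≤ (ψ i ℕ.* (n ∸ i) ℕ.^ j) ℕ.* children t a ∅ l
      -- Only if all insertions of l succeed does l fill exactly i slots, which leaves n ∸ i hash
      -- values for each letter of r. This is why the weight carries the factor `ok l`.
      inner l e with ok l in hl
      ... | false = ℕP.≤-trans (ℕP.≤-reflexive (∑Word-zero j λ r _ → trans (cong (ψ (length l) ℕ.*_) (ℕP.*-zeroʳ (children t a ∅ l))) (ℕP.*-zeroʳ (ψ (length l))))) z≤n
      ... | true  = ℕP.≤-reflexive (begin-equality
        ∑Word j (λ r → ψ (length l) ℕ.* (children t a ∅ l ℕ.* (1 ℕ.* 𝟙 (avoids l r))))
          ≡⟨ ∑Word-cong j (λ r _ → regroup′ (ψ (length l)) (children t a ∅ l) (𝟙 (avoids l r))) ⟩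
        ∑Word j (λ r → (ψ (length l) ℕ.* children t a ∅ l) ℕ.* 𝟙 (avoids l r))
          ≡⟨ ∑Word-* j (ψ (length l) ℕ.* children t a ∅ l) (λ r → 𝟙 (avoids l r)) ⟩
        (ψ (length l) ℕ.* children t a ∅ l) ℕ.* ∑Word j (λ r → 𝟙 (avoids l r))
          ≡⟨ cong ((ψ (length l) ℕ.* children t a ∅ l) ℕ.*_) (trans (∑Word-all j (not ∘ occ l))
               (cong (ℕ._^ j) (trans (card-not (occ l)) (cong (n ∸_) (card-occ l hl))))) ⟩
        (ψ (length l) ℕ.* children t a ∅ l) ℕ.* (n ∸ length l) ℕ.^ j
          ≡⟨ cong (λ i → (ψ i ℕ.* children t a ∅ l) ℕ.* (n ∸ i) ℕ.^ j) e ⟩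
        (ψ i ℕ.* children t a ∅ l) ℕ.* (n ∸ i) ℕ.^ j
          ≡⟨ regroup″ (ψ i) (children t a ∅ l) ((n ∸ i) ℕ.^ j) ⟩
        (ψ i ℕ.* (n ∸ i) ℕ.^ j) ℕ.* children t a ∅ l ∎)
        where
        regroup′ : ∀ p c v → p ℕ.* (c ℕ.* (1 ℕ.* v)) ≡ (p ℕ.* c) ℕ.* v
        regroup′ = solve-∀
        regroup″ : ∀ p c q → (p ℕ.* c) ℕ.* q ≡ (p ℕ.* q) ℕ.* c
        regroup″ = solve-∀

-- Quadratic probing

opaque
  unfolding ∑

  sum-cartesian : ∀ {A : Set} {n k} (g : Fin n → A) (f : Vec A (suc k) → ℕ) ys →
                  sum (List.map f (cartesianProductWith _∷_ (tabulate g) ys)) ≡ ∑ λ i → sum (List.map (λ y → f (g i ∷ y)) ys)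
  sum-cartesian {n = zero}  g f ys = refl
  sum-cartesian {A} {suc n} {k} g f ys = begin
    sum (List.map f (List.map (g Fin.zero ∷_) ys ++ rest))
      ≡⟨ cong sum (ListP.map-++ f (List.map (g Fin.zero ∷_) ys) rest) ⟩
    sum (List.map f (List.map (g Fin.zero ∷_) ys) ++ List.map f rest)
      ≡⟨ sum-++ (List.map f (List.map (g Fin.zero ∷_) ys)) (List.map f rest) ⟩
    sum (List.map f (List.map (g Fin.zero ∷_) ys)) ℕ.+ sum (List.map f rest)
      ≡⟨ cong₂ ℕ._+_ (cong sum (sym (ListP.map-∘ ys))) (sum-cartesian (g ∘ Fin.suc) f ys) ⟩
    sum (List.map (λ y → f (g Fin.zero ∷ y)) ys) ℕ.+ ∑ (λ i → sum (List.map (λ y → f (g (Fin.suc i) ∷ y)) ys)) ∎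
    where
    open ≡-Reasoning
    rest : List (Vec A (suc k))
    rest = cartesianProductWith _∷_ (tabulate (g ∘ Fin.suc)) ys

sum-outcomes : ∀ n k (f : List (Fin n) → ℕ) → sum (List.map (f ∘ toList) (outcomes n k)) ≡ ∑Word k f
sum-outcomes n zero    f = ℕP.+-identityʳ _
sum-outcomes n (suc k) f = trans (sum-cartesian (λ a → a) (f ∘ toList) (outcomes n k))
  (∑-cong λ a → sum-outcomes n k (f ∘ (a ∷_)))

∑Word-reverse : ∀ {n} k (f : List (Fin n) → ℕ) → ∑Word k (f ∘ reverse) ≡ ∑Word k f
∑Word-reverse zero    f = refl
∑Word-reverse (suc k) f = begin
  ∑ (λ a → ∑Word k λ l → f (reverse (a ∷ l)))    ≡⟨ ∑-cong (λ a → ∑Word-cong k λ l _ → cong f (ListP.unfold-reverse a l)) ⟩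
  ∑ (λ a → ∑Word k λ l → f (reverse l ∷ʳ a))     ≡⟨ ∑-cong (λ a → ∑Word-reverse k λ l → f (l ∷ʳ a)) ⟩
  ∑ (λ a → ∑Word k λ l → f (l ∷ʳ a))             ≡⟨ sym (∑Word-∷ʳ k f) ⟩
  ∑Word (suc k) f                                ∎
  where open ≡-Reasoning

-- Outcomes list the oldest key first, words the newest; the uniform measure is invariant under
-- reversal.
sum-newestFirst : ∀ n k (f : List (Fin n) → ℕ) → sum (List.map (f ∘ reverse ∘ toList) (outcomes n k)) ≡ ∑Word k f
sum-newestFirst n k f = trans (sum-outcomes n k (f ∘ reverse)) (∑Word-reverse k f)

length-filterᵇ : ∀ {A : Set} (p : A → Bool) xs → length (filterᵇ p xs) ≡ sum (List.map (𝟙 ∘ p) xs)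
length-filterᵇ p []       = refl
length-filterᵇ p (x ∷ xs) with p x
... | true  = cong suc (length-filterᵇ p xs)
... | false = length-filterᵇ p xs

sum-filterᵇ-≤ : ∀ {A : Set} (p : A → Bool) (f g : A → ℕ) → (∀ x → p x ≡ true → f x ℕ.≤ g x) → ∀ xs →
                sum (List.map f (filterᵇ p xs)) ℕ.≤ sum (List.map (λ x → 𝟙 (p x) ℕ.* g x) xs)
sum-filterᵇ-≤ p f g h []       = z≤n
sum-filterᵇ-≤ p f g h (x ∷ xs) with p x in e
... | true  = ℕP.+-mono-≤ (ℕP.≤-trans (h x e) (ℕP.m≤m+n (g x) 0)) (sum-filterᵇ-≤ p f g h xs)
... | false = sum-filterᵇ-≤ p f g h xs

module Rotation {n : ℕ} .{{_ : NonZero n}} where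

  rotate : ℕ → Fin n → Fin n
  rotate c a = (toℕ a ℕ.+ c) mod n

  toℕ-rotate : ∀ c a → toℕ (rotate c a) ≡ (toℕ a ℕ.+ c) % n
  toℕ-rotate c a = toℕ-fromℕ< _

  rotate-rotate : ∀ c d a → rotate c (rotate d a) ≡ rotate (d ℕ.+ c) a
  rotate-rotate c d a = toℕ-injective (begin
    toℕ (rotate c (rotate d a))               ≡⟨ toℕ-rotate c (rotate d a) ⟩
    (toℕ (rotate d a) ℕ.+ c) % n              ≡⟨ cong (λ x → (x ℕ.+ c) % n) (toℕ-rotate d a) ⟩
    ((toℕ a ℕ.+ d) % n ℕ.+ c) % n             ≡⟨ %-distribˡ-+ ((toℕ a ℕ.+ d) % n) c n ⟩
    ((toℕ a ℕ.+ d) % n % n ℕ.+ c % n) % n     ≡⟨ cong (λ x → (x ℕ.+ c % n) % n) (m%n%n≡m%n (toℕ a ℕ.+ d) n) ⟩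
    ((toℕ a ℕ.+ d) % n ℕ.+ c % n) % n         ≡⟨ sym (%-distribˡ-+ (toℕ a ℕ.+ d) c n) ⟩
    (toℕ a ℕ.+ d ℕ.+ c) % n                   ≡⟨ cong (_% n) (ℕP.+-assoc (toℕ a) d c) ⟩
    (toℕ a ℕ.+ (d ℕ.+ c)) % n                 ≡⟨ sym (toℕ-rotate (d ℕ.+ c) a) ⟩
    toℕ (rotate (d ℕ.+ c) a)                  ∎)
    where open ≡-Reasoning

  rotate-comm : ∀ c d a → rotate c (rotate d a) ≡ rotate d (rotate c a)
  rotate-comm c d a = trans (rotate-rotate c d a) (trans (cong (λ x → rotate x a) (ℕP.+-comm d c)) (sym (rotate-rotate d c a)))

  rotate-full : ∀ k a → rotate (k ℕ.* n) a ≡ a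
  rotate-full k a = toℕ-injective (trans (toℕ-rotate (k ℕ.* n) a) (trans ([m+kn]%n≡m%n (toℕ a) k n) (m<n⇒m%n≡m (toℕ<n a))))

  rotate-zero : ∀ a → rotate 0 a ≡ a
  rotate-zero = rotate-full 0

  c+[n-1]c : ∀ c → c ℕ.+ c ℕ.* ℕ.pred n ≡ c ℕ.* n
  c+[n-1]c c = trans (sym (ℕP.*-suc c (ℕ.pred n))) (cong (c ℕ.*_) (ℕP.suc-pred n))

  -- The inverse rotation is by c (n - 1), since c + c (n - 1) is a multiple of n for every c,
  -- including c larger than n.
  rotation : ℕ → Permutation′ n
  rotation c = permutation (rotate c) (rotate (c ℕ.* ℕ.pred n))
    (λ a → trans (rotate-rotate c _ a) (trans (cong (λ x → rotate x a) (trans (ℕP.+-comm (c ℕ.* ℕ.pred n) c) (c+[n-1]c c))) (rotate-full c a)))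
    (λ a → trans (rotate-rotate _ c a) (trans (cong (λ x → rotate x a) (c+[n-1]c c)) (rotate-full c a)))

  rotate-onto : ∀ s s′ → rotate (toℕ s′ ℕ.+ (n ∸ toℕ s)) s ≡ s′
  rotate-onto s s′ = toℕ-injective (begin
    toℕ (rotate (toℕ s′ ℕ.+ (n ∸ toℕ s)) s)             ≡⟨ toℕ-rotate _ s ⟩
    (toℕ s ℕ.+ (toℕ s′ ℕ.+ (n ∸ toℕ s))) % n            ≡⟨ cong (_% n) (move (toℕ s) (toℕ s′) (n ∸ toℕ s)) ⟩
    (toℕ s′ ℕ.+ (toℕ s ℕ.+ (n ∸ toℕ s))) % n            ≡⟨ cong (λ x → (toℕ s′ ℕ.+ x) % n) (ℕP.m+[n∸m]≡n (toℕ≤n s)) ⟩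
    (toℕ s′ ℕ.+ n) % n                                  ≡⟨ [m+n]%n≡m%n (toℕ s′) n ⟩
    toℕ s′ % n                                          ≡⟨ m<n⇒m%n≡m (toℕ<n s′) ⟩
    toℕ s′                                              ∎)
    where
    open ≡-Reasoning
    move : ∀ a b c → a ℕ.+ (b ℕ.+ c) ≡ b ℕ.+ (a ℕ.+ c)
    move = solve-∀

  rotate-injective : ∀ {x y} a → x ℕ.< n → y ℕ.< n → rotate x a ≡ rotate y a → x ≡ y
  rotate-injective {x} {y} a hx hy e = trans (sym (back hx)) (trans (cong (λ b → toℕ (rotate (n ∸ toℕ a) b)) e) (back hy))
    where
    open ≡-Reasoning
    move : ∀ a x c → a ℕ.+ (x ℕ.+ c) ≡ x ℕ.+ (a ℕ.+ c)
    move = solve-∀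
    back : ∀ {x} → x ℕ.< n → toℕ (rotate (n ∸ toℕ a) (rotate x a)) ≡ x
    back {x} hx = begin
      toℕ (rotate (n ∸ toℕ a) (rotate x a))    ≡⟨ cong toℕ (rotate-rotate (n ∸ toℕ a) x a) ⟩
      toℕ (rotate (x ℕ.+ (n ∸ toℕ a)) a)       ≡⟨ toℕ-rotate _ a ⟩
      (toℕ a ℕ.+ (x ℕ.+ (n ∸ toℕ a))) % n      ≡⟨ cong (_% n) (move (toℕ a) x _) ⟩
      (x ℕ.+ (toℕ a ℕ.+ (n ∸ toℕ a))) % n      ≡⟨ cong (λ y → (x ℕ.+ y) % n) (ℕP.m+[n∸m]≡n (toℕ≤n a)) ⟩
      (x ℕ.+ n) % n                            ≡⟨ [m+n]%n≡m%n x n ⟩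
      x % n                                    ≡⟨ m<n⇒m%n≡m hx ⟩
      x                                        ∎

  squares : ℕ → ℕ → Fin n → List (Fin n)
  squares zero    i a = []
  squares (suc k) i a = rotate (i ℕ.* i) a ∷ squares k (suc i) a

  squares-rotate : ∀ k i c a → squares k i (rotate c a) ≡ List.map (rotate c) (squares k i a)
  squares-rotate zero    i c a = refl
  squares-rotate (suc k) i c a = cong₂ _∷_ (rotate-comm (i ℕ.* i) c a) (squares-rotate k (suc i) c a)

  length-squares : ∀ k i a → length (squares k i a) ≡ k
  length-squares zero    i a = refl
  length-squares (suc k) i a = cong suc (length-squares k (suc i) a)

  squares-≢ : ∀ k i j a → j ℕ.< i → (∀ l → l ℕ.< i ℕ.+ k → l ℕ.* l ℕ.< n) → All (rotate (j ℕ.* j) a ≢_) (squares k i a)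
  squares-≢ zero    i j a j<i h = []
  squares-≢ (suc k) i j a j<i h =
    (λ e → ℕP.<-irrefl (rotate-injective a (h j (ℕP.<-trans j<i i<)) (h i i<) e) (ℕP.*-mono-< j<i j<i)) ∷
    squares-≢ k (suc i) j a (ℕP.m<n⇒m<1+n j<i) (λ l l< → h l (subst (l ℕ.<_) (sym (ℕP.+-suc i k)) l<))
    where
    i< : i ℕ.< i ℕ.+ suc k
    i< = ℕP.m<m+n i (s≤s z≤n)

  squares-unique : ∀ k i a → (∀ l → l ℕ.< i ℕ.+ k → l ℕ.* l ℕ.< n) → Unique (squares k i a)
  squares-unique zero    i a h = []
  squares-unique (suc k) i a h = squares-≢ k (suc i) i a (ℕP.n<1+n i) h′ ∷ squares-unique k (suc i) a h′
    where
    h′ : ∀ l → l ℕ.< suc i ℕ.+ k → l ℕ.* l ℕ.< n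
    h′ l l< = h l (subst (l ℕ.<_) (sym (ℕP.+-suc i k)) l<)

-- Quadratic probing cut off after suc κ probes, which are distinct because κ² < n.
module Quadratic {n : ℕ} .{{_ : NonZero n}} (κ : ℕ) (κ²<n : κ ℕ.* κ ℕ.< n) where

  open Rotation {n}

  later : Fin n → List (Fin n)
  later = squares κ 1

  open Scheme later

  probes-squares : ∀ a → squares (suc κ) 0 a ≡ probes a
  probes-squares a = cong (_∷ later a) (rotate-zero a)

  probes-unique : ∀ a → Unique (probes a)
  probes-unique a = subst Unique (probes-squares a) (squares-unique (suc κ) 0 a
    λ l l< → ℕP.≤-<-trans (ℕP.*-mono-≤ (ℕP.≤-pred l<) (ℕP.≤-pred l<)) κ²<n)

  length-probes : ∀ a → length (probes a) ≡ suc κ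
  length-probes a = cong suc (length-squares κ 1 a)

  translate : ∀ s s′ → ∃ λ (π : Permutation′ n) → π ⟨$⟩ʳ s ≡ s′ × (∀ a → later (π ⟨$⟩ʳ a) ≡ List.map (π ⟨$⟩ʳ_) (later a))
  translate s s′ = rotation c , rotate-onto s s′ , squares-rotate κ 1 c
    where c = toℕ s′ ℕ.+ (n ∸ toℕ s)

  κ<n : κ ℕ.< n
  κ<n = ℕP.≤-<-trans (κ≤κ² κ) κ²<n
    where
    κ≤κ² : ∀ κ → κ ℕ.≤ κ ℕ.* κ
    κ≤κ² zero    = z≤n
    κ≤κ² (suc k) = ℕP.m≤m*n (suc k) (suc k)

  module _ {K : Set} (h : K → Fin n) where

    open Probing h

    Represents : Word → Table → Set
    Represents w t = ∀ s → is-just (lookup t s) ≡ occ w s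

    -- One-sided by design: when the cut-off search finds a slot, the full search stops at the same
    -- one. Nothing is claimed when the cut-off search fails.
    search-firstFree : ∀ {w t} → Represents w t → ∀ x k i fuel {p} → k ℕ.≤ fuel →
                       firstFree (squares k i (h x)) (occ w) ≡ just p →
                       search t x fuel i ≡ just (i ℕ.+ busy (squares k i (h x)) (occ w)) ×
                       slot x (i ℕ.+ busy (squares k i (h x)) (occ w)) ≡ p
    search-firstFree {w} {t} r x (suc k) i (suc fuel) (s≤s k≤) eq with lookup t (slot x i) | r (slot x i)
    ... | just _  | e rewrite sym e with search-firstFree {w} {t} r x k (suc i) fuel k≤ eq
    ...   | e₁ , e₂ = trans e₁ (cong just (sym (ℕP.+-suc i _))) , trans (cong (slot x) (ℕP.+-suc i _)) e₂
    search-firstFree {w} {t} r x (suc k) i (suc fuel) (s≤s k≤) eq | nothing | e rewrite sym e with eq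
    ... | refl = cong just (sym (ℕP.+-identityʳ i)) , cong (slot x) (ℕP.+-identityʳ i)

    insert-represents : ∀ {w t} → Represents w t → ∀ x → is-just (first (h x) (occ w)) ≡ true →
                        ∃ λ t′ → insert x t ≡ just (t′ , suc (busy (probes (h x)) (occ w))) × Represents (h x ∷ w) t′
    insert-represents {w} {t} r x ok′ with first (h x) (occ w) in eq
    ... | just p with search-firstFree {w} {t} r x (suc κ) 0 n κ<n (trans (cong (λ qs → firstFree qs (occ w)) (probes-squares (h x))) eq)
    ...   | e₁ , e₂ = t [ slot x j ]≔ just x
                    , trans (cong (Maybe.map λ i → t [ slot x i ]≔ just x , suc i) e₁)
                            (cong (λ qs → just (t [ slot x j ]≔ just x , suc (busy qs (occ w)))) (probes-squares (h x)))
                    , update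
      where
      j = busy (squares (suc κ) 0 (h x)) (occ w)
      update : ∀ s → is-just (lookup (t [ slot x j ]≔ just x) s) ≡ add (just p) (occ w) s
      update s rewrite e₂ with s ≟ p
      ... | yes refl = cong is-just (VecP.lookup∘update p t (just x))
      ... | no s≢p   = trans (cong is-just (VecP.lookup∘update′ s≢p t (just x))) (r s)

    empty-represents : Represents [] empty
    empty-represents s = cong is-just (VecP.lookup-replicate s nothing)

    ok-ʳ++ : ∀ (xs : Word) {w} → ok (xs List.ʳ++ w) ≡ true → ok w ≡ true
    ok-ʳ++ []       e = e
    ok-ʳ++ (a ∷ xs) {w} e with first a (occ w) | ok-ʳ++ xs {a ∷ w} e
    ... | just _ | e′ = e′

    insertAll-represents : ∀ xs {w t} → Represents w t → ok (List.map h xs List.ʳ++ w) ≡ true →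
                           ∃ λ t′ → insertAll xs t ≡ just t′ × Represents (List.map h xs List.ʳ++ w) t′
    insertAll-represents []       {w} {t} r e = t , refl , r
    insertAll-represents (x ∷ xs) {w} {t} r e with insert-represents {w} {t} r x (∧-trueˡ (ok-ʳ++ (List.map h xs) e))
      where
      ∧-trueˡ : ∀ {b c} → b ∧ c ≡ true → b ≡ true
      ∧-trueˡ {true} _ = refl
    ... | t′ , e₁ , r′ rewrite e₁ = insertAll-represents xs {h x ∷ w} {t′} r′ e

  module _ {m : ℕ} where

    newestFirst : Vec (Fin n) (suc m) → Word
    newestFirst ω = reverse (toList ω)

    -- The event E of the theorem: every insertion succeeds within the first `suc κ` probes, which
    -- is stronger than success of quadratic probing.
    good : Event n (suc m)
    good ω = ok (newestFirst ω)

    newestCost : Word → ℕ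
    newestCost []      = 0
    newestCost (a ∷ w) = suc (busy (probes a) (occ w))

    newestFirst-∷ : ∀ (ω : Vec (Fin n) (suc m)) →
                    newestFirst ω ≡ lookup ω (Fin.fromℕ m) ∷ reverse (List.map (lookup ω) (List.map inject₁ (allFin m)))
    newestFirst-∷ ω = begin
      reverse (toList ω)
        ≡⟨ cong reverse (sym (hashes ω)) ⟩
      reverse (tabulate (lookup ω ∘ inject₁) ∷ʳ lookup ω (Fin.fromℕ m))
        ≡⟨ ListP.reverse-++ (tabulate (lookup ω ∘ inject₁)) _ ⟩
      lookup ω (Fin.fromℕ m) ∷ reverse (tabulate (lookup ω ∘ inject₁))
        ≡⟨ cong (λ l → lookup ω (Fin.fromℕ m) ∷ reverse l)
             (sym (trans (cong (List.map (lookup ω)) (ListP.map-tabulate (λ i → i) inject₁)) (ListP.map-tabulate inject₁ (lookup ω)))) ⟩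
      lookup ω (Fin.fromℕ m) ∷ reverse (List.map (lookup ω) (List.map inject₁ (allFin m))) ∎
      where
      open ≡-Reasoning
      hashes : ∀ {m} (ω : Vec (Fin n) (suc m)) → tabulate (lookup ω ∘ inject₁) ∷ʳ lookup ω (Fin.fromℕ m) ≡ toList ω
      hashes {zero}  (a ∷ []) = refl
      hashes {suc m} (a ∷ ω)  = cong (a ∷_) (hashes ω)

    run-good : ∀ ω → good ω ≡ true → ∃ λ t → run ω ≡ just (t , newestCost (newestFirst ω))
    run-good ω e with newestFirst ω | newestFirst-∷ ω
    ... | _ | refl with insertAll-represents (lookup ω) (List.map inject₁ (allFin m)) (empty-represents (lookup ω)) (ok-tail e)
      where
      ok-tail : ∀ {b c} → b ∧ c ≡ true → c ≡ true
      ok-tail {true} h = h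
    ...   | t , e₁ , r with insert-represents (lookup ω) {reverse (List.map (lookup ω) (List.map inject₁ (allFin m)))} {t} r (Fin.fromℕ m) (ok-head e)
      where
      ok-head : ∀ {b c} → b ∧ c ≡ true → b ≡ true
      ok-head {true} h = refl
    ...     | t′ , e₂ , _ = t′ , trans (cong (_>>= Probing.insert (lookup ω) (Fin.fromℕ m)) e₁) e₂

    good-succeeds : ∀ ω → ω ∈ᴱ good → AllSucceed ω
    good-succeeds ω h with run-good ω (Equivalence.to T-≡ h)
    ... | t , e = _ , e

    size-good : size good ≡ ∑Word (suc m) (𝟙 ∘ ok)
    size-good = trans (length-filterᵇ good (outcomes n (suc m))) (sum-newestFirst n (suc m) (𝟙 ∘ ok))

    sum-cost-≤ : sum (List.map lastCost (filterᵇ good (outcomes n (suc m)))) ℕ.≤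
                 ∑ (λ a → ∑Word m λ w → 𝟙 (ok w) ℕ.* suc (busy (probes a) (occ w)))
    sum-cost-≤ = ℕP.≤-trans
      (sum-filterᵇ-≤ good lastCost (newestCost ∘ newestFirst) cost (outcomes n (suc m)))
      (ℕP.≤-trans (ℕP.≤-reflexive (sum-newestFirst n (suc m) λ w → 𝟙 (ok w) ℕ.* newestCost w))
        -- Success of the newest insertion is dropped from the indicator; what remains is a
        -- condition on the first m keys, the shape that `∑Word-busy` bounds.
        (∑-mono λ a → ∑Word-mono m λ w _ → ℕP.*-monoˡ-≤ _ (drop (is-just (first a (occ w))) (ok w))))
      where
      cost : ∀ ω → good ω ≡ true → lastCost ω ℕ.≤ newestCost (newestFirst ω)
      cost ω e with run-good ω e
      ... | t , e′ rewrite e′ = ℕP.≤-refl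
      drop : ∀ b c → 𝟙 (b ∧ c) ℕ.≤ 𝟙 c
      drop true  c = ℕP.≤-refl
      drop false c = z≤n

  open Count later translate

  -- By ∑Word-busy, n^(t + 1) times a bound for the expectation of ψ at the number of occupied slots probed by key t + 1.
  mass : (ℕ → ℕ) → ℕ → ℕ
  mass ψ t = n ℕ.* ∑Antidiagonal t (λ i j → choose i j ℕ.* i ! ℕ.* (ψ i ℕ.* catalan i ℕ.* (n ∸ i) ℕ.^ j))

  total-cost-≤ : ∀ {m} → sum (List.map lastCost (filterᵇ (good {m}) (outcomes n (suc m)))) ℕ.≤ mass suc m
  total-cost-≤ {m} = ℕP.≤-trans sum-cost-≤ (∑Word-busy probes-unique m suc s≤s)

  isLarge : ℕ → ℕ
  isLarge i = 𝟙 (κ ℕ.<ᵇ i)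

  -- A bound for the number of words of length t that are not `ok`: either the newest insertion is
  -- the first to fail, or an earlier one failed and the newest hash value is arbitrary.
  failures : ℕ → ℕ
  failures zero    = 0
  failures (suc t) = mass isLarge t ℕ.+ n ℕ.* failures t

  ∑Word-ok-≥ : ∀ t → n ℕ.^ t ℕ.≤ ∑Word t (𝟙 ∘ ok) ℕ.+ failures t
  ∑Word-ok-≥ zero    = ℕP.≤-refl
  ∑Word-ok-≥ (suc t) = begin
    n ℕ.* n ℕ.^ t                                                            ≤⟨ ℕP.*-monoʳ-≤ n (∑Word-ok-≥ t) ⟩
    n ℕ.* (∑Word t (𝟙 ∘ ok) ℕ.+ failures t)                                      ≡⟨ ℕP.*-distribˡ-+ n (∑Word t (𝟙 ∘ ok)) _ ⟩
    n ℕ.* ∑Word t (𝟙 ∘ ok) ℕ.+ n ℕ.* failures t                                  ≡⟨ cong (ℕ._+ n ℕ.* failures t) (sym (∑-const n _)) ⟩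
    ∑ {n} (λ _ → ∑Word t (𝟙 ∘ ok)) ℕ.+ n ℕ.* failures t
      ≤⟨ ℕP.+-monoˡ-≤ _ (∑-mono λ a → ∑Word-mono t λ w _ → case a w) ⟩
    ∑ (λ a → ∑Word t λ w → 𝟙 (ok (a ∷ w)) ℕ.+ 𝟙 (ok w) ℕ.* isLarge (busy (probes a) (occ w))) ℕ.+ n ℕ.* failures t
      ≡⟨ cong (ℕ._+ n ℕ.* failures t) (trans (∑-cong λ a → ∑Word-+ t _ _) (∑-+ _ _)) ⟩
    (∑Word (suc t) (𝟙 ∘ ok) ℕ.+ ∑ (λ a → ∑Word t λ w → 𝟙 (ok w) ℕ.* isLarge (busy (probes a) (occ w)))) ℕ.+ n ℕ.* failures t
      ≤⟨ ℕP.+-monoˡ-≤ _ (ℕP.+-monoʳ-≤ (∑Word (suc t) (𝟙 ∘ ok)) (∑Word-busy probes-unique t isLarge isLarge-mono)) ⟩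
    (∑Word (suc t) (𝟙 ∘ ok) ℕ.+ mass isLarge t) ℕ.+ n ℕ.* failures t              ≡⟨ ℕP.+-assoc (∑Word (suc t) (𝟙 ∘ ok)) _ _ ⟩
    ∑Word (suc t) (𝟙 ∘ ok) ℕ.+ failures (suc t)                                  ∎
    where
    open ℕP.≤-Reasoning
    isLarge-true : ∀ {i} → κ ℕ.< i → 1 ℕ.≤ isLarge i
    isLarge-true {i} h with κ ℕ.<ᵇ i | ℕP.<⇒<ᵇ h
    ... | true | _ = ℕP.≤-refl
    isLarge-mono : ∀ {i j} → i ℕ.≤ j → isLarge i ℕ.≤ isLarge j
    isLarge-mono {i} {j} i≤j with κ ℕ.<ᵇ i in e
    ... | false = z≤n
    ... | true  = isLarge-true (ℕP.≤-trans (ℕP.<ᵇ⇒< κ i (Equivalence.from T-≡ e)) i≤j)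
    case : ∀ a w → 𝟙 (ok w) ℕ.≤ 𝟙 (ok (a ∷ w)) ℕ.+ 𝟙 (ok w) ℕ.* isLarge (busy (probes a) (occ w))
    case a w with ok w | first a (occ w) in eq
    ... | false | _       = z≤n
    ... | true  | just _  = ℕP.m≤m+n 1 _
    -- A failed insertion has met `suc κ` occupied probes, the least number that `isLarge` counts as
    -- large.
    ... | true  | nothing = ℕP.≤-trans (isLarge-true (ℕP.≤-reflexive (sym (trans (busy-nothing (probes a) (occ w) eq) (length-probes a)))))
                                       (ℕP.≤-reflexive (sym (ℕP.+-identityʳ _)))

-- Partial sums of the exponential series

open RationalLemmas
open ExpLemmas
open +-*-Solver using (solve; _:=_; _:+_; _:*_; _:-_; :-_; con)

≤-by-difference : ∀ {p q} d → 0ℚ ≤ d → p + d ≡ q → p ≤ q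
≤-by-difference {p} d hd refl = subst (_≤ p + d) (ℚP.+-identityʳ p) (ℚP.+-monoʳ-≤ p hd)

*-monoʳ : ∀ {p q} r → 0ℚ ≤ r → p ≤ q → p * r ≤ q * r
*-monoʳ r hr = ℚP.*-monoʳ-≤-nonNeg r {{ℚ.nonNegative hr}}

0≤1 : 0ℚ ≤ 1ℚ
0≤1 = ℚP.<⇒≤ 0<1

p≤q⇒0≤q-p : ∀ {p q} → p ≤ q → 0ℚ ≤ q - p
p≤q⇒0≤q-p {p} {q} h = subst (_≤ q - p) (ℚP.+-inverseʳ p) (ℚP.+-monoˡ-≤ (- p) h)

*-cancelˡ-≡ : ∀ {r p q} → 0ℚ < r → r * p ≡ r * q → p ≡ q
*-cancelˡ-≡ {r} hr e = ℚP.≤-antisym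
  (ℚP.*-cancelˡ-≤-pos r {{ℚ.positive hr}} (ℚP.≤-reflexive e))
  (ℚP.*-cancelˡ-≤-pos r {{ℚ.positive hr}} (ℚP.≤-reflexive (sym e)))

*-cancelˡ-≤ : ∀ {r p q} → 0ℚ < r → r * p ≤ r * q → p ≤ q
*-cancelˡ-≤ {r} hr = ℚP.*-cancelˡ-≤-pos r {{ℚ.positive hr}}

p≤∣p∣ : ∀ p → p ≤ ∣ p ∣
p≤∣p∣ p with ℚP.≤-total 0ℚ p
... | inj₁ h = ℚP.≤-reflexive (sym (ℚP.0≤p⇒∣p∣≡p h))
... | inj₂ h = ℚP.≤-trans h (ℚP.0≤∣p∣ p)

partialSum : (ℕ → ℚ) → ℕ → ℚ
partialSum f zero    = 0ℚ
partialSum f (suc k) = partialSum f k + f k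

partialSum-head : ∀ f k → partialSum f (suc k) ≡ f 0 + partialSum (f ∘ suc) k
partialSum-head f zero    = solve 1 (λ a → con 0ℚ :+ a := a :+ con 0ℚ) refl (f 0)
partialSum-head f (suc k) = trans (cong (_+ f (suc k)) (partialSum-head f k)) (ℚP.+-assoc (f 0) _ _)

partialSum-cong : ∀ {f g} → (∀ i → f i ≡ g i) → ∀ k → partialSum f k ≡ partialSum g k
partialSum-cong h zero    = refl
partialSum-cong h (suc k) = cong₂ _+_ (partialSum-cong h k) (h k)

partialSum-* : ∀ c f k → partialSum (λ i → c * f i) k ≡ c * partialSum f k
partialSum-* c f zero    = sym (ℚP.*-zeroʳ c)
partialSum-* c f (suc k) = trans (cong (_+ c * f k) (partialSum-* c f k)) (sym (ℚP.*-distribˡ-+ c _ _))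

expSum≡partialSum : ∀ x k → expSum x k ≡ partialSum (expTerm x) k
expSum≡partialSum x zero    = refl
expSum≡partialSum x (suc k) = cong (_+ expTerm x k) (expSum≡partialSum x k)

convolve : (ℕ → ℚ) → (ℕ → ℚ) → ℕ → ℚ
convolve f g zero    = f 0 * g 0
convolve f g (suc k) = f 0 * g (suc k) + convolve (f ∘ suc) g k

convolve-last : ∀ f g k → convolve f g (suc k) ≡ convolve f (g ∘ suc) k + f (suc k) * g 0
convolve-last f g zero    = refl
convolve-last f g (suc k) = trans (cong ((f 0 * g (suc (suc k))) +_) (convolve-last (f ∘ suc) g k)) (sym (ℚP.+-assoc (f 0 * g (suc (suc k))) _ _))

convolve-scale : ∀ c d f f′ g g′ → (∀ i → f′ i ≡ c * f i) → (∀ i → g′ i ≡ d * g i) → ∀ k → convolve f′ g′ k ≡ (c * d) * convolve f g k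
convolve-scale c d f f′ g g′ hf hg zero = trans (cong₂ _*_ (hf 0) (hg 0))
  (solve 4 (λ c d a b → (c :* a) :* (d :* b) := (c :* d) :* (a :* b)) refl c d (f 0) (g 0))
convolve-scale c d f f′ g g′ hf hg (suc k) = trans
  (cong₂ _+_ (cong₂ _*_ (hf 0) (hg (suc k))) (convolve-scale c d (f ∘ suc) (f′ ∘ suc) g g′ (hf ∘ suc) hg k))
  (solve 5 (λ c d a b r → (c :* a) :* (d :* b) :+ (c :* d) :* r := (c :* d) :* (a :* b :+ r)) refl c d (f 0) (g (suc k)) _)

-- The product rule for the derivation x d/dx, read off coefficientwise: k = i + j on every summand.
convolve-weigh : ∀ f g k → fromℕ k * convolve f g k ≡
                 convolve (λ i → fromℕ i * f i) g k + convolve f (λ j → fromℕ j * g j) k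
convolve-weigh f g k = go f g 0 k
  where
  -- Shifting f turns the weight i of f i into an offset.
  go : ∀ f g s k → fromℕ (s ℕ.+ k) * convolve f g k ≡
       convolve (λ i → fromℕ (s ℕ.+ i) * f i) g k + convolve f (λ j → fromℕ j * g j) k
  go f g s zero    = solve 3 (λ a b c → a :* (b :* c) := (a :* b) :* c :+ b :* (con 0ℚ :* c)) refl (fromℕ (s ℕ.+ 0)) (f 0) (g 0)
  go f g s (suc k) = begin
    fromℕ (s ℕ.+ suc k) * (f 0 * g (suc k) + convolve (f ∘ suc) g k)
      ≡⟨ ℚP.*-distribˡ-+ (fromℕ (s ℕ.+ suc k)) _ _ ⟩
    fromℕ (s ℕ.+ suc k) * (f 0 * g (suc k)) + fromℕ (s ℕ.+ suc k) * convolve (f ∘ suc) g k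
      ≡⟨ cong₂ _+_ (cong (_* (f 0 * g (suc k))) (/-+ s (suc k) 1))
                   (trans (cong (λ x → fromℕ x * convolve (f ∘ suc) g k) (ℕP.+-suc s k)) (go (f ∘ suc) g (suc s) k)) ⟩
    (fromℕ s + fromℕ (suc k)) * (f 0 * g (suc k)) + (A + B)
      ≡⟨ solve 6 (λ s t a b x y → (s :+ t) :* (a :* b) :+ (x :+ y) := ((s :* a) :* b :+ x) :+ (a :* (t :* b) :+ y)) refl
           (fromℕ s) (fromℕ (suc k)) (f 0) (g (suc k)) A B ⟩
    ((fromℕ s * f 0) * g (suc k) + A) + (f 0 * (fromℕ (suc k) * g (suc k)) + B)
      ≡⟨ cong (_+ (f 0 * (fromℕ (suc k) * g (suc k)) + B))
           (cong₂ _+_ (cong (λ x → (fromℕ x * f 0) * g (suc k)) (sym (ℕP.+-identityʳ s)))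
                      (convolve-cong (λ i → cong (λ x → fromℕ x * f (suc i)) (sym (ℕP.+-suc s i))) k)) ⟩
    convolve (λ i → fromℕ (s ℕ.+ i) * f i) g (suc k) + convolve f (λ j → fromℕ j * g j) (suc k) ∎
    where
    open ≡-Reasoning
    A = convolve (λ i → fromℕ (suc s ℕ.+ i) * f (suc i)) g k
    B = convolve (f ∘ suc) (λ j → fromℕ j * g j) k
    convolve-cong : ∀ {f f′} → (∀ i → f i ≡ f′ i) → ∀ k → convolve f g k ≡ convolve f′ g k
    convolve-cong h zero    = cong (_* g 0) (h 0)
    convolve-cong h (suc k) = cong₂ _+_ (cong (_* g (suc k)) (h 0)) (convolve-cong (h ∘ suc) k)

expTerm-suc : ∀ x j → fromℕ (suc j) * expTerm x (suc j) ≡ x * expTerm x j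
expTerm-suc x j = trans
  (solve 4 (λ s x p i → s :* ((x :* p) :* i) := x :* (p :* (s :* i))) refl (fromℕ (suc j)) x (x ^ j) (inv! (suc j)))
  (cong (λ i → x * (x ^ j * i)) (inv!-suc j))

-- The binomial theorem. By the product rule of `convolve-weigh`, both sides satisfy (k + 1) c(k+1)
-- = (x + y) c(k).
expTerm-+ : ∀ x y k → expTerm (x + y) k ≡ convolve (expTerm x) (expTerm y) k
expTerm-+ x y zero    = refl
expTerm-+ x y (suc k) = *-cancelˡ-≡ (fromℕ-suc-pos k) (begin
  fromℕ (suc k) * expTerm (x + y) (suc k)     ≡⟨ expTerm-suc (x + y) k ⟩
  (x + y) * expTerm (x + y) k                 ≡⟨ cong ((x + y) *_) (expTerm-+ x y k) ⟩
  (x + y) * C                                 ≡⟨ solve 3 (λ x y c → (x :+ y) :* c := (x :* con 1ℚ) :* c :+ (con 1ℚ :* y) :* c) refl x y C ⟩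
  (x * 1ℚ) * C + (1ℚ * y) * C
    ≡⟨ sym (cong₂ _+_ (convolve-scale x 1ℚ X (λ i → fromℕ (suc i) * X (suc i)) Y Y (expTerm-suc x) (λ i → sym (ℚP.*-identityˡ _)) k)
                      (convolve-scale 1ℚ y X X Y (λ i → fromℕ (suc i) * Y (suc i)) (λ i → sym (ℚP.*-identityˡ _)) (expTerm-suc y) k)) ⟩
  P + Q                                       ≡⟨ solve 4 (λ p q a b → p :+ q := (((con 0ℚ :* con 1ℚ) :* a) :+ p) :+ (q :+ b :* (con 0ℚ :* con 1ℚ))) refl P Q (Y (suc k)) (X (suc k)) ⟩
  convolve (λ i → fromℕ i * X i) Y (suc k) + (Q + X (suc k) * (0ℚ * 1ℚ))
    ≡⟨ cong (convolve (λ i → fromℕ i * X i) Y (suc k) +_) (sym (convolve-last X (λ j → fromℕ j * Y j) k)) ⟩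
  convolve (λ i → fromℕ i * X i) Y (suc k) + convolve X (λ j → fromℕ j * Y j) (suc k)
    ≡⟨ sym (convolve-weigh X Y (suc k)) ⟩
  fromℕ (suc k) * convolve X Y (suc k)        ∎)
  where
  open ≡-Reasoning
  X Y : ℕ → ℚ
  X = expTerm x
  Y = expTerm y
  C = convolve X Y k
  P = convolve (λ i → fromℕ (suc i) * X (suc i)) Y k
  Q = convolve X (λ i → fromℕ (suc i) * Y (suc i)) k

-- The part of partialSum f k * partialSum g M that lies outside the triangle i + j < k.
excess : ℕ → (ℕ → ℚ) → (ℕ → ℚ) → ℕ → ℚ
excess zero    f g M = 0ℚ
excess (suc k) f g M = f 0 * (partialSum g M - partialSum g (suc k)) + excess k (f ∘ suc) g M

triangle-head : ∀ f g k → partialSum (convolve f g) (suc k) ≡ f 0 * partialSum g (suc k) + partialSum (convolve (f ∘ suc) g) k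
triangle-head f g zero    = solve 2 (λ a b → con 0ℚ :+ a :* b := a :* (con 0ℚ :+ b) :+ con 0ℚ) refl (f 0) (g 0)
triangle-head f g (suc k) = trans (cong (_+ convolve f g (suc k)) (triangle-head f g k))
  (solve 5 (λ a s t b c → (a :* s :+ t) :+ (a :* b :+ c) := a :* (s :+ b) :+ (t :+ c)) refl
    (f 0) (partialSum g (suc k)) (partialSum (convolve (f ∘ suc) g) k) (g (suc k)) (convolve (f ∘ suc) g k))

square≡triangle+excess : ∀ k f g M → partialSum f k * partialSum g M ≡ partialSum (convolve f g) k + excess k f g M
square≡triangle+excess zero    f g M = ℚP.*-zeroˡ (partialSum g M)
square≡triangle+excess (suc k) f g M = begin
  partialSum f (suc k) * partialSum g M
    ≡⟨ cong (_* partialSum g M) (partialSum-head f k) ⟩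
  (f 0 + partialSum (f ∘ suc) k) * partialSum g M
    ≡⟨ ℚP.*-distribʳ-+ (partialSum g M) (f 0) _ ⟩
  f 0 * partialSum g M + partialSum (f ∘ suc) k * partialSum g M
    ≡⟨ cong ((f 0 * partialSum g M) +_) (square≡triangle+excess k (f ∘ suc) g M) ⟩
  f 0 * partialSum g M + (partialSum (convolve (f ∘ suc) g) k + excess k (f ∘ suc) g M)
    ≡⟨ solve 5 (λ a s t u v → a :* s :+ (t :+ u) := (a :* v :+ t) :+ (a :* (s :- v) :+ u)) refl
         (f 0) (partialSum g M) (partialSum (convolve (f ∘ suc) g) k) (excess k (f ∘ suc) g M) (partialSum g (suc k)) ⟩
  (f 0 * partialSum g (suc k) + partialSum (convolve (f ∘ suc) g) k) + excess (suc k) f g M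
    ≡⟨ cong (_+ excess (suc k) f g M) (sym (triangle-head f g k)) ⟩
  partialSum (convolve f g) (suc k) + excess (suc k) f g M ∎
  where open ≡-Reasoning

∣partialSum-tail∣ : ∀ {g g′} → (∀ i → ∣ g i ∣ ≤ g′ i) → ∀ k d →
                   ∣ partialSum g (d ℕ.+ k) - partialSum g k ∣ ≤ partialSum g′ (d ℕ.+ k) - partialSum g′ k
∣partialSum-tail∣ {g} {g′} h k zero = ℚP.≤-reflexive (trans (cong ∣_∣ (ℚP.+-inverseʳ (partialSum g k))) (sym (ℚP.+-inverseʳ (partialSum g′ k))))
∣partialSum-tail∣ {g} {g′} h k (suc d) = subst₂ _≤_
  (cong ∣_∣ (solve 3 (λ a b c → (a :- b) :+ c := (a :+ c) :- b) refl (partialSum g (d ℕ.+ k)) (partialSum g k) (g (d ℕ.+ k))))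
  (solve 3 (λ a b c → (a :- b) :+ c := (a :+ c) :- b) refl (partialSum g′ (d ℕ.+ k)) (partialSum g′ k) (g′ (d ℕ.+ k)))
  (∣-∣-mono-+ {partialSum g (d ℕ.+ k) - partialSum g k} {g (d ℕ.+ k)} (∣partialSum-tail∣ h k d) (h (d ℕ.+ k)))

∣excess∣ : ∀ k {f f′ g g′} M → (∀ i → ∣ f i ∣ ≤ f′ i) → (∀ i → ∣ g i ∣ ≤ g′ i) → k ℕ.≤ M → ∣ excess k f g M ∣ ≤ excess k f′ g′ M
∣excess∣ zero    M hf hg h = ℚP.≤-refl
∣excess∣ (suc k) {f} {f′} {g} {g′} M hf hg h = ∣-∣-mono-+ {f 0 * (partialSum g M - partialSum g (suc k))} {excess k (f ∘ suc) g M}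
  (∣-∣-mono-* {f 0} {partialSum g M - partialSum g (suc k)} (hf 0) tail
    (ℚP.≤-trans (ℚP.0≤∣p∣ (partialSum g M - partialSum g (suc k))) tail))
  (∣excess∣ k M (hf ∘ suc) hg (ℕP.≤-trans (ℕP.n≤1+n k) h))
  where
  tail : ∣ partialSum g M - partialSum g (suc k) ∣ ≤ partialSum g′ M - partialSum g′ (suc k)
  tail = subst (λ M → ∣ partialSum g M - partialSum g (suc k) ∣ ≤ partialSum g′ M - partialSum g′ (suc k)) (ℕP.m∸n+n≡m h)
    (∣partialSum-tail∣ hg (suc k) (M ∸ suc k))

-- The rectangle i < k, j < M lies inside the triangle i + j < k + M, and all terms are nonnegative.
square≤triangle : ∀ k M f g → (∀ i → 0ℚ ≤ f i) → (∀ i → 0ℚ ≤ g i) →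
                  partialSum f k * partialSum g M ≤ partialSum (convolve f g) (k ℕ.+ M)
square≤triangle zero    M f g hf hg = subst (_≤ partialSum (convolve f g) M) (sym (ℚP.*-zeroˡ (partialSum g M))) (partialSum-nonNeg M)
  where
  convolve-nonNeg : ∀ {f} → (∀ i → 0ℚ ≤ f i) → ∀ k → 0ℚ ≤ convolve f g k
  convolve-nonNeg hf zero    = *-nonNeg (hf 0) (hg 0)
  convolve-nonNeg hf (suc k) = +-nonNeg (*-nonNeg (hf 0) (hg (suc k))) (convolve-nonNeg (hf ∘ suc) k)
  partialSum-nonNeg : ∀ k → 0ℚ ≤ partialSum (convolve f g) k
  partialSum-nonNeg zero    = ℚP.≤-refl
  partialSum-nonNeg (suc k) = +-nonNeg (partialSum-nonNeg k) (convolve-nonNeg hf k)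
square≤triangle (suc k) M f g hf hg = begin
  partialSum f (suc k) * partialSum g M
    ≡⟨ trans (cong (_* partialSum g M) (partialSum-head f k)) (ℚP.*-distribʳ-+ (partialSum g M) (f 0) _) ⟩
  f 0 * partialSum g M + partialSum (f ∘ suc) k * partialSum g M
    ≤⟨ ℚP.+-mono-≤ (*-monoˡ (f 0) (hf 0) (extend (suc k))) (square≤triangle k M (f ∘ suc) g (hf ∘ suc) hg) ⟩
  f 0 * partialSum g (suc k ℕ.+ M) + partialSum (convolve (f ∘ suc) g) (k ℕ.+ M)
    ≡⟨ sym (triangle-head f g (k ℕ.+ M)) ⟩
  partialSum (convolve f g) (suc k ℕ.+ M) ∎
  where
  open ℚP.≤-Reasoning
  extend : ∀ d → partialSum g M ≤ partialSum g (d ℕ.+ M)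
  extend zero    = ℚP.≤-refl
  extend (suc d) = ℚP.≤-trans (extend d) (≤-by-difference (g (d ℕ.+ M)) (hg _) refl)

expSum-+ : ∀ x y k → expSum (x + y) k ≡ partialSum (convolve (expTerm x) (expTerm y)) k
expSum-+ x y zero    = refl
expSum-+ x y (suc k) = cong₂ _+_ (expSum-+ x y k) (expTerm-+ x y k)

expSum-*-excess : ∀ x y k → expSum x k * expSum y k ≡ expSum (x + y) k + excess k (expTerm x) (expTerm y) k
expSum-*-excess x y k = trans (cong₂ _*_ (expSum≡partialSum x k) (expSum≡partialSum y k))
  (trans (square≡triangle+excess k (expTerm x) (expTerm y) k) (cong (_+ excess k (expTerm x) (expTerm y) k) (sym (expSum-+ x y k))))

expSum-*-≥ : ∀ {x y} → 0ℚ ≤ x → 0ℚ ≤ y → ∀ k → expSum (x + y) k ≤ expSum x k * expSum y k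
expSum-*-≥ {x} {y} hx hy k = ≤-by-difference (excess k (expTerm x) (expTerm y) k)
  (ℚP.≤-trans (ℚP.0≤∣p∣ (excess k (expTerm x) (expTerm y) k))
    (∣excess∣ k k (λ i → ℚP.≤-reflexive (ℚP.0≤p⇒∣p∣≡p (expTerm-nonNeg hx i))) (λ i → ℚP.≤-reflexive (ℚP.0≤p⇒∣p∣≡p (expTerm-nonNeg hy i))) ℕP.≤-refl))
  (sym (expSum-*-excess x y k))

-- The excess is dominated by the one for ∣ x ∣ and ∣ y ∣. That square fits into the triangle of
-- side 2k, so its excess is at most the part of the series at ∣ x ∣ + ∣ y ∣ between k and 2k, which
-- the tail bound controls.
expSum-*-close : ∀ x y B → ∣ x ∣ + ∣ y ∣ ≤ B → ∀ k M → B + B ≤ fromℕ M → M ℕ.≤ k →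
                 ∣ expSum x k * expSum y k - expSum (x + y) k ∣ ≤ expTerm B k + expTerm B k
expSum-*-close x y B hB k M hM hk = ℚP.≤-trans
  (ℚP.≤-reflexive (cong ∣_∣ (trans (cong (_- expSum (x + y) k) (expSum-*-excess x y k))
    (solve 2 (λ a b → (a :+ b) :- a := b) refl (expSum (x + y) k) (excess k (expTerm x) (expTerm y) k)))))
  (ℚP.≤-trans (∣excess∣ k k (∣expTerm∣-mono ℚP.≤-refl) (∣expTerm∣-mono ℚP.≤-refl) ℕP.≤-refl)
  (ℚP.≤-trans (ℚP.≤-reflexive (trans (solve 2 (λ a b → a := (b :+ a) :- b) refl (excess k X Y k) (expSum b k))
    (cong (_- expSum b k) (sym (expSum-*-excess ∣ x ∣ ∣ y ∣ k)))))
  (ℚP.≤-trans (ℚP.+-monoˡ-≤ (- expSum b k)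
    (subst₂ _≤_ (sym (cong₂ _*_ (expSum≡partialSum ∣ x ∣ k) (expSum≡partialSum ∣ y ∣ k))) (sym (expSum-+ ∣ x ∣ ∣ y ∣ (k ℕ.+ k)))
      (square≤triangle k k X Y (expTerm-nonNeg (ℚP.0≤∣p∣ x)) (expTerm-nonNeg (ℚP.0≤∣p∣ y)))))
  (ℚP.≤-trans (p≤∣p∣ (expSum b (k ℕ.+ k) - expSum b k))
    (expSum-close (ℚP.≤-trans (ℚP.≤-reflexive (ℚP.0≤p⇒∣p∣≡p (+-nonNeg (ℚP.0≤∣p∣ x) (ℚP.0≤∣p∣ y)))) hB) M hM k hk (k ℕ.+ k) (ℕP.m≤m+n k k))))))
  where
  b = ∣ x ∣ + ∣ y ∣
  X Y : ℕ → ℚ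
  X = expTerm ∣ x ∣
  Y = expTerm ∣ y ∣

expSum-nonNeg : ∀ {u} → 0ℚ ≤ u → ∀ k → 0ℚ ≤ expSum u k
expSum-nonNeg hu zero    = ℚP.≤-refl
expSum-nonNeg hu (suc k) = +-nonNeg (expSum-nonNeg hu k) (expTerm-nonNeg hu k)

expSum-mono : ∀ {u v} → 0ℚ ≤ u → u ≤ v → ∀ k → expSum u k ≤ expSum v k
expSum-mono hu h zero    = ℚP.≤-refl
expSum-mono {u} hu h (suc k) = ℚP.+-mono-≤ (expSum-mono hu h k) (ℚP.≤-trans
  (ℚP.≤-reflexive (sym (ℚP.0≤p⇒∣p∣≡p (expTerm-nonNeg hu k))))
  (∣expTerm∣-mono (ℚP.≤-trans (ℚP.≤-reflexive (ℚP.0≤p⇒∣p∣≡p hu)) h) k))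

expSum-≥1 : ∀ {u} → 0ℚ ≤ u → ∀ k → 1ℚ ≤ expSum u (suc k)
expSum-≥1 hu zero    = ℚP.≤-refl
expSum-≥1 {u} hu (suc k) = ℚP.≤-trans (expSum-≥1 hu k) (≤-by-difference (expTerm u (suc k)) (expTerm-nonNeg hu (suc k)) refl)

-- e^u ≤ 1/(1 - u) for partial sums: consecutive terms have ratio at most u, so the sum s satisfies
-- s ≤ 1 + u s. Stated as a product to avoid division.
expSum-geometric : ∀ {u} → 0ℚ ≤ u → ∀ k → expSum u k * (1ℚ - u) ≤ 1ℚ
expSum-geometric {u} hu k = ≤-by-difference (1ℚ - (expSum u k - u * expSum u k))
  (p≤q⇒0≤q-p (ℚP.≤-trans (ℚP.+-monoˡ-≤ (- (u * expSum u k)) (step k))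
    (ℚP.≤-reflexive (solve 1 (λ a → (con 1ℚ :+ a) :- a := con 1ℚ) refl (u * expSum u k)))))
  (solve 2 (λ e u → e :* (con 1ℚ :- u) :+ (con 1ℚ :- (e :- u :* e)) := con 1ℚ) refl (expSum u k) u)
  where
  term : ∀ i → expTerm u (suc i) ≤ u * expTerm u i
  term i = subst (expTerm u (suc i) ≤_) (expTerm-suc u i) (subst (_≤ fromℕ (suc i) * expTerm u (suc i)) (ℚP.*-identityˡ _)
    (*-monoʳ (expTerm u (suc i)) (expTerm-nonNeg hu (suc i)) (fromℕ-mono (s≤s (z≤n {i})))))
  step : ∀ k → expSum u k ≤ 1ℚ + u * expSum u k
  step zero    = ≤-by-difference 1ℚ 0≤1 (solve 1 (λ u → con 0ℚ :+ con 1ℚ := con 1ℚ :+ u :* con 0ℚ) refl u)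
  step (suc k) = ℚP.≤-trans (inner k)
    (ℚP.+-monoʳ-≤ 1ℚ (*-monoˡ u hu (≤-by-difference (expTerm u k) (expTerm-nonNeg hu k) refl)))
    where
    inner : ∀ k → expSum u (suc k) ≤ 1ℚ + u * expSum u k
    inner zero    = ℚP.≤-reflexive (solve 1 (λ u → con 1ℚ := con 1ℚ :+ u :* con 0ℚ) refl u)
    inner (suc k) = ℚP.≤-trans (ℚP.+-mono-≤ (inner k) (term k))
      (ℚP.≤-reflexive (solve 3 (λ u s t → (con 1ℚ :+ u :* s) :+ u :* t := con 1ℚ :+ u :* (s :+ t)) refl u (expSum u k) (expTerm u k)))

-- e^(T u) ≤ (1 - u)^(-T). This is the bridge between exponentials and powers, used for the
-- numerical bound on e, for (1 - 1/N)^T in the decay, and for the failure probability.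
expSum-power : ∀ {u} → 0ℚ ≤ u → u ≤ 1ℚ → ∀ T k → expSum (fromℕ T * u) k * (1ℚ - u) ^ T ≤ 1ℚ
expSum-power {u} hu hu1 zero    k = subst (λ x → expSum x k * 1ℚ ≤ 1ℚ) (sym (ℚP.*-zeroˡ u)) (at-0 k)
  where
  at-0 : ∀ k → expSum 0ℚ k * 1ℚ ≤ 1ℚ
  at-0 k = expSum-geometric ℚP.≤-refl k
expSum-power {u} hu hu1 (suc T) k = begin
  expSum (fromℕ (suc T) * u) k * ((1ℚ - u) * (1ℚ - u) ^ T)
    ≤⟨ *-monoʳ ((1ℚ - u) * (1ℚ - u) ^ T) (*-nonNeg 0≤1-u (^-nonNeg 0≤1-u T))
         (subst (λ x → expSum x k ≤ expSum u k * expSum (fromℕ T * u) k) split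
           (expSum-*-≥ hu (*-nonNeg (fromℕ-nonNeg T) hu) k)) ⟩
  (expSum u k * expSum (fromℕ T * u) k) * ((1ℚ - u) * (1ℚ - u) ^ T)
    ≡⟨ solve 4 (λ a b c d → (a :* b) :* (c :* d) := (a :* c) :* (b :* d)) refl (expSum u k) (expSum (fromℕ T * u) k) (1ℚ - u) ((1ℚ - u) ^ T) ⟩
  (expSum u k * (1ℚ - u)) * (expSum (fromℕ T * u) k * (1ℚ - u) ^ T)
    ≤⟨ *-mono (*-nonNeg (expSum-nonNeg hu k) 0≤1-u) 0≤1 (expSum-geometric hu k) (expSum-power hu hu1 T k) ⟩
  1ℚ * 1ℚ ∎
  where
  open ℚP.≤-Reasoning
  0≤1-u : 0ℚ ≤ 1ℚ - u
  0≤1-u = p≤q⇒0≤q-p hu1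
  split : u + fromℕ T * u ≡ fromℕ (suc T) * u
  split = trans (solve 2 (λ u t → u :+ t :* u := (t :+ con 1ℚ) :* u) refl u (fromℕ T)) (cong (_* u) (sym (fromℕ-suc T)))

expTerm-anti : ∀ {B} → 0ℚ ≤ B → ∀ M → B + B ≤ fromℕ M → ∀ k d → M ℕ.≤ k → expTerm B (d ℕ.+ k) ≤ expTerm B k
expTerm-anti hB M hM k zero    hk = ℚP.≤-refl
expTerm-anti {B} hB M hM k (suc d) hk = ℚP.≤-trans
  (≤-by-difference (expTerm B (suc (d ℕ.+ k))) (expTerm-nonNeg hB (suc (d ℕ.+ k))) refl)
  (ℚP.≤-trans (expTerm-halves hB M hM (d ℕ.+ k) (ℕP.≤-trans hk (ℕP.m≤n+m k d))) (expTerm-anti hB M hM k d hk))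

-- The threshold N is uniform in x and y because `exp` is taken along the diagonal, where the
-- argument varies together with the truncation order.
expSum-*-limit : ∀ B → 0ℚ ≤ B → ∀ η → 0ℚ < η → ∃ λ N → ∀ k → N ℕ.≤ k → ∀ x y → ∣ x ∣ + ∣ y ∣ ≤ B →
                 ∣ expSum x k * expSum y k - expSum (x + y) k ∣ < η
expSum-*-limit B hB η hη = j ℕ.+ M , λ k hk x y h → ℚP.≤-<-trans
  (expSum-*-close x y B h k M hM (ℕP.≤-trans (ℕP.m≤n+m M j) hk))
  (subst (expTerm B k + expTerm B k <_) (halves η) (ℚP.+-mono-< (small k hk) (small k hk)))
  where
  M j : ℕ
  M = proj₁ (archimedean (B + B))
  hM : B + B ≤ fromℕ M
  hM = proj₂ (archimedean (B + B))
  j = proj₁ (expTerm-small hB M hM (½ * η) (half-pos hη))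
  small : ∀ k → j ℕ.+ M ℕ.≤ k → expTerm B k < ½ * η
  small k hk = ℚP.≤-<-trans
    (subst (λ k → expTerm B k ≤ expTerm B (j ℕ.+ M)) (ℕP.m∸n+n≡m hk) (expTerm-anti hB M hM (j ℕ.+ M) (k ∸ (j ℕ.+ M)) (ℕP.m≤n+m M j)))
    (proj₂ (expTerm-small hB M hM (½ * η) (half-pos hη)))

-- The critical load

≤! : ∀ {p q} {_ : True (p ℚP.≤? q)} → p ≤ q
≤! {_} {_} {h} = toWitness h

<! : ∀ {p q} {_ : True (p ℚP.<? q)} → p < q
<! {_} {_} {h} = toWitness h

∣-∣<⇒< : ∀ {p q r} → ∣ p - q ∣ < r → p < q + r
∣-∣<⇒< {p} {q} {r} h = subst (_< q + r) (solve 2 (λ p q → q :+ (p :- q) := p) refl p q)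
  (ℚP.+-monoʳ-< q (ℚP.≤-<-trans (p≤∣p∣ (p - q)) h))

∣-∣<⇒> : ∀ {p q r} → ∣ p - q ∣ < r → q < p + r
∣-∣<⇒> {p} {q} {r} h = ∣-∣<⇒< (subst (_< r) (∣-∣-flip p q) h)

≤<-absurd : ∀ {p q} → p ≤ q → ¬ (q < p)
≤<-absurd h h′ = ℚP.<-irrefl refl (ℚP.≤-<-trans h h′)

smaller : ∀ {p q} → 0ℚ < p → 0ℚ < q → ∃ λ r → 0ℚ < r × r ≤ p × r ≤ q
smaller {p} {q} hp hq with ℚP.≤-total p q
... | inj₁ h = p , hp , ℚP.≤-refl , h
... | inj₂ h = q , hq , h , ℚP.≤-refl

_⊕_ : ∀ {p q} → 0ℚ ≤ p → 0ℚ ≤ q → 0ℚ ≤ p + q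
_⊕_ = +-nonNeg

infixl 6 _⊕_

_⊗_ : ∀ {p q} → 0ℚ ≤ p → 0ℚ ≤ q → 0ℚ ≤ p * q
_⊗_ = *-nonNeg

infixl 7 _⊗_

-- The tangent of exp at a lies below the graph: e^x ≥ e^a (1 - (a - x)), in a form valid for every
-- partial sum.
expSum-step : ∀ {x a} → 0ℚ ≤ x → x ≤ a → a - x ≤ 1ℚ → ∀ k → expSum a k * (1ℚ - (a - x)) ≤ expSum x k
expSum-step {x} {a} hx xa h k = begin
  expSum a k * (1ℚ - (a - x))
    ≡⟨ cong (λ z → expSum z k * (1ℚ - (a - x))) (solve 2 (λ a x → a := x :+ (a :- x)) refl a x) ⟩
  expSum (x + (a - x)) k * (1ℚ - (a - x))
    ≤⟨ *-monoʳ _ (p≤q⇒0≤q-p h) (expSum-*-≥ hx 0≤z k) ⟩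
  expSum x k * expSum (a - x) k * (1ℚ - (a - x))
    ≡⟨ ℚP.*-assoc (expSum x k) _ _ ⟩
  expSum x k * (expSum (a - x) k * (1ℚ - (a - x)))
    ≤⟨ *-monoˡ (expSum x k) (expSum-nonNeg hx k) (expSum-geometric 0≤z k) ⟩
  expSum x k * 1ℚ
    ≡⟨ ℚP.*-identityʳ _ ⟩
  expSum x k ∎
  where
  open ℚP.≤-Reasoning
  0≤z = p≤q⇒0≤q-p xa

e-bound : ℚ
e-bound = ℤ.+ 256 / 81

-- e ≤ (4/3)⁴
expSum-1-≤ : ∀ k → expSum 1ℚ k ≤ e-bound
expSum-1-≤ k = *-cancelˡ-≤ {(1ℚ - ¼) ^ 4} <!
  (subst (_≤ (1ℚ - ¼) ^ 4 * e-bound) (ℚP.*-comm (expSum 1ℚ k) _)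
    (expSum-power {¼} ≤! ≤! 4 k))
  where
  ¼ : ℚ
  ¼ = ℤ.+ 1 / 4

-- y approximates the threshold: exp (1 - y) exp y = e and the threshold equation hold up to η, whence exp y ≥ 4 y - 80 η.
module AtThreshold
  (k : ℕ) (a y δ η : ℚ) (0≤a : 0ℚ ≤ a) (0<δ : 0ℚ < δ) (0<η : 0ℚ < η)
  (gap : δ ≤ y - a) (y≤ : y ≤ 1ℚ + η) (η≤ : η ≤ ℤ.+ 1 / 1000) (η≤δ : η ≤ (ℤ.+ 1 / 320) * δ)
  (product : ∣ expSum (1ℚ - y) (suc k) * expSum y (suc k) - expSum 1ℚ (suc k) ∣ < η)
  (root : ∣ fromℕ 4 * recip (expSum 1ℚ (suc k)) * y * expSum (1ℚ - y) (suc k) - 1ℚ ∣ < η)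
  where

  u v w : ℚ
  u = expSum (1ℚ - y) (suc k)
  v = expSum y (suc k)
  w = expSum 1ℚ (suc k)

  1≤w : 1ℚ ≤ w
  1≤w = expSum-≥1 0≤1 k

  w≤4 : w ≤ fromℕ 4
  w≤4 = ℚP.≤-trans (expSum-1-≤ (suc k)) ≤!

  0≤w : 0ℚ ≤ w
  0≤w = ℚP.≤-trans 0≤1 1≤w

  0≤η : 0ℚ ≤ η
  0≤η = ℚP.<⇒≤ 0<η

  a≤y : a ≤ y
  a≤y = ≤-by-difference ((y - a - δ) + δ) (p≤q⇒0≤q-p gap ⊕ ℚP.<⇒≤ 0<δ) (solve 3 (λ a y δ → a :+ ((y :- a :- δ) :+ δ) := y) refl a y δ)

  0≤y : 0ℚ ≤ y
  0≤y = ℚP.≤-trans 0≤a a≤y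

  scaled : w * (fromℕ 4 * recip w * y * u) ≡ fromℕ 4 * y * u
  scaled = trans (solve 5 (λ w c r y u → w :* (c :* r :* y :* u) := (w :* r) :* (c :* y :* u)) refl w (fromℕ 4) (recip w) y u)
    (trans (cong (_* (fromℕ 4 * y * u)) (RecipLemmas.*-recip (ℚP.<-≤-trans 0<1 1≤w))) (ℚP.*-identityˡ _))

  4yu≤ : fromℕ 4 * y * u ≤ w * (1ℚ + η)
  4yu≤ = subst (_≤ w * (1ℚ + η)) scaled (*-monoˡ w 0≤w (ℚP.<⇒≤ (∣-∣<⇒< {fromℕ 4 * recip w * y * u} {1ℚ} root)))

  ≤4yu : w ≤ fromℕ 4 * y * u + w * η
  ≤4yu = subst₂ _≤_ (ℚP.*-identityʳ w) (trans (ℚP.*-distribˡ-+ w _ η) (cong (_+ w * η) scaled))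
    (*-monoˡ w 0≤w (ℚP.<⇒≤ (∣-∣<⇒> {fromℕ 4 * recip w * y * u} {1ℚ} root)))

  -- A crude positive lower bound, there to permit division by u. Since 4 y u is close to w ≥ 1 and
  -- y hardly exceeds 1, u is in fact not much below 1/4.
  1/16≤u : ℤ.+ 1 / 16 ≤ u
  1/16≤u = ℚP.≮⇒≥ λ u< → ≤<-absurd (absurd (ℚP.<⇒≤ u<)) 1/4<3/4
    where
    1/4<3/4 : 0ℚ < ℤ.+ 1 / 2
    1/4<3/4 = <!
    absurd : u ≤ ℤ.+ 1 / 16 → ℤ.+ 1 / 2 ≤ 0ℚ
    absurd h = ≤-by-difference
      ((w - 1ℚ) * (1ℚ - η) + (fromℕ 4 * y * u + w * η - w) + fromℕ 4 * y * (ℤ.+ 1 / 16 - u) + (ℤ.+ 1 / 4) * (1ℚ + η - y)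
        + (ℤ.+ 5 / 4) * (ℤ.+ 1 / 1000 - η) + ℤ.+ 995 / 4000)
      (p≤q⇒0≤q-p 1≤w ⊗ p≤q⇒0≤q-p {η} {1ℚ} (ℚP.≤-trans η≤ ≤!) ⊕ p≤q⇒0≤q-p ≤4yu ⊕
       0≤4 ⊗ 0≤y ⊗ p≤q⇒0≤q-p h ⊕ ≤! {0ℚ} {ℤ.+ 1 / 4} ⊗ p≤q⇒0≤q-p y≤ ⊕ ≤! {0ℚ} {ℤ.+ 5 / 4} ⊗ p≤q⇒0≤q-p η≤ ⊕ ≤!)
      (solve 4 (λ w y u η → con (ℤ.+ 1 / 2) :+ ((w :- con 1ℚ) :* (con 1ℚ :- η) :+ (con (fromℕ 4) :* y :* u :+ w :* η :- w)
          :+ con (fromℕ 4) :* y :* (con (ℤ.+ 1 / 16) :- u) :+ con (ℤ.+ 1 / 4) :* (con 1ℚ :+ η :- y)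
          :+ con (ℤ.+ 5 / 4) :* (con (ℤ.+ 1 / 1000) :- η) :+ con (ℤ.+ 995 / 4000)) := con 0ℚ) refl w y u η)
      where
      0≤4 : 0ℚ ≤ fromℕ 4
      0≤4 = fromℕ-nonNeg 4

  -- From w < u v + η and 4 y u ≤ w (1 + η) follows u (4 y - v) ≤ (w + 1) η ≤ 5 η; the division by u
  -- ≥ 1/16 produces the constant 80.
  4y≤v : fromℕ 4 * y - fromℕ 80 * η ≤ v
  4y≤v = ℚP.≮⇒≥ λ v< → ≤<-absurd (absurd (ℚP.<⇒≤ v<)) (∣-∣<⇒> {u * v} {w} product)
    where
    absurd : v ≤ fromℕ 4 * y - fromℕ 80 * η → u * v + η ≤ w
    absurd h = ≤-by-difference
      (u * (fromℕ 4 * y - fromℕ 80 * η - v) + (w * (1ℚ + η) - fromℕ 4 * y * u) + fromℕ 80 * η * (u - ℤ.+ 1 / 16) + (fromℕ 4 - w) * η)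
      (ℚP.≤-trans (≤! {0ℚ} {ℤ.+ 1 / 16}) 1/16≤u ⊗ p≤q⇒0≤q-p h ⊕ p≤q⇒0≤q-p 4yu≤ ⊕ fromℕ-nonNeg 80 ⊗ 0≤η ⊗ p≤q⇒0≤q-p 1/16≤u ⊕
       p≤q⇒0≤q-p w≤4 ⊗ 0≤η)
      (solve 5 (λ w y u v η → u :* v :+ η :+ (u :* (con (fromℕ 4) :* y :- con (fromℕ 80) :* η :- v) :+ (w :* (con 1ℚ :+ η) :- con (fromℕ 4) :* y :* u)
          :+ con (fromℕ 80) :* η :* (u :- con (ℤ.+ 1 / 16)) :+ (con (fromℕ 4) :- w) :* η) := w) refl w y u v η)

  -- Keeps the threshold away from 1. Up to errors 4 y ≤ e^y ≤ e ≤ 256/81 < 3.17, whereas y ≥ 7/8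
  -- would give 4 y ≥ 3.5; η ≤ 1/1000 makes 80 η ≤ 0.08 small enough for this gap.
  y≤7/8 : y ≤ ℤ.+ 7 / 8
  y≤7/8 = ℚP.≮⇒≥ λ 7/8< → ≤<-absurd (absurd (ℚP.<⇒≤ 7/8<)) (<! {0ℚ} {ℤ.+ 1 / 10})
    where
    ζ = ℤ.+ 1 / 1000
    v≤ : v * (1ℚ - ζ) ≤ e-bound
    v≤ = ℚP.≤-trans (*-monoʳ (1ℚ - ζ) ≤! (expSum-mono 0≤y (ℚP.≤-trans y≤ (ℚP.+-monoʳ-≤ 1ℚ η≤)) (suc k)))
      (ℚP.≤-trans (ℚP.≤-reflexive (cong (λ z → expSum (1ℚ + ζ) (suc k) * (1ℚ - z)) (solve 1 (λ ζ → ζ := (con 1ℚ :+ ζ) :- con 1ℚ) refl ζ)))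
        (ℚP.≤-trans (expSum-step {1ℚ} {1ℚ + ζ} 0≤1 ≤! ≤! (suc k)) (expSum-1-≤ (suc k))))
    absurd : ℤ.+ 7 / 8 ≤ y → ℤ.+ 1 / 10 ≤ 0ℚ
    absurd h = ≤-by-difference
      ((v - (fromℕ 4 * y - fromℕ 80 * η)) * (1ℚ - ζ) + (e-bound - v * (1ℚ - ζ)) + fromℕ 4 * (1ℚ - ζ) * (y - ℤ.+ 7 / 8)
        + fromℕ 80 * (1ℚ - ζ) * (ζ - η) + (fromℕ 4 * (ℤ.+ 7 / 8) * (1ℚ - ζ) - fromℕ 80 * ζ * (1ℚ - ζ) - e-bound - ℤ.+ 1 / 10))
      (p≤q⇒0≤q-p 4y≤v ⊗ 0≤1-ζ ⊕ p≤q⇒0≤q-p v≤ ⊕ fromℕ-nonNeg 4 ⊗ 0≤1-ζ ⊗ p≤q⇒0≤q-p h ⊕ fromℕ-nonNeg 80 ⊗ 0≤1-ζ ⊗ p≤q⇒0≤q-p η≤ ⊕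
        ≤!)
      (solve 3 (λ v y η → con (ℤ.+ 1 / 10) :+ ((v :- (con (fromℕ 4) :* y :- con (fromℕ 80) :* η)) :* con (1ℚ - ζ) :+ (con e-bound :- v :* con (1ℚ - ζ))
        :+ con (fromℕ 4) :* con (1ℚ - ζ) :* (y :- con (ℤ.+ 7 / 8)) :+ con (fromℕ 80) :* con (1ℚ - ζ) :* (con ζ :- η)
        :+ con (fromℕ 4 * (ℤ.+ 7 / 8) * (1ℚ - ζ) - fromℕ 80 * ζ * (1ℚ - ζ) - e-bound - ℤ.+ 1 / 10)) := con 0ℚ) refl v y η)
      where
      0≤1-ζ : 0ℚ ≤ 1ℚ - ζ
      0≤1-ζ = ≤!

  y≤1 : y ≤ 1ℚ
  y≤1 = ℚP.≤-trans y≤7/8 ≤!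

  y-a≤1 : y - a ≤ 1ℚ
  y-a≤1 = ≤-by-difference ((1ℚ - y) + a) (p≤q⇒0≤q-p y≤1 ⊕ 0≤a) (solve 2 (λ y a → (y :- a) :+ ((con 1ℚ :- y) :+ a) := con 1ℚ) refl y a)

  a≤7/8 : a ≤ ℤ.+ 7 / 8
  a≤7/8 = ℚP.≤-trans a≤y y≤7/8

  E : ℚ
  E = expSum a (suc k)

  -- 4 y (1 - (y - a)) - 4 a = 4 (y - a) (1 - y)
  E-large : fromℕ 4 * a + (ℤ.+ 1 / 4) * δ ≤ E
  E-large = ≤-by-difference
    ((E - v * (1ℚ - (y - a))) + (v - (fromℕ 4 * y - fromℕ 80 * η)) * (1ℚ - (y - a)) + fromℕ 4 * (y - a - δ) * (1ℚ - y)
      + fromℕ 4 * δ * (ℤ.+ 7 / 8 - y) + fromℕ 80 * η * (y - a) + fromℕ 80 * ((ℤ.+ 1 / 320) * δ - η))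
    (p≤q⇒0≤q-p (expSum-step 0≤a a≤y y-a≤1 (suc k)) ⊕ p≤q⇒0≤q-p 4y≤v ⊗ p≤q⇒0≤q-p y-a≤1 ⊕ fromℕ-nonNeg 4 ⊗ p≤q⇒0≤q-p gap ⊗ p≤q⇒0≤q-p y≤1 ⊕
     fromℕ-nonNeg 4 ⊗ ℚP.<⇒≤ 0<δ ⊗ p≤q⇒0≤q-p y≤7/8 ⊕ fromℕ-nonNeg 80 ⊗ 0≤η ⊗ p≤q⇒0≤q-p a≤y ⊕ fromℕ-nonNeg 80 ⊗ p≤q⇒0≤q-p η≤δ)
    (solve 6 (λ E v y a δ η → con (fromℕ 4) :* a :+ con (ℤ.+ 1 / 4) :* δ :+
        ((E :- v :* (con 1ℚ :- (y :- a))) :+ (v :- (con (fromℕ 4) :* y :- con (fromℕ 80) :* η)) :* (con 1ℚ :- (y :- a)) :+ con (fromℕ 4) :* (y :- a :- δ) :* (con 1ℚ :- y)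
        :+ con (fromℕ 4) :* δ :* (con (ℤ.+ 7 / 8) :- y) :+ con (fromℕ 80) :* η :* (y :- a) :+ con (fromℕ 80) :* (con (ℤ.+ 1 / 320) :* δ :- η)) := E)
      refl E v y a δ η)

  -- Since E ≥ 4 a + δ/4 and E ≤ 4, lowering E by the fraction δ/16 still leaves at least 4 a.
  ρ : ℚ
  ρ = 1ℚ - (ℤ.+ 1 / 16) * δ

  ρ<1 : ρ < 1ℚ
  ρ<1 = subst (ρ <_) (solve 1 (λ d → (con 1ℚ :- d) :+ d := con 1ℚ) refl ((ℤ.+ 1 / 16) * δ))
    (subst (_< ρ + (ℤ.+ 1 / 16) * δ) (ℚP.+-identityʳ ρ) (ℚP.+-monoʳ-< ρ (*-pos (<! {0ℚ} {ℤ.+ 1 / 16}) 0<δ)))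

  0≤ρ : 0ℚ ≤ ρ
  0≤ρ = ≤-by-difference ((ℤ.+ 1 / 16) * (y - a - δ) + (ℤ.+ 1 / 16) * (1ℚ - (y - a)) + ℤ.+ 15 / 16)
    (≤! {0ℚ} {ℤ.+ 1 / 16} ⊗ p≤q⇒0≤q-p gap ⊕ ≤! {0ℚ} {ℤ.+ 1 / 16} ⊗ p≤q⇒0≤q-p y-a≤1 ⊕ ≤!)
    (solve 3 (λ y a δ → con 0ℚ :+ (con (ℤ.+ 1 / 16) :* (y :- a :- δ) :+ con (ℤ.+ 1 / 16) :* (con 1ℚ :- (y :- a)) :+ con (ℤ.+ 15 / 16)) :=
      con 1ℚ :- con (ℤ.+ 1 / 16) :* δ) refl y a δ)

  -- The inequality at a extends to all smaller x by the tangent at a: ρ e^x ≥ 4 a (1 - (a - x)),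
  -- which exceeds 4 x by 4 (a - x) (1 - a).
  subcritical : ∀ x → 0ℚ ≤ x → x ≤ a → fromℕ 4 * x ≤ ρ * expSum x (suc k)
  subcritical x 0≤x x≤a = ≤-by-difference
    (ρ * (expSum x (suc k) - E * (1ℚ - (a - x))) + ((E - (fromℕ 4 * a + (ℤ.+ 1 / 4) * δ)) + (ℤ.+ 1 / 16) * δ * (fromℕ 4 - E)) * (1ℚ - (a - x))
      + fromℕ 4 * (a - x) * (1ℚ - a))
    (0≤ρ ⊗ p≤q⇒0≤q-p (expSum-step 0≤x x≤a a-x≤1 (suc k)) ⊕
     (p≤q⇒0≤q-p E-large ⊕ ≤! {0ℚ} {ℤ.+ 1 / 16} ⊗ ℚP.<⇒≤ 0<δ ⊗ p≤q⇒0≤q-p E≤4) ⊗ p≤q⇒0≤q-p a-x≤1 ⊕ fromℕ-nonNeg 4 ⊗ p≤q⇒0≤q-p x≤a ⊗ p≤q⇒0≤q-p a≤1)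
    (solve 5 (λ F E a x δ → con (fromℕ 4) :* x :+
        ((con 1ℚ :- con (ℤ.+ 1 / 16) :* δ) :* (F :- E :* (con 1ℚ :- (a :- x))) :+
         ((E :- (con (fromℕ 4) :* a :+ con (ℤ.+ 1 / 4) :* δ)) :+ con (ℤ.+ 1 / 16) :* δ :* (con (fromℕ 4) :- E)) :* (con 1ℚ :- (a :- x))
         :+ con (fromℕ 4) :* (a :- x) :* (con 1ℚ :- a))
        := (con 1ℚ :- con (ℤ.+ 1 / 16) :* δ) :* F) refl (expSum x (suc k)) E a x δ)
    where
    a≤1 : a ≤ 1ℚ
    a≤1 = ℚP.≤-trans a≤y y≤1
    E≤4 : E ≤ fromℕ 4
    E≤4 = ℚP.≤-trans (expSum-mono 0≤a a≤1 (suc k)) w≤4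
    a-x≤1 : a - x ≤ 1ℚ
    a-x≤1 = ≤-by-difference ((1ℚ - a) + x) (p≤q⇒0≤q-p a≤1 ⊕ 0≤x) (solve 2 (λ a x → (a :- x) :+ ((con 1ℚ :- a) :+ x) := con 1ℚ) refl a x)

-- What the count uses about α, in rational terms: a load a slightly above α, the ratio ρ of the
-- decay, and the order K at which the exponential series is cut. The inequality covers a whole
-- interval because the loads T/N met in the decay vary.
record Subcritical (α : ℝ) : Set where
  field
    a ρ   : ℚ
    K     : ℕ
    0≤a   : 0ℚ ≤ a
    a≤7/8 : a ≤ ℤ.+ 7 / 8
    0≤ρ   : 0ℚ ≤ ρ
    ρ<1   : ρ < 1ℚ
    bound : ∀ x → 0ℚ ≤ x → x ≤ a → fromℕ 4 * x ≤ ρ * expSum x K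
    load  : ∀ n m → .{{NonZero n}} → natᴿ m ≃ᴿ α *ᴿ natᴿ n → fromℕ m ≤ a * fromℕ n

subcritical-load : (α* : ℝ) → IsThreshold α* → (α : ℝ) → 0ᴿ ≤ᴿ α → α <ᴿ α* → Subcritical α
subcritical-load α* (_ , α*≤1 , root) α 0≤α (ε , 0<ε , N₁ , below) = record
  { a = a ; ρ = A.ρ ; K = k ; 0≤a = 0≤a ; a≤7/8 = A.a≤7/8 ; 0≤ρ = A.0≤ρ ; ρ<1 = A.ρ<1
  ; bound = A.subcritical ; load = load }
  where
  ⅛ε δ : ℚ
  ⅛ε = (ℤ.+ 1 / 8) * ε
  δ = (ℤ.+ 1 / 4) * ε
  0<⅛ε : 0ℚ < ⅛ε
  0<⅛ε = *-pos (<! {0ℚ} {ℤ.+ 1 / 8}) 0<ε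
  0<δ : 0ℚ < δ
  0<δ = *-pos (<! {0ℚ} {ℤ.+ 1 / 4}) 0<ε
  N₂ i₀ : ℕ
  N₂ = proj₁ (cauchy α ⅛ε 0<⅛ε)
  i₀ = N₁ ℕ.+ N₂
  -- Halfway between α and α*. From i₀ on α moves by less than ε/8, so a margin of at least δ = ε/4
  -- remains on both sides.
  a : ℚ
  a = seq α i₀ + ½ * ε

  near : ∀ k → i₀ ℕ.≤ k → ∣ seq α k - seq α i₀ ∣ < ⅛ε
  near k hk = proj₂ (cauchy α ⅛ε 0<⅛ε) k i₀ (ℕP.≤-trans (ℕP.m≤n+m N₂ N₁) hk) (ℕP.m≤n+m N₂ N₁)

  α+δ≤a : ∀ k → i₀ ℕ.≤ k → seq α k + δ ≤ a
  α+δ≤a k hk = ≤-by-difference ((seq α i₀ + ⅛ε - seq α k) + ⅛ε)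
    (p≤q⇒0≤q-p (ℚP.<⇒≤ (∣-∣<⇒< {seq α k} {seq α i₀} (near k hk))) ⊕ ℚP.<⇒≤ 0<⅛ε)
    (solve 3 (λ s t e → (s :+ con (ℤ.+ 1 / 4) :* e) :+ ((t :+ con (ℤ.+ 1 / 8) :* e :- s) :+ con (ℤ.+ 1 / 8) :* e) := t :+ con ½ :* e)
      refl (seq α k) (seq α i₀) ε)

  gap : ∀ k → i₀ ℕ.≤ k → δ ≤ seq α* k - a
  gap k hk = ≤-by-difference ((seq α* k - (seq α k + ε)) + (seq α k + ⅛ε - seq α i₀) + ⅛ε)
    (p≤q⇒0≤q-p (ℚP.<⇒≤ (below k (ℕP.≤-trans (ℕP.m≤m+n N₁ N₂) hk))) ⊕
     p≤q⇒0≤q-p (ℚP.<⇒≤ (∣-∣<⇒> {seq α k} {seq α i₀} (near k hk))) ⊕ ℚP.<⇒≤ 0<⅛ε)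
    (solve 4 (λ y s t e → con (ℤ.+ 1 / 4) :* e :+ ((y :- (s :+ e)) :+ (s :+ con (ℤ.+ 1 / 8) :* e :- t) :+ con (ℤ.+ 1 / 8) :* e) := y :- (t :+ con ½ :* e))
      refl (seq α* k) (seq α k) (seq α i₀) ε)

  0≤a : 0ℚ ≤ a
  0≤a = ℚP.≤-trans (ℚP.<⇒≤ (proj₂ (0≤α δ 0<δ) k₀ (ℕP.m≤n+m _ i₀))) (α+δ≤a k₀ (ℕP.m≤m+n i₀ _))
    where k₀ = i₀ ℕ.+ proj₁ (0≤α δ 0<δ)

  -- The second bound makes 80 η ≤ δ/4, half of the margin 4 δ (1 - 7/8) = δ/2 that the gap between
  -- a and y yields in `E-large`.
  tolerance : ∃ λ η → 0ℚ < η × η ≤ ℤ.+ 1 / 1000 × η ≤ (ℤ.+ 1 / 320) * δ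
  tolerance = smaller <! (*-pos (<! {0ℚ} {ℤ.+ 1 / 320}) 0<δ)

  η : ℚ
  η = proj₁ tolerance
  0<η : 0ℚ < η
  0<η = proj₁ (proj₂ tolerance)
  η≤ : η ≤ ℤ.+ 1 / 1000
  η≤ = proj₁ (proj₂ (proj₂ tolerance))

  N₃ N₄ N₅ k k-1 : ℕ
  N₃ = proj₁ (α*≤1 η 0<η)
  N₄ = proj₁ (root η 0<η)
  N₅ = proj₁ (expSum-*-limit (fromℕ 3) (fromℕ-nonNeg 3) η 0<η)
  k-1 = i₀ ℕ.+ (N₃ ℕ.+ (N₄ ℕ.+ N₅))
  -- A successor, so that the partial sums contain the term 1.
  k = suc k-1

  ≤k : ∀ {i} → i ℕ.≤ k-1 → i ℕ.≤ k
  ≤k h = ℕP.≤-trans h (ℕP.n≤1+n k-1)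
  i₀≤k : i₀ ℕ.≤ k
  i₀≤k = ≤k (ℕP.m≤m+n i₀ _)
  N₃≤k : N₃ ℕ.≤ k
  N₃≤k = ≤k (ℕP.≤-trans (ℕP.m≤m+n N₃ _) (ℕP.m≤n+m _ i₀))
  N₄≤k : N₄ ℕ.≤ k
  N₄≤k = ≤k (ℕP.≤-trans (ℕP.≤-trans (ℕP.m≤m+n N₄ _) (ℕP.m≤n+m _ N₃)) (ℕP.m≤n+m _ i₀))
  N₅≤k : N₅ ℕ.≤ k
  N₅≤k = ≤k (ℕP.≤-trans (ℕP.≤-trans (ℕP.m≤n+m N₅ N₄) (ℕP.m≤n+m _ N₃)) (ℕP.m≤n+m _ i₀))

  y : ℚ
  y = seq α* k

  y≤ : y ≤ 1ℚ + η
  y≤ = ℚP.<⇒≤ (proj₂ (α*≤1 η 0<η) k N₃≤k)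

  0≤y : 0ℚ ≤ y
  0≤y = ≤-by-difference ((y - a - δ) + a + δ) (p≤q⇒0≤q-p (gap k i₀≤k) ⊕ 0≤a ⊕ ℚP.<⇒≤ 0<δ)
    (solve 3 (λ y a δ → con 0ℚ :+ ((y :- a :- δ) :+ a :+ δ) := y) refl y a δ)

  size≤3 : ∣ 1ℚ - y ∣ + ∣ y ∣ ≤ fromℕ 3
  size≤3 = ≤-by-difference ((1ℚ - ∣ 1ℚ - y ∣) + (1ℚ + η - y) + (ℤ.+ 1 / 1000 - η) + ℤ.+ 999 / 1000)
    (p≤q⇒0≤q-p (≤⇒∣-∣≤ {1ℚ} {y} {1ℚ} 1≤y+1 y≤1+1) ⊕ p≤q⇒0≤q-p y≤ ⊕ p≤q⇒0≤q-p η≤ ⊕ ≤! {0ℚ} {ℤ.+ 999 / 1000})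
    (trans (cong (λ z → ∣ 1ℚ - y ∣ + z + ((1ℚ - ∣ 1ℚ - y ∣) + (1ℚ + η - y) + (ℤ.+ 1 / 1000 - η) + ℤ.+ 999 / 1000)) (ℚP.0≤p⇒∣p∣≡p 0≤y))
      (solve 3 (λ t y η → t :+ y :+ ((con 1ℚ :- t) :+ (con 1ℚ :+ η :- y) :+ (con (ℤ.+ 1 / 1000) :- η) :+ con (ℤ.+ 999 / 1000)) := con (fromℕ 3))
        refl ∣ 1ℚ - y ∣ y η))
    where
    1≤y+1 : 1ℚ ≤ y + 1ℚ
    1≤y+1 = subst (_≤ y + 1ℚ) (ℚP.+-identityˡ 1ℚ) (ℚP.+-monoˡ-≤ 1ℚ 0≤y)
    y≤1+1 : y ≤ 1ℚ + 1ℚ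
    y≤1+1 = ℚP.≤-trans y≤ (ℚP.+-monoʳ-≤ 1ℚ (ℚP.≤-trans η≤ (≤! {ℤ.+ 1 / 1000} {1ℚ})))

  module A = AtThreshold k-1 a y δ η 0≤a 0<δ 0<η (gap k i₀≤k) y≤ η≤ (proj₂ (proj₂ (proj₂ tolerance)))
    (subst (λ z → ∣ expSum (1ℚ - y) k * expSum y k - expSum z k ∣ < η) (solve 1 (λ y → (con 1ℚ :- y) :+ y := con 1ℚ) refl y)
      (proj₂ (expSum-*-limit (fromℕ 3) (fromℕ-nonNeg 3) η 0<η) k N₅≤k (1ℚ - y) y size≤3))
    (proj₂ (root η 0<η) k N₄≤k)

  load : ∀ n m → .{{NonZero n}} → natᴿ m ≃ᴿ α *ᴿ natᴿ n → fromℕ m ≤ a * fromℕ n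
  load n@(suc _) m eq = begin
    fromℕ m                              ≤⟨ ℚP.<⇒≤ (∣-∣<⇒< {fromℕ m} {seq α j * fromℕ n} (proj₂ (eq δ 0<δ) j (ℕP.m≤n+m _ i₀))) ⟩
    -- As n ≥ 1, the error δ is at most δ n and is absorbed by the margin between α and a.
    seq α j * fromℕ n + δ                ≤⟨ ℚP.+-monoʳ-≤ (seq α j * fromℕ n) (subst (_≤ δ * fromℕ n) (ℚP.*-identityʳ δ) (*-monoˡ δ (ℚP.<⇒≤ 0<δ) (fromℕ-mono (s≤s (z≤n {ℕ.pred n}))))) ⟩
    seq α j * fromℕ n + δ * fromℕ n      ≡⟨ sym (ℚP.*-distribʳ-+ (fromℕ n) (seq α j) δ) ⟩
    (seq α j + δ) * fromℕ n              ≤⟨ *-monoʳ (fromℕ n) (fromℕ-nonNeg n) (α+δ≤a j (ℕP.m≤m+n i₀ _)) ⟩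
    a * fromℕ n                          ∎
    where
    open ℚP.≤-Reasoning
    j = i₀ ℕ.+ proj₁ (eq δ 0<δ)

-- Decay of the component sizes

fromℕ-* : ∀ m n → fromℕ (m ℕ.* n) ≡ fromℕ m * fromℕ n
fromℕ-* zero    n = sym (ℚP.*-zeroˡ (fromℕ n))
fromℕ-* (suc m) n = trans (/-+ n (m ℕ.* n) 1) (trans (cong (λ x → fromℕ n + x) (fromℕ-* m n))
  (trans (solve 2 (λ n m → n :+ m :* n := (m :+ con 1ℚ) :* n) refl (fromℕ n) (fromℕ m)) (cong (_* fromℕ n) (sym (fromℕ-suc m)))))

fromℕ-^ : ∀ n k → fromℕ (n ℕ.^ k) ≡ fromℕ n ^ k
fromℕ-^ n zero    = refl
fromℕ-^ n (suc k) = trans (fromℕ-* n (n ℕ.^ k)) (cong (fromℕ n *_) (fromℕ-^ n k))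

/-*-fromℕ : ∀ a b .{{_ : NonZero b}} → (ℤ.+ a / b) * fromℕ b ≡ fromℕ a
/-*-fromℕ a b = trans (cong (_* fromℕ b) (split a)) (trans (ℚP.*-assoc (fromℕ a) _ _)
  (trans (cong (fromℕ a *_) (trans (ℚP.*-comm (ℤ.+ 1 / b) (fromℕ b)) unit)) (ℚP.*-identityʳ (fromℕ a))))
  where
  unit : fromℕ b * (ℤ.+ 1 / b) ≡ 1ℚ
  unit = subst (λ k → .{{_ : NonZero k}} → fromℕ b * (ℤ.+ 1 / k) ≡ 1ℚ) (ℕP.*-identityʳ b) (/-cancel b 1)
  split : ∀ a → ℤ.+ a / b ≡ fromℕ a * (ℤ.+ 1 / b)
  split zero    = trans (ℚP.0/n≡0 b) (sym (ℚP.*-zeroˡ (ℤ.+ 1 / b)))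
  split (suc a) = trans (/-+ 1 a b) (trans (cong (λ x → ℤ.+ 1 / b + x) (split a))
    (trans (solve 2 (λ u a → u :+ a :* u := (a :+ con 1ℚ) :* u) refl (ℤ.+ 1 / b) (fromℕ a)) (cong (_* (ℤ.+ 1 / b)) (sym (fromℕ-suc a)))))

*-^ : ∀ x y k → (x * y) ^ k ≡ x ^ k * y ^ k
*-^ x y zero    = refl
*-^ x y (suc k) = trans (cong (x * y *_) (*-^ x y k))
  (solve 4 (λ x y p q → (x :* y) :* (p :* q) := (x :* p) :* (y :* q)) refl x y (x ^ k) (y ^ k))

∑Antidiagonal-≤-partialSum : ∀ t (u : ℕ → ℕ → ℕ) (c : ℕ → ℚ) → (∀ i j → i ℕ.+ j ≡ t → fromℕ (u i j) ≤ c i) → fromℕ (∑Antidiagonal t u) ≤ partialSum c (suc t)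
∑Antidiagonal-≤-partialSum zero    u c h = ℚP.≤-trans (h 0 0 refl) (ℚP.≤-reflexive (sym (ℚP.+-identityˡ (c 0))))
∑Antidiagonal-≤-partialSum (suc t) u c h = ℚP.≤-trans (ℚP.≤-reflexive (/-+ (u 0 (suc t)) _ 1))
  (ℚP.≤-trans (ℚP.+-mono-≤ (h 0 (suc t) refl) (∑Antidiagonal-≤-partialSum t (λ i j → u (suc i) j) (c ∘ suc) λ i j e → h (suc i) j (cong suc e)))
    (ℚP.≤-reflexive (sym (partialSum-head c (suc t)))))

module Geometric (ρ : ℚ) (0≤ρ : 0ℚ ≤ ρ) (ρ≤1 : ρ ≤ 1ℚ) where

  0≤1-ρ : 0ℚ ≤ 1ℚ - ρ
  0≤1-ρ = p≤q⇒0≤q-p ρ≤1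

  geometric : ∀ k → partialSum (ρ ^_) k * (1ℚ - ρ) + ρ ^ k ≡ 1ℚ
  geometric zero    = solve 1 (λ r → con 0ℚ :* r :+ con 1ℚ := con 1ℚ) refl (1ℚ - ρ)
  geometric (suc k) = trans
    (solve 3 (λ s p r → (s :+ p) :* (con 1ℚ :- r) :+ r :* p := s :* (con 1ℚ :- r) :+ p) refl (partialSum (ρ ^_) k) (ρ ^ k) ρ)
    (geometric k)

  geometric-≤ : ∀ k → partialSum (ρ ^_) k * (1ℚ - ρ) ≤ 1ℚ
  geometric-≤ k = ≤-by-difference (ρ ^ k) (^-nonNeg 0≤ρ k) (geometric k)

  arithmetic : ∀ k → partialSum (λ i → fromℕ (suc i) * ρ ^ i) k * (1ℚ - ρ) + fromℕ k * ρ ^ k ≡ partialSum (ρ ^_) k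
  arithmetic zero    = solve 1 (λ r → con 0ℚ :* r :+ con 0ℚ :* con 1ℚ := con 0ℚ) refl (1ℚ - ρ)
  arithmetic (suc k) = trans
    (cong (λ x → (partialSum (λ i → fromℕ (suc i) * ρ ^ i) k + x * ρ ^ k) * (1ℚ - ρ) + x * (ρ * ρ ^ k)) (fromℕ-suc k))
    (trans (solve 4 (λ s p r n → (s :+ (n :+ con 1ℚ) :* p) :* (con 1ℚ :- r) :+ (n :+ con 1ℚ) :* (r :* p) := (s :* (con 1ℚ :- r) :+ n :* p) :+ p)
             refl (partialSum (λ i → fromℕ (suc i) * ρ ^ i) k) (ρ ^ k) ρ (fromℕ k))
      (cong (_+ ρ ^ k) (arithmetic k)))

  arithmetic-≤ : ∀ k → partialSum (λ i → fromℕ (suc i) * ρ ^ i) k * (1ℚ - ρ) * (1ℚ - ρ) ≤ 1ℚ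
  arithmetic-≤ k = ℚP.≤-trans
    (*-monoʳ (1ℚ - ρ) 0≤1-ρ (≤-by-difference {partialSum (λ i → fromℕ (suc i) * ρ ^ i) k * (1ℚ - ρ)} (fromℕ k * ρ ^ k) (fromℕ-nonNeg k ⊗ ^-nonNeg 0≤ρ k) (arithmetic k)))
    (geometric-≤ k)

  tail-≤ : ∀ κ k → partialSum (λ i → fromℕ (𝟙 (κ ℕ.<ᵇ i)) * ρ ^ i) k * (1ℚ - ρ) ≤ ρ ^ suc κ
  tail-≤ κ       zero    = subst (_≤ ρ ^ suc κ) (sym (ℚP.*-zeroˡ (1ℚ - ρ))) (^-nonNeg 0≤ρ (suc κ))
  tail-≤ zero    (suc k) = begin
    partialSum (λ i → fromℕ (𝟙 (0 ℕ.<ᵇ i)) * ρ ^ i) (suc k) * (1ℚ - ρ)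
      ≡⟨ cong (_* (1ℚ - ρ)) (trans (partialSum-head (λ i → fromℕ (𝟙 (0 ℕ.<ᵇ i)) * ρ ^ i) k)
           (cong (0ℚ * 1ℚ +_) (trans (partialSum-cong (λ i → ℚP.*-identityˡ _) k) (partialSum-* ρ (ρ ^_) k)))) ⟩
    (0ℚ * 1ℚ + ρ * partialSum (ρ ^_) k) * (1ℚ - ρ)
      ≡⟨ solve 2 (λ r s → (con 0ℚ :* con 1ℚ :+ r :* s) :* (con 1ℚ :- r) := r :* (s :* (con 1ℚ :- r))) refl ρ (partialSum (ρ ^_) k) ⟩
    ρ * (partialSum (ρ ^_) k * (1ℚ - ρ)) ≤⟨ *-monoˡ ρ 0≤ρ (geometric-≤ k) ⟩
    ρ * 1ℚ ∎
    where
    open ℚP.≤-Reasoning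
  tail-≤ (suc κ) (suc k) = begin
    partialSum (λ i → fromℕ (𝟙 (suc κ ℕ.<ᵇ i)) * ρ ^ i) (suc k) * (1ℚ - ρ)
      ≡⟨ cong (_* (1ℚ - ρ)) (trans (partialSum-head (λ i → fromℕ (𝟙 (suc κ ℕ.<ᵇ i)) * ρ ^ i) k)
           (cong (0ℚ * 1ℚ +_) (trans (partialSum-cong (λ i → solve 3 (λ a r p → a :* (r :* p) := r :* (a :* p)) refl (fromℕ (𝟙 (κ ℕ.<ᵇ i))) ρ (ρ ^ i)) k)
                                     (partialSum-* ρ (λ i → fromℕ (𝟙 (κ ℕ.<ᵇ i)) * ρ ^ i) k)))) ⟩
    (0ℚ * 1ℚ + ρ * s) * (1ℚ - ρ)
      ≡⟨ solve 2 (λ r s → (con 0ℚ :* con 1ℚ :+ r :* s) :* (con 1ℚ :- r) := r :* (s :* (con 1ℚ :- r))) refl ρ s ⟩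
    ρ * (s * (1ℚ - ρ)) ≤⟨ *-monoˡ ρ 0≤ρ (tail-≤ κ k) ⟩
    ρ * ρ ^ suc κ ∎
    where
    open ℚP.≤-Reasoning
    s = partialSum (λ i → fromℕ (𝟙 (κ ℕ.<ᵇ i)) * ρ ^ i) k

module Decay {α : ℝ} (S : Subcritical α) where

  open Subcritical S

  a≤1 : a ≤ 1ℚ
  a≤1 = ℚP.≤-trans a≤7/8 ≤!

  -- From 4 x ≤ ρ exp x at x = T/N and exp (T/N) ≤ (1 - 1/N)^(- T).
  critical-step : ∀ N T → fromℕ T ≤ a * fromℕ (suc N) → fromℕ 4 * fromℕ T * fromℕ N ^ T ≤ ρ * fromℕ (suc N) ^ suc T
  critical-step N T h = begin
    fromℕ 4 * fromℕ T * fromℕ N ^ T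
      ≡⟨ cong (λ x → fromℕ 4 * fromℕ T * x ^ T) (sym [1-u]Ñ) ⟩
    fromℕ 4 * fromℕ T * ((1ℚ - u) * Ñ) ^ T
      ≡⟨ cong (fromℕ 4 * fromℕ T *_) (*-^ (1ℚ - u) Ñ T) ⟩
    fromℕ 4 * fromℕ T * (p * Ñ ^ T)
      ≡⟨ trans (sym (ℚP.*-identityˡ _)) (trans (cong (_* (fromℕ 4 * fromℕ T * (p * Ñ ^ T))) (sym (*-inv Ñ 0<Ñ)))
           (solve 6 (λ n u f t p q → (n :* u) :* (f :* t :* (p :* q)) := (f :* (t :* u)) :* p :* (n :* q)) refl Ñ u (fromℕ 4) (fromℕ T) p (Ñ ^ T))) ⟩
    fromℕ 4 * x * p * Ñ ^ suc T
      ≤⟨ *-monoʳ (Ñ ^ suc T) (^-nonNeg (ℚP.<⇒≤ 0<Ñ) (suc T)) (*-monoʳ p 0≤p (bound x (fromℕ-nonNeg T ⊗ 0≤u) x≤a)) ⟩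
    ρ * expSum x K * p * Ñ ^ suc T
      ≡⟨ cong (_* Ñ ^ suc T) (ℚP.*-assoc ρ (expSum x K) p) ⟩
    ρ * (expSum x K * p) * Ñ ^ suc T
      ≤⟨ *-monoʳ (Ñ ^ suc T) (^-nonNeg (ℚP.<⇒≤ 0<Ñ) (suc T)) (*-monoˡ ρ 0≤ρ (expSum-power 0≤u u≤1 T K)) ⟩
    ρ * 1ℚ * Ñ ^ suc T
      ≡⟨ cong (_* Ñ ^ suc T) (ℚP.*-identityʳ ρ) ⟩
    ρ * Ñ ^ suc T ∎
    where
    open ℚP.≤-Reasoning
    Ñ u x p : ℚ
    Ñ = fromℕ (suc N)
    0<Ñ : 0ℚ < Ñ
    0<Ñ = fromℕ-suc-pos N
    u = inv Ñ 0<Ñ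
    x = fromℕ T * u
    p = (1ℚ - u) ^ T
    0≤u : 0ℚ ≤ u
    0≤u = ℚP.<⇒≤ (inv-pos Ñ 0<Ñ)
    u≤1 : u ≤ 1ℚ
    u≤1 = subst₂ _≤_ (ℚP.*-identityˡ u) (*-inv Ñ 0<Ñ) (*-monoʳ u 0≤u (fromℕ-mono (s≤s (z≤n {N}))))
    0≤p : 0ℚ ≤ p
    0≤p = ^-nonNeg (p≤q⇒0≤q-p u≤1) T
    x≤a : x ≤ a
    x≤a = subst (x ≤_) (trans (ℚP.*-assoc a Ñ u) (trans (cong (a *_) (*-inv Ñ 0<Ñ)) (ℚP.*-identityʳ a))) (*-monoʳ u 0≤u h)
    [1-u]Ñ : (1ℚ - u) * Ñ ≡ fromℕ N
    [1-u]Ñ = trans (solve 2 (λ u n → (con 1ℚ :- u) :* n := n :- n :* u) refl u Ñ)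
      (trans (cong₂ _-_ (fromℕ-suc N) (*-inv Ñ 0<Ñ)) (solve 1 (λ n → (n :+ con 1ℚ) :- con 1ℚ := n) refl (fromℕ N)))

  -- fallingTerm i j = 4^i (i + j)! / j!
  fallingTerm : ℕ → ℕ → ℚ
  fallingTerm i j = fromℕ (choose i j ℕ.* i !) * fromℕ (4 ℕ.^ i)

  fallingTerm-suc : ∀ i j → fallingTerm (suc i) j ≡ fallingTerm i (suc j) * (fromℕ 4 * fromℕ (suc j))
  fallingTerm-suc i j = trans
    (cong₂ _*_ (trans (cong fromℕ (choose-!-shift i j)) (fromℕ-* (suc j) (choose i (suc j) ℕ.* i !))) (fromℕ-* 4 (4 ℕ.^ i)))
    (solve 4 (λ s c f p → (s :* c) :* (f :* p) := (c :* p) :* (f :* s)) refl (fromℕ (suc j)) (fromℕ (choose i (suc j) ℕ.* i !)) (fromℕ 4) (fromℕ (4 ℕ.^ i)))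

  fallingTerm-nonNeg : ∀ i j → 0ℚ ≤ fallingTerm i j
  fallingTerm-nonNeg i j = fromℕ-nonNeg (choose i j ℕ.* i !) ⊗ fromℕ-nonNeg (4 ℕ.^ i)

  -- N stands for n - i. Replacing `suc i , j , N` by `i , suc j , suc N` keeps the number of keys
  -- and the number of slots, and costs a factor ρ by `critical-step`. The exponent of N is `suc j`,
  -- one more than the number of outside keys, to match the homogeneous form of that step.
  decay : ∀ i j N → fromℕ (i ℕ.+ j) ≤ a * fromℕ (N ℕ.+ i) →
          fallingTerm i j * fromℕ N ^ suc j ≤ ρ ^ i * fromℕ (N ℕ.+ i) ^ suc (i ℕ.+ j)
  decay zero    j N h = ℚP.≤-reflexive (trans (cong (λ n → 1ℚ * 1ℚ * fromℕ n ^ suc j) (sym (ℕP.+-identityʳ N)))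
    (cong (_* fromℕ (N ℕ.+ 0) ^ suc j) (ℚP.*-identityʳ 1ℚ)))
  decay (suc i) j N h = begin
    fallingTerm (suc i) j * fromℕ N ^ suc j
      ≡⟨ trans (cong (_* fromℕ N ^ suc j) (fallingTerm-suc i j)) (ℚP.*-assoc (fallingTerm i (suc j)) _ _) ⟩
    fallingTerm i (suc j) * (fromℕ 4 * fromℕ (suc j) * fromℕ N ^ suc j)
      ≤⟨ *-monoˡ (fallingTerm i (suc j)) (fallingTerm-nonNeg i (suc j)) (critical-step N (suc j) j≤) ⟩
    fallingTerm i (suc j) * (ρ * fromℕ (suc N) ^ suc (suc j))
      ≡⟨ solve 3 (λ f r p → f :* (r :* p) := r :* (f :* p)) refl (fallingTerm i (suc j)) ρ _ ⟩
    ρ * (fallingTerm i (suc j) * fromℕ (suc N) ^ suc (suc j))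
      ≤⟨ *-monoˡ ρ 0≤ρ (decay i (suc j) (suc N) h′) ⟩
    ρ * (ρ ^ i * fromℕ (suc N ℕ.+ i) ^ suc (i ℕ.+ suc j))
      ≡⟨ trans (sym (ℚP.*-assoc ρ (ρ ^ i) _)) (cong₂ (λ x y → ρ ^ suc i * fromℕ x ^ suc y) (sym (ℕP.+-suc N i)) (ℕP.+-suc i j)) ⟩
    ρ ^ suc i * fromℕ (N ℕ.+ suc i) ^ suc (suc i ℕ.+ j) ∎
    where
    open ℚP.≤-Reasoning
    h′ : fromℕ (i ℕ.+ suc j) ≤ a * fromℕ (suc N ℕ.+ i)
    h′ = subst₂ (λ x y → fromℕ x ≤ a * fromℕ y) (sym (ℕP.+-suc i j)) (ℕP.+-suc N i) h
    -- Removing i keys together with i slots does not raise the load above a, because a ≤ 1.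
    j≤ : fromℕ (suc j) ≤ a * fromℕ (suc N)
    j≤ = ≤-by-difference ((a * fromℕ (suc N ℕ.+ i) - fromℕ (i ℕ.+ suc j)) + (1ℚ - a) * fromℕ i)
      (p≤q⇒0≤q-p h′ ⊕ p≤q⇒0≤q-p a≤1 ⊗ fromℕ-nonNeg i)
      (trans (cong₂ (λ x y → fromℕ (suc j) + ((a * x - y) + (1ℚ - a) * fromℕ i)) (/-+ (suc N) i 1) (/-+ i (suc j) 1))
        (solve 4 (λ j a n i → j :+ ((a :* (n :+ i) :- (i :+ j)) :+ (con 1ℚ :- a) :* i) := a :* n) refl (fromℕ (suc j)) a (fromℕ (suc N)) (fromℕ i)))

  -- The constant is 16 = 2 · 8: 2 comes from the Catalan bound 2 · 4^i, and 8 from n ≤ 8 (n - i),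
  -- as i ≤ 7 n/8. The latter supplies the extra factor n - i that `decay` requires.
  term-≤ : ∀ (ψ : ℕ → ℕ) i j n → fromℕ (i ℕ.+ j) ≤ a * fromℕ n →
           fromℕ (n ℕ.* (choose i j ℕ.* i ! ℕ.* (ψ i ℕ.* catalan i ℕ.* (n ∸ i) ℕ.^ j))) ≤
           fromℕ 16 * fromℕ n ^ suc (i ℕ.+ j) * (fromℕ (ψ i) * ρ ^ i)
  term-≤ ψ i j n h = begin
    fromℕ (n ℕ.* (f ℕ.* (ψ i ℕ.* catalan i ℕ.* N ℕ.^ j)))
      ≤⟨ fromℕ-mono (ℕP.*-monoʳ-≤ n (ℕP.*-monoʳ-≤ f (ℕP.*-monoˡ-≤ (N ℕ.^ j) (ℕP.*-monoʳ-≤ (ψ i) (ballot-≤ 1 i))))) ⟩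
    fromℕ (n ℕ.* (f ℕ.* (ψ i ℕ.* (4 ℕ.^ i ℕ.* 2) ℕ.* N ℕ.^ j)))
      ≡⟨ trans (fromℕ-* n _) (cong (fromℕ n *_) (trans (fromℕ-* f _) (cong (fromℕ f *_) (trans (fromℕ-* (ψ i ℕ.* (4 ℕ.^ i ℕ.* 2)) (N ℕ.^ j))
           (cong₂ _*_ (trans (fromℕ-* (ψ i) _) (cong (fromℕ (ψ i) *_) (fromℕ-* (4 ℕ.^ i) 2))) (fromℕ-^ N j)))))) ⟩
    fromℕ n * (fromℕ f * (fromℕ (ψ i) * (fromℕ (4 ℕ.^ i) * fromℕ 2) * fromℕ N ^ j))
      ≡⟨ solve 6 (λ n f s g t p → n :* (f :* (s :* (g :* t) :* p)) := n :* (t :* s :* (f :* g) :* p)) refl (fromℕ n) (fromℕ f) (fromℕ (ψ i)) (fromℕ (4 ℕ.^ i)) (fromℕ 2) (fromℕ N ^ j) ⟩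
    fromℕ n * (fromℕ 2 * fromℕ (ψ i) * fallingTerm i j * fromℕ N ^ j)
      ≤⟨ *-monoʳ _ (fromℕ-nonNeg 2 ⊗ fromℕ-nonNeg (ψ i) ⊗ fallingTerm-nonNeg i j ⊗ ^-nonNeg (fromℕ-nonNeg N) j) n≤8N ⟩
    fromℕ 8 * fromℕ N * (fromℕ 2 * fromℕ (ψ i) * fallingTerm i j * fromℕ N ^ j)
      ≡⟨ solve 6 (λ e n t s f p → e :* n :* (t :* s :* f :* p) := (e :* t :* s) :* (f :* (n :* p))) refl (fromℕ 8) (fromℕ N) (fromℕ 2) (fromℕ (ψ i)) (fallingTerm i j) (fromℕ N ^ j) ⟩
    fromℕ 8 * fromℕ 2 * fromℕ (ψ i) * (fallingTerm i j * fromℕ N ^ suc j)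
      ≤⟨ *-monoˡ _ (fromℕ-nonNeg 8 ⊗ fromℕ-nonNeg 2 ⊗ fromℕ-nonNeg (ψ i))
           (subst (λ n → fallingTerm i j * fromℕ N ^ suc j ≤ ρ ^ i * fromℕ n ^ suc (i ℕ.+ j)) N+i
             (decay i j N (subst (λ n → fromℕ (i ℕ.+ j) ≤ a * fromℕ n) (sym N+i) h))) ⟩
    fromℕ 8 * fromℕ 2 * fromℕ (ψ i) * (ρ ^ i * fromℕ n ^ suc (i ℕ.+ j))
      ≡⟨ solve 3 (λ s r p → con (fromℕ 8) :* con (fromℕ 2) :* s :* (r :* p) := con (fromℕ 16) :* p :* (s :* r)) refl (fromℕ (ψ i)) (ρ ^ i) (fromℕ n ^ suc (i ℕ.+ j)) ⟩
    fromℕ 16 * fromℕ n ^ suc (i ℕ.+ j) * (fromℕ (ψ i) * ρ ^ i) ∎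
    where
    open ℚP.≤-Reasoning
    f N : ℕ
    f = choose i j ℕ.* i !
    N = n ∸ i
    fi≤ : fromℕ i ≤ (ℤ.+ 7 / 8) * fromℕ n
    fi≤ = ℚP.≤-trans (fromℕ-mono (ℕP.m≤m+n i j)) (ℚP.≤-trans h (*-monoʳ (fromℕ n) (fromℕ-nonNeg n) a≤7/8))
    i≤n : i ℕ.≤ n
    i≤n with i ℕP.≤? n
    ... | yes p = p
    ... | no ¬p = ⊥-elim (≤<-absurd (ℚP.≤-trans fi≤ (subst ((ℤ.+ 7 / 8) * fromℕ n ≤_) (ℚP.*-identityˡ (fromℕ n)) (*-monoʳ (fromℕ n) (fromℕ-nonNeg n) (≤! {ℤ.+ 7 / 8} {1ℚ}))))
        (ℚP.<-≤-trans (subst (fromℕ n <_) (sym (fromℕ-suc n)) (subst (_< fromℕ n + 1ℚ) (ℚP.+-identityʳ (fromℕ n)) (ℚP.+-monoʳ-< (fromℕ n) 0<1))) (fromℕ-mono (ℕP.≰⇒> ¬p))))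
    N+i : N ℕ.+ i ≡ n
    N+i = ℕP.m∸n+n≡m i≤n
    n≤8N : fromℕ n ≤ fromℕ 8 * fromℕ N
    n≤8N = ≤-by-difference (fromℕ 8 * ((ℤ.+ 7 / 8) * fromℕ n - fromℕ i)) (fromℕ-nonNeg 8 ⊗ p≤q⇒0≤q-p fi≤)
      (trans (cong (λ x → x + fromℕ 8 * ((ℤ.+ 7 / 8) * x - fromℕ i)) n≡)
        (solve 2 (λ m i → (m :+ i) :+ con (fromℕ 8) :* (con (ℤ.+ 7 / 8) :* (m :+ i) :- i) := con (fromℕ 8) :* m) refl (fromℕ N) (fromℕ i)))
      where
      n≡ : fromℕ n ≡ fromℕ N + fromℕ i
      n≡ = trans (cong fromℕ (sym N+i)) (/-+ N i 1)

  ∑Antidiagonal-≤ : ∀ (ψ : ℕ → ℕ) t n → fromℕ t ≤ a * fromℕ n →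
           fromℕ (n ℕ.* ∑Antidiagonal t (λ i j → choose i j ℕ.* i ! ℕ.* (ψ i ℕ.* catalan i ℕ.* (n ∸ i) ℕ.^ j))) ≤
           fromℕ 16 * fromℕ n ^ suc t * partialSum (λ i → fromℕ (ψ i) * ρ ^ i) (suc t)
  ∑Antidiagonal-≤ ψ t n h = ℚP.≤-trans (ℚP.≤-reflexive (cong fromℕ (sym (∑Antidiagonal-* t n _))))
    (ℚP.≤-trans (∑Antidiagonal-≤-partialSum t _ (λ i → fromℕ 16 * fromℕ n ^ suc t * (fromℕ (ψ i) * ρ ^ i)) term)
      (ℚP.≤-reflexive (partialSum-* (fromℕ 16 * fromℕ n ^ suc t) (λ i → fromℕ (ψ i) * ρ ^ i) (suc t))))
    where
    term : ∀ i j → i ℕ.+ j ≡ t → fromℕ (n ℕ.* (choose i j ℕ.* i ! ℕ.* (ψ i ℕ.* catalan i ℕ.* (n ∸ i) ℕ.^ j))) ≤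
           fromℕ 16 * fromℕ n ^ suc t * (fromℕ (ψ i) * ρ ^ i)
    term i j refl = term-≤ ψ i j n h

-- The failure probability and the expected cost

-- Because exp y ≤ (1 - c)^(- k).
exp-neg-≥ : ∀ c → 0ℚ ≤ c → c ≤ 1ℚ → ∀ k η → 0ℚ < η →
            ∃ λ N → ∀ i → N ℕ.≤ i → ∀ y → 0ℚ ≤ y → y ≤ fromℕ k * c → (1ℚ - c) ^ k ≤ expSum (- y) i + η
exp-neg-≥ c 0≤c c≤1 k η 0<η = suc N , bound
  where
  B : ℚ
  B = fromℕ k * c + fromℕ k * c
  limit = expSum-*-limit B ((fromℕ-nonNeg k ⊗ 0≤c) ⊕ (fromℕ-nonNeg k ⊗ 0≤c)) η 0<η
  N : ℕ
  N = proj₁ limit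
  bound : ∀ i → suc N ℕ.≤ i → ∀ y → 0ℚ ≤ y → y ≤ fromℕ k * c → (1ℚ - c) ^ k ≤ expSum (- y) i + η
  bound i@(suc i-1) hi y 0≤y y≤ = ℚP.≮⇒≥ λ h → ≤<-absurd (absurd (ℚP.<⇒≤ h)) (∣-∣<⇒> {expSum (- y) i * p} {expSum (- y + y) i} close)
    where
    p X : ℚ
    p = expSum y i
    X = (1ℚ - c) ^ k
    1≤p : 1ℚ ≤ p
    1≤p = expSum-≥1 0≤y i-1
    pX≤1 : p * X ≤ 1ℚ
    pX≤1 = ℚP.≤-trans (*-monoʳ X (^-nonNeg (p≤q⇒0≤q-p c≤1) k) (expSum-mono 0≤y y≤ i)) (expSum-power 0≤c c≤1 k i)
    close : ∣ expSum (- y) i * p - expSum (- y + y) i ∣ < η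
    close = proj₂ limit i (ℕP.≤-trans (ℕP.n≤1+n N) hi) (- y) y
      (subst (_≤ B) (sym (cong₂ _+_ (trans (ℚP.∣-p∣≡∣p∣ y) (ℚP.0≤p⇒∣p∣≡p 0≤y)) (ℚP.0≤p⇒∣p∣≡p 0≤y))) (ℚP.+-mono-≤ y≤ y≤))
    absurd : expSum (- y) i + η ≤ X → expSum (- y) i * p + η ≤ expSum (- y + y) i
    absurd h = ℚP.≤-trans
      (≤-by-difference (p * (X - (expSum (- y) i + η)) + (1ℚ - p * X) + (p - 1ℚ) * η)
        (ℚP.≤-trans 0≤1 1≤p ⊗ p≤q⇒0≤q-p h ⊕ p≤q⇒0≤q-p pX≤1 ⊕ p≤q⇒0≤q-p 1≤p ⊗ ℚP.<⇒≤ 0<η)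
        (solve 4 (λ q p X η → q :* p :+ η :+ (p :* (X :- (q :+ η)) :+ (con 1ℚ :- p :* X) :+ (p :- con 1ℚ) :* η) := con 1ℚ) refl (expSum (- y) i) p X η))
      (expSum-≥1 (ℚP.≤-reflexive (sym (ℚP.+-inverseˡ y))) i-1)

√-approx-≤ : ∀ n k → n ℕ.≤ k ℕ.* k → ∀ i → √-approx n i ≤ fromℕ k
√-approx-≤ n k h i = /-mono-≤ j (suc i) k 1
  (subst (ℕ._≤ k ℕ.* suc i) (sym (ℕP.*-identityʳ j)) (SqrtLemmas.square-cancel j (k ℕ.* suc i)
    (ℕP.≤-trans (proj₁ (isqrt-spec (n ℕ.* (suc i ℕ.* suc i))))
      (ℕP.≤-trans (ℕP.*-monoˡ-≤ (suc i ℕ.* suc i) h) (ℕP.≤-reflexive (sym (SqrtLemmas.swap-squares k (suc i))))))))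
  where j = isqrt (n ℕ.* (suc i ℕ.* suc i))

module Assembly {α : ℝ} (S : Subcritical α) where

  open Subcritical S
  open Decay S
  open Geometric ρ 0≤ρ (ℚP.<⇒≤ ρ<1)

  0<1-ρ : 0ℚ < 1ℚ - ρ
  0<1-ρ = subst (_< 1ℚ - ρ) (ℚP.+-inverseʳ ρ) (ℚP.+-monoˡ-< (- ρ) ρ<1)

  -- c is chosen so that ρ ≤ (1 - c)^4, which leaves room for the factor n ≤ k² of the union bound.
  r c τ D C : ℚ
  r = inv (1ℚ - ρ) 0<1-ρ
  c = (ℤ.+ 1 / 4) * (1ℚ - ρ)
  τ = 1ℚ - c
  D = fromℕ 32 * r
  C = fromℕ 32 * (r * r)

  0<r : 0ℚ < r
  0<r = inv-pos (1ℚ - ρ) 0<1-ρ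

  0≤r : 0ℚ ≤ r
  0≤r = ℚP.<⇒≤ 0<r

  0≤D : 0ℚ ≤ D
  0≤D = fromℕ-nonNeg 32 ⊗ 0≤r

  0<C : 0ℚ < C
  0<C = *-pos (<! {0ℚ} {fromℕ 32}) (*-pos 0<r 0<r)

  0<c : 0ℚ < c
  0<c = *-pos (<! {0ℚ} {ℤ.+ 1 / 4}) 0<1-ρ

  0≤c : 0ℚ ≤ c
  0≤c = ℚP.<⇒≤ 0<c

  c≤1 : c ≤ 1ℚ
  c≤1 = ≤-by-difference ((ℤ.+ 1 / 4) * ρ + ℤ.+ 3 / 4) (≤! {0ℚ} {ℤ.+ 1 / 4} ⊗ 0≤ρ ⊕ ≤! {0ℚ} {ℤ.+ 3 / 4})
    (solve 1 (λ ρ → con (ℤ.+ 1 / 4) :* (con 1ℚ :- ρ) :+ (con (ℤ.+ 1 / 4) :* ρ :+ con (ℤ.+ 3 / 4)) := con 1ℚ) refl ρ)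

  0≤τ : 0ℚ ≤ τ
  0≤τ = p≤q⇒0≤q-p c≤1

  -- Each step multiplies by at most 1, as (1 + (k + 1) c) (1 - c) ≤ 1 + k c. It provides k c τ^k ≤
  -- 1, so that a power of τ absorbs a factor k.
  bernoulli : ∀ k → (1ℚ + fromℕ k * c) * τ ^ k ≤ 1ℚ
  bernoulli zero    = ℚP.≤-reflexive (solve 1 (λ c → (con 1ℚ :+ con 0ℚ :* c) :* con 1ℚ := con 1ℚ) refl c)
  bernoulli (suc k) = ℚP.≤-trans
    (≤-by-difference ((fromℕ k + 1ℚ) * c * c * τ ^ k) ((fromℕ-nonNeg k ⊕ 0≤1) ⊗ 0≤c ⊗ 0≤c ⊗ ^-nonNeg 0≤τ k)
      (trans (cong (λ x → (1ℚ + x * c) * (τ * τ ^ k) + (fromℕ k + 1ℚ) * c * c * τ ^ k) (fromℕ-suc k))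
        (solve 3 (λ k c p → (con 1ℚ :+ (k :+ con 1ℚ) :* c) :* ((con 1ℚ :- c) :* p) :+ (k :+ con 1ℚ) :* c :* c :* p := (con 1ℚ :+ k :* c) :* p)
          refl (fromℕ k) c (τ ^ k))))
    (bernoulli k)

  ρ^k≤τ^4k : ∀ k → ρ ^ k ≤ τ ^ k * τ ^ k * (τ ^ k * τ ^ k)
  ρ^k≤τ^4k zero    = ≤!
  ρ^k≤τ^4k (suc k) = ℚP.≤-trans
    (*-mono 0≤ρ (0≤X ⊗ 0≤X ⊗ (0≤X ⊗ 0≤X)) ρ≤τ⁴ (ρ^k≤τ^4k k))
    (ℚP.≤-reflexive (solve 2 (λ t x → (t :* t :* (t :* t)) :* (x :* x :* (x :* x)) := (t :* x) :* (t :* x) :* ((t :* x) :* (t :* x))) refl τ (τ ^ k)))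
    where
    0≤X : 0ℚ ≤ τ ^ k
    0≤X = ^-nonNeg 0≤τ k
    ρ≤τ⁴ : ρ ≤ τ * τ * (τ * τ)
    ρ≤τ⁴ = ≤-by-difference (c * c * (fromℕ 2 + fromℕ 4 * (1ℚ - c) + c * c))
      (0≤c ⊗ 0≤c ⊗ (fromℕ-nonNeg 2 ⊕ fromℕ-nonNeg 4 ⊗ 0≤τ ⊕ 0≤c ⊗ 0≤c))
      (trans (cong (_+ c * c * (fromℕ 2 + fromℕ 4 * (1ℚ - c) + c * c)) (solve 1 (λ ρ → ρ := con 1ℚ :- con (fromℕ 4) :* (con (ℤ.+ 1 / 4) :* (con 1ℚ :- ρ))) refl ρ))
        (solve 1 (λ c → (con 1ℚ :- con (fromℕ 4) :* c) :+ c :* c :* (con (fromℕ 2) :+ con (fromℕ 4) :* (con 1ℚ :- c) :+ c :* c)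
          := (con 1ℚ :- c) :* (con 1ℚ :- c) :* ((con 1ℚ :- c) :* (con 1ℚ :- c))) refl c))

  0<c³ : 0ℚ < c * c * c
  0<c³ = *-pos (*-pos 0<c 0<c) 0<c

  -- A lower bound for k, unrelated to the critical load: the first summand yields k c ≥ 2 and hence
  -- τ^k ≤ 1/2, the second D ≤ c³ k and hence D τ^k ≤ c².
  threshold : ℚ
  threshold = fromℕ 2 * inv c 0<c + D * inv (c * c * c) 0<c³

  J n₀ : ℕ
  J = proj₁ (archimedean threshold)
  n₀ = J ℕ.* J

  module _ (n k : ℕ) (n≤k² : n ℕ.≤ k ℕ.* k) (J≤k : J ℕ.≤ k) where

    X F : ℚ
    X = τ ^ k
    F = fromℕ n * D * ρ ^ k

    0≤X : 0ℚ ≤ X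
    0≤X = ^-nonNeg 0≤τ k

    threshold≤k : threshold ≤ fromℕ k
    threshold≤k = ℚP.≤-trans (proj₂ (archimedean threshold)) (fromℕ-mono J≤k)

    2≤kc : fromℕ 2 ≤ fromℕ k * c
    2≤kc = ℚP.≤-trans
      (≤-by-difference (D * inv (c * c * c) 0<c³ * c) (0≤D ⊗ ℚP.<⇒≤ (inv-pos (c * c * c) 0<c³) ⊗ 0≤c)
        (trans (cong (_+ D * inv (c * c * c) 0<c³ * c) (sym (trans (cong (fromℕ 2 *_) (*-inv c 0<c)) (ℚP.*-identityʳ (fromℕ 2)))))
          (solve 4 (λ t c i e → t :* (c :* i) :+ e :* c := (t :* i :+ e) :* c) refl (fromℕ 2) c (inv c 0<c) (D * inv (c * c * c) 0<c³))))
      (*-monoʳ c 0≤c threshold≤k)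

    D≤c³k : D ≤ c * c * c * fromℕ k
    D≤c³k = ℚP.≤-trans
      (≤-by-difference (c * c * c * (fromℕ 2 * inv c 0<c)) (ℚP.<⇒≤ 0<c³ ⊗ (fromℕ-nonNeg 2 ⊗ ℚP.<⇒≤ (inv-pos c 0<c)))
        (trans (cong (_+ c * c * c * (fromℕ 2 * inv c 0<c)) (sym (trans (cong (D *_) (*-inv (c * c * c) 0<c³)) (ℚP.*-identityʳ D))))
          (solve 4 (λ d q i e → d :* (q :* i) :+ q :* e := q :* (e :+ d :* i)) refl D (c * c * c) (inv (c * c * c) 0<c³) (fromℕ 2 * inv c 0<c))))
      (*-monoˡ (c * c * c) (ℚP.<⇒≤ 0<c³) threshold≤k)

    kcX≤1 : fromℕ k * c * X ≤ 1ℚ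
    kcX≤1 = ℚP.≤-trans (≤-by-difference X 0≤X (solve 2 (λ a x → a :* x :+ x := (con 1ℚ :+ a) :* x) refl (fromℕ k * c) X)) (bernoulli k)

    X≤½ : fromℕ 2 * X ≤ 1ℚ
    X≤½ = ℚP.≤-trans (*-monoʳ X 0≤X 2≤kc) kcX≤1

    DX≤c² : D * X ≤ c * c
    DX≤c² = ℚP.≤-trans (*-monoʳ X 0≤X D≤c³k) (ℚP.≤-trans
      (ℚP.≤-reflexive (solve 3 (λ c k x → c :* c :* c :* k :* x := c :* c :* (k :* c :* x)) refl c (fromℕ k) X))
      (ℚP.≤-trans (*-monoˡ (c * c) (0≤c ⊗ 0≤c) kcX≤1) (ℚP.≤-reflexive (ℚP.*-identityʳ (c * c)))))

    -- With ρ^k ≤ X⁴ and n ≤ k², two factors X absorb k², a third absorbs D, and the fourth remains: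
    -- c² F ≤ (k c X)² (D X) X ≤ c² X.
    F≤X : F ≤ X
    F≤X = *-cancelˡ-≤ (*-pos 0<c 0<c) (begin
      c * c * (fromℕ n * D * ρ ^ k)
        ≤⟨ *-monoˡ (c * c) (0≤c ⊗ 0≤c) (*-mono (fromℕ-nonNeg n ⊗ 0≤D) (0≤X ⊗ 0≤X ⊗ (0≤X ⊗ 0≤X))
             (*-monoʳ D 0≤D (ℚP.≤-trans (fromℕ-mono n≤k²) (ℚP.≤-reflexive (fromℕ-* k k)))) (ρ^k≤τ^4k k)) ⟩
      c * c * (fromℕ k * fromℕ k * D * (X * X * (X * X)))
        ≡⟨ solve 4 (λ c k d x → c :* c :* (k :* k :* d :* (x :* x :* (x :* x))) := (k :* c :* x) :* (k :* c :* x) :* (d :* x :* x)) refl c (fromℕ k) D X ⟩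
      (fromℕ k * c * X) * (fromℕ k * c * X) * (D * X * X)
        ≤⟨ *-mono ((fromℕ-nonNeg k ⊗ 0≤c ⊗ 0≤X) ⊗ (fromℕ-nonNeg k ⊗ 0≤c ⊗ 0≤X)) (0≤c ⊗ 0≤c ⊗ 0≤X)
             (*-mono (fromℕ-nonNeg k ⊗ 0≤c ⊗ 0≤X) 0≤1 kcX≤1 kcX≤1) (*-monoʳ X 0≤X DX≤c²) ⟩
      1ℚ * 1ℚ * (c * c * X)
        ≡⟨ ℚP.*-identityˡ (c * c * X) ⟩
      c * c * X ∎)
      where open ℚP.≤-Reasoning

  module Table (n m : ℕ) {{_ : NonZero n}} (n₀≤n : n₀ ℕ.≤ n) (m≤an : fromℕ m ≤ a * fromℕ n) where

    -- The predecessor gives the largest κ with κ² < n strictly, also when n is a square; then k = κ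
    -- + 1 is at least √n.
    κ k M : ℕ
    κ = isqrt (ℕ.pred n)
    k = suc κ
    M = suc m

    κ²<n : κ ℕ.* κ ℕ.< n
    κ²<n = ℕP.≤-<-trans (proj₁ (isqrt-spec (ℕ.pred n))) (ℕP.≤-reflexive (ℕP.suc-pred n))

    n≤k² : n ℕ.≤ k ℕ.* k
    n≤k² = subst (ℕ._≤ k ℕ.* k) (ℕP.suc-pred n) (proj₂ (isqrt-spec (ℕ.pred n)))

    J≤k : J ℕ.≤ k
    J≤k = SqrtLemmas.square-cancel J k (ℕP.≤-trans n₀≤n n≤k²)

    open Quadratic κ κ²<n

    E : Event n M
    E = good {m}

    0≤n : 0ℚ ≤ fromℕ n
    0≤n = fromℕ-nonNeg n

    0≤n^ : ∀ t → 0ℚ ≤ fromℕ n ^ t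
    0≤n^ = ^-nonNeg 0≤n

    L : ℚ
    L = ρ ^ k * r

    0≤L : 0ℚ ≤ L
    0≤L = ^-nonNeg 0≤ρ k ⊗ 0≤r

    divide : ∀ {s q} → s * (1ℚ - ρ) ≤ q → s ≤ q * r
    divide {s} {q} h = subst (_≤ q * r) (trans (ℚP.*-assoc s (1ℚ - ρ) r) (trans (cong (s *_) (*-inv (1ℚ - ρ) 0<1-ρ)) (ℚP.*-identityʳ s)))
      (*-monoʳ r 0≤r h)

    ≤an : ∀ {t} → t ℕ.≤ m → fromℕ t ≤ a * fromℕ n
    ≤an h = ℚP.≤-trans (fromℕ-mono h) m≤an

    failures-≤ : ∀ t → t ℕ.≤ M → fromℕ (failures t) ≤ fromℕ t * (fromℕ 16 * L) * fromℕ n ^ t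
    failures-≤ zero    h = ℚP.≤-reflexive (solve 1 (λ l → con 0ℚ := con 0ℚ :* l :* con 1ℚ) refl (fromℕ 16 * L))
    failures-≤ (suc t) (s≤s h) = begin
      fromℕ (mass isLarge t ℕ.+ n ℕ.* failures t)
        ≡⟨ trans (/-+ (mass isLarge t) _ 1) (cong (λ x → fromℕ (mass isLarge t) + x) (fromℕ-* n (failures t))) ⟩
      fromℕ (mass isLarge t) + fromℕ n * fromℕ (failures t)
        ≤⟨ ℚP.+-mono-≤ (ℚP.≤-trans (∑Antidiagonal-≤ isLarge t n (≤an h)) (*-monoˡ _ (fromℕ-nonNeg 16 ⊗ 0≤n^ (suc t)) (divide (tail-≤ κ (suc t)))))
                       (*-monoˡ (fromℕ n) 0≤n (failures-≤ t (ℕP.m≤n⇒m≤1+n h))) ⟩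
      fromℕ 16 * fromℕ n ^ suc t * L + fromℕ n * (fromℕ t * (fromℕ 16 * L) * fromℕ n ^ t)
        ≡⟨ solve 5 (λ s n p l t → s :* (n :* p) :* l :+ n :* (t :* (s :* l) :* p) := (t :+ con 1ℚ) :* (s :* l) :* (n :* p)) refl
             (fromℕ 16) (fromℕ n) (fromℕ n ^ t) L (fromℕ t) ⟩
      (fromℕ t + 1ℚ) * (fromℕ 16 * L) * fromℕ n ^ suc t
        ≡⟨ cong (λ x → x * (fromℕ 16 * L) * fromℕ n ^ suc t) (sym (fromℕ-suc t)) ⟩
      fromℕ (suc t) * (fromℕ 16 * L) * fromℕ n ^ suc t ∎
      where open ℚP.≤-Reasoning

    1≤n : 1ℚ ≤ fromℕ n
    1≤n = fromℕ-mono (ℕP.≤-trans (s≤s z≤n) (ℕP.≤-reflexive (ℕP.suc-pred n)))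

    M≤2n : fromℕ M ≤ fromℕ 2 * fromℕ n
    M≤2n = subst (_≤ fromℕ 2 * fromℕ n) (sym (fromℕ-suc m)) (≤-by-difference ((1ℚ - a) * fromℕ n + (a * fromℕ n - fromℕ m) + (fromℕ n - 1ℚ))
      (p≤q⇒0≤q-p a≤1 ⊗ 0≤n ⊕ p≤q⇒0≤q-p m≤an ⊕ p≤q⇒0≤q-p 1≤n)
      (solve 3 (λ m a n → m :+ con 1ℚ :+ ((con 1ℚ :- a) :* n :+ (a :* n :- m) :+ (n :- con 1ℚ)) := con (fromℕ 2) :* n) refl (fromℕ m) a (fromℕ n)))

    X₀ F₀ N : ℚ
    X₀ = X n k n≤k² J≤k
    F₀ = F n k n≤k² J≤k
    N = fromℕ n ^ M

    -- The union bound over M ≤ 2 n insertions, each failing with probability at most 16 r ρ^k; the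
    -- product 2 · 16 is the 32 in D.
    size-≥ : N ≤ fromℕ (size E) + F₀ * N
    size-≥ = begin
      fromℕ n ^ M                               ≡⟨ sym (fromℕ-^ n M) ⟩
      fromℕ (n ℕ.^ M)                           ≤⟨ fromℕ-mono (∑Word-ok-≥ M) ⟩
      fromℕ (∑Word M (𝟙 ∘ Scheme.ok later) ℕ.+ failures M)              ≡⟨ trans (cong (λ s → fromℕ (s ℕ.+ failures M)) (sym (size-good {m}))) (/-+ (size E) (failures M) 1) ⟩
      fromℕ (size E) + fromℕ (failures M)
        ≤⟨ ℚP.+-monoʳ-≤ (fromℕ (size E)) (ℚP.≤-trans (failures-≤ M ℕP.≤-refl)
             (*-monoʳ N (0≤n^ M) (*-monoʳ (fromℕ 16 * L) (fromℕ-nonNeg 16 ⊗ 0≤L) M≤2n))) ⟩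
      fromℕ (size E) + fromℕ 2 * fromℕ n * (fromℕ 16 * (ρ ^ k * r)) * N
        ≡⟨ cong (λ x → fromℕ (size E) + x * N) (solve 3 (λ n p r → con (fromℕ 2) :* n :* (con (fromℕ 16) :* (p :* r)) := n :* (con (fromℕ 32) :* r) :* p) refl (fromℕ n) (ρ ^ k) r) ⟩
      fromℕ (size E) + F₀ * N ∎
      where open ℚP.≤-Reasoning

    0<N : 0ℚ < N
    0<N = pos M
      where
      pos : ∀ t → 0ℚ < fromℕ n ^ t
      pos zero    = 0<1
      pos (suc t) = *-pos (ℚP.<-≤-trans 0<1 1≤n) (pos t)

    size-≥-half : N ≤ fromℕ 2 * fromℕ (size E)
    size-≥-half = ≤-by-difference (fromℕ 2 * (fromℕ (size E) + F₀ * N - N) + fromℕ 2 * (X₀ - F₀) * N + (1ℚ - fromℕ 2 * X₀) * N)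
      (fromℕ-nonNeg 2 ⊗ p≤q⇒0≤q-p size-≥ ⊕ fromℕ-nonNeg 2 ⊗ p≤q⇒0≤q-p (F≤X n k n≤k² J≤k) ⊗ ℚP.<⇒≤ 0<N ⊕
       p≤q⇒0≤q-p (X≤½ n k n≤k² J≤k) ⊗ ℚP.<⇒≤ 0<N)
      (solve 4 (λ N s f x → N :+ (con (fromℕ 2) :* (s :+ f :* N :- N) :+ con (fromℕ 2) :* (x :- f) :* N :+ (con 1ℚ :- con (fromℕ 2) :* x) :* N) := con (fromℕ 2) :* s)
        refl N (fromℕ (size E)) F₀ X₀)

    size≢0 : NonZero (size E)
    size≢0 = nonZero (size E) size-≥-half
      where
      nonZero : ∀ s → N ≤ fromℕ 2 * fromℕ s → NonZero s
      nonZero zero    h = ⊥-elim (≤<-absurd h 0<N)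
      nonZero (suc s) h = _

    Pr-≥ : 1ℚ ≤ Pr E + X₀
    Pr-≥ = *-cancelˡ-≤ 0<N (≤-by-difference ((fromℕ (size E) + F₀ * N - N) + (X₀ - F₀) * N)
      (p≤q⇒0≤q-p size-≥ ⊕ p≤q⇒0≤q-p (F≤X n k n≤k² J≤k) ⊗ ℚP.<⇒≤ 0<N)
      (trans (solve 4 (λ N s f x → N :* con 1ℚ :+ ((s :+ f :* N :- N) :+ (x :- f) :* N) := s :+ N :* x) refl N (fromℕ (size E)) F₀ X₀)
        (trans (cong (_+ N * X₀) (sym (trans (ℚP.*-comm N (Pr E)) (trans (cong (Pr E *_) (sym (fromℕ-^ n M))) (/-*-fromℕ (size E) (n ℕ.^ M) {{ℕP.m^n≢0 n M}})))))
          (sym (ℚP.*-distribˡ-+ N (Pr E) X₀)))))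

    -- τ^k = (1 - c)^k ≤ e^(- c k) ≤ e^(- c √n), because k ≥ √n; `exp-neg-≥` states this up to an
    -- error for the partial sums, which is taken as half of ε.
    success-probability : 1ᴿ -ᴿ exp (-ᴿ (fromℚ c *ᴿ √ n)) ≤ᴿ fromℚ (Pr E)
    success-probability ε 0<ε = proj₁ lower , λ i hi → ℚP.≤-<-trans
      (≤-by-difference ((Pr E + X₀ - 1ℚ) + (expSum (- (c * √-approx n i)) i + ½ * ε - X₀))
        (p≤q⇒0≤q-p Pr-≥ ⊕ p≤q⇒0≤q-p (proj₂ lower i hi (c * √-approx n i) (0≤c ⊗ 0≤√ i) (c√≤ i)))
        (solve 4 (λ q p x e → (con 1ℚ :- q) :+ ((p :+ x :- con 1ℚ) :+ (q :+ e :- x)) := p :+ e) refl (expSum (- (c * √-approx n i)) i) (Pr E) X₀ (½ * ε)))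
      (ℚP.+-monoʳ-< (Pr E) ½ε<ε)
      where
      lower = exp-neg-≥ c 0≤c c≤1 k (½ * ε) (half-pos 0<ε)
      0≤√ : ∀ i → 0ℚ ≤ √-approx n i
      0≤√ i = /-nonNeg (isqrt (n ℕ.* (suc i ℕ.* suc i))) (suc i)
      c√≤ : ∀ i → c * √-approx n i ≤ fromℕ k * c
      c√≤ i = subst (c * √-approx n i ≤_) (ℚP.*-comm c (fromℕ k)) (*-monoˡ c 0≤c (√-approx-≤ n k n≤k² i))
      ½ε<ε : ½ * ε < ε
      ½ε<ε = subst₂ _<_ (ℚP.+-identityʳ (½ * ε)) (halves ε) (ℚP.+-monoʳ-< (½ * ε) (half-pos 0<ε))

    total : ℕ
    total = sum (List.map lastCost (filterᵇ E (outcomes n M)))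

    -- Σ (i + 1) ρ^i ≤ r² bounds the total by 16 r² n^M; conditioning on an event of probability at
    -- least 1/2 doubles the constant.
    total-≤ : fromℕ total ≤ C * fromℕ (size E)
    total-≤ = begin
      fromℕ total                                        ≤⟨ fromℕ-mono (total-cost-≤ {m}) ⟩
      fromℕ (mass suc m)                                 ≤⟨ ∑Antidiagonal-≤ suc m n m≤an ⟩
      fromℕ 16 * N * partialSum (λ i → fromℕ (suc i) * ρ ^ i) M
        ≤⟨ *-monoˡ (fromℕ 16 * N) (fromℕ-nonNeg 16 ⊗ ℚP.<⇒≤ 0<N) (divide (divide (arithmetic-≤ M))) ⟩
      fromℕ 16 * N * (1ℚ * r * r)                        ≡⟨ solve 2 (λ N r → con (fromℕ 16) :* N :* (con 1ℚ :* r :* r) := con (fromℕ 16) :* (r :* r) :* N) refl N r ⟩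
      fromℕ 16 * (r * r) * N                             ≤⟨ *-monoˡ _ (fromℕ-nonNeg 16 ⊗ (0≤r ⊗ 0≤r)) size-≥-half ⟩
      fromℕ 16 * (r * r) * (fromℕ 2 * fromℕ (size E))    ≡⟨ solve 2 (λ s r → con (fromℕ 16) :* (r :* r) :* (con (fromℕ 2) :* s) := con (fromℕ 32) :* (r :* r) :* s) refl (fromℕ (size E)) r ⟩
      C * fromℕ (size E)                                 ∎
      where open ℚP.≤-Reasoning

    expected-cost : fromℚ (𝔼[ lastCost ∣ E ] {{size≢0}}) ≤ᴿ fromℚ C
    expected-cost ε 0<ε = 0 , λ _ _ → ℚP.≤-<-trans mean (subst (_< C + ε) (ℚP.+-identityʳ C) (ℚP.+-monoʳ-< C 0<ε))
      where
      0<size : 0ℚ < fromℕ (size E)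
      0<size = *-cancelˡ-< (ℚP.<-≤-trans (subst (_< N) refl 0<N) size-≥-half)
        where
        *-cancelˡ-< : 0ℚ < fromℕ 2 * fromℕ (size E) → 0ℚ < fromℕ (size E)
        *-cancelˡ-< h = ℚP.*-cancelˡ-<-nonNeg (fromℕ 2) (subst (_< fromℕ 2 * fromℕ (size E)) (sym (ℚP.*-zeroʳ (fromℕ 2))) h)
      mean : 𝔼[ lastCost ∣ E ] {{size≢0}} ≤ C
      mean = *-cancelˡ-≤ 0<size (subst₂ _≤_ (sym (trans (ℚP.*-comm (fromℕ (size E)) _) (/-*-fromℕ total (size E) {{size≢0}})))
        (ℚP.*-comm C (fromℕ (size E))) total-≤)

corollary1p2 : (α* : ℝ) → IsThreshold α* →
    (α : ℝ) → 0ᴿ ≤ᴿ α → α <ᴿ α* →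
    ∃ λ (C : ℝ) → ∃ λ (c : ℝ) → ∃ λ (n₀ : ℕ) →
    0ᴿ <ᴿ C × 0ᴿ <ᴿ c ×
    ((n m : ℕ) .{{_ : NonZero n}} → n₀ ℕ.≤ n → natᴿ m ≃ᴿ α *ᴿ natᴿ n →
    ∃ λ (E : Event n (suc m)) →
    1ᴿ -ᴿ exp (-ᴿ (c *ᴿ √ n)) ≤ᴿ fromℚ (Pr E) ×
    ((ω : Vec (Fin n) (suc m)) → ω ∈ᴱ E → AllSucceed ω) ×
    Σ (NonZero (size E)) λ E≢∅ → fromℚ (𝔼[ lastCost ∣ E ] {{E≢∅}}) ≤ᴿ C)
corollary1p2 α* α*-threshold α 0≤α α<α* = fromℚ A.C , fromℚ A.c , A.n₀ , positive A.0<C , positive A.0<c , λ where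
    n@(suc _) m n₀≤n m≃αn → let module Q = A.Table n m n₀≤n (Subcritical.load S n m m≃αn) in
      Q.E , Q.success-probability , Quadratic.good-succeeds Q.κ Q.κ²<n , Q.size≢0 , Q.expected-cost
  where
  S : Subcritical α
  S = subcritical-load α* α*-threshold α 0≤α α<α*
  module A = Assembly S
  positive : ∀ {q} → 0ℚ < q → 0ᴿ <ᴿ fromℚ q
  positive {q} 0<q = ½ * q , half-pos 0<q , 0 , λ _ _ → subst₂ _<_ (sym (ℚP.+-identityˡ (½ * q))) (halves q)
    (subst (_< ½ * q + ½ * q) (ℚP.+-identityʳ (½ * q)) (ℚP.+-monoʳ-< (½ * q) (half-pos 0<q)))
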